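{- Let $\mathcal B$ be an approximable interpretation basis. For any net $S$ and any sequent $\Gamma$: if $S\vdash_{\mathsf{MLL}^\maltese}\Gamma$ (i.e. $S$ represents an $\mathsf{MLL}^\maltese$ proof of $\Gamma$), then $S\in[\![\Gamma]\!]_{\mathcal B}$ (i.e. $S$ realises $\Gamma$ with respect to $\mathcal B$).
   Context: **Nets.** Fix a countable set of positions. A hypergraph has a finite set $V$ of positions and a finite set $E$ of labelled links; each link has a source and a target, which are finite sequences of pairwise distinct positions, the source and the target being disjoint. The only links used are: tensor links $\langle p_1,p_2\rhd_\otimes p\rangle$ and par links $\langle p_1,p_2\rhd_\wp p\rangle$ (two inputs, one output), cut links $\langle p_1,p_2\rhd_{\mathsf{cut}}\rangle$ (two inputs, no output), and daimon links $\langle\rhd_\maltese p_1,\dots,p_n\rangle$, $n\ge 0$ (no input). ($\wp$ denotes the par connective.) The sum $H_1+H_2$ takes the union of positions and the disjoint union of links. A conclusion is a position that is in the source of no link. A (multiplicative) net $S$ is a finite sum of such links in which every position is in the target of exactly one link and in the source of at most one link, together with a total order on its conclusions; $S(i)$ is the $i$-th conclusion and $\#S$ the number of conclusions. Nets are considered up to isomorphism. $S\parallel T$ is the disjoint union (after renaming positions), with the conclusions of $S$ ordered before those of $T$. $\maltese_n$ is the net made of one daimon link with $n$ outputs. **Cut elimination** $\to$ is the closure under sum with a context of the following rules (insensitive to the order of the inputs of cut links; conclusions and their order are unchanged): (i) $\langle p_1,p_2\rhd_\wp p\rangle+\langle p,q\rhd_{\mathsf{cut}}\rangle+\langle q_1,q_2\rhd_\otimes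 q\rangle\to\langle p_1,q_1\rhd_{\mathsf{cut}}\rangle+\langle p_2,q_2\rhd_{\mathsf{cut}}\rangle$; (ii) for two distinct daimon links, $\langle\rhd_\maltese\bar p\rangle+\langle p_i,q_j\rhd_{\mathsf{cut}}\rangle+\langle\rhd_\maltese\bar q\rangle\to\langle\rhd_\maltese\bar p\setminus p_i,\bar q\setminus q_j\rangle$; (iii) $\langle p_1,p_2\rhd_\otimes p\rangle+\langle p,q\rhd_{\mathsf{cut}}\rangle+\langle\rhd_\maltese\bar a,q,\bar b\rangle\to\langle p_1,q^1\rhd_{\mathsf{cut}}\rangle+\langle p_2,q^2\rhd_{\mathsf{cut}}\rangle+\langle\rhd_\maltese\bar a,q^1,q^2,\bar b\rangle$ with $q^1,q^2$ fresh; (iv) $\langle q_1,q_2\rhd_\wp q\rangle+\langle q,p\rhd_{\mathsf{cut}}\rangle+\langle\rhd_\maltese\bar a,p,\bar b\rangle\to\langle q_1,p^1\rhd_{\mathsf{cut}}\rangle+\langle q_2,p^2\rhd_{\mathsf{cut}}\rangle+\langle\rhd_\maltese\bar a',p^1,\bar b'\rangle+\langle\rhd_\maltese\bar a'',p^2,\bar b''\rangle$ with $p^1,p^2$ fresh, for any choice of sequences such that $\bar a',\bar a''$ enumerate a splitting of $\bar a$ into two (possibly empty) parts and $\bar b',\bar b''$ one of $\bar b$. In (iii) and (iv) the inputs of the connective link may themselves be outputs of the daimon link involved. Other cuts are not reducible. $\to^*$ is the reflexive transitive closure. **Orthogonality and types.** For nets $S,T$ with $k=\min(\#S,\#T)$,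 the interaction $S::T$ is $S+T+\sum_{1\le i\le k}\langle S(i),T(i)\rhd_{\mathsf{cut}}\rangle$ ($S,T$ made disjoint), the remaining conclusions keeping their order. $S\perp T$ iff there exists a reduction $S::T\to^*\maltese_0$. For a set $A$ of nets, $A^\bot=\{P\mid\forall R\in A,\ P\perp R\}$; a type is a set $\mathbf A$ with $\mathbf A^{\bot\bot}=\mathbf A$. If $\mathbf A,\mathbf A^\bot$ are nonempty, all their nets have the same number of conclusions, written $\#\mathbf A$; otherwise the condition $\#S\ge\#\mathbf A$ below is read as vacuous. Define $\mathbf A\rightthreetimes\mathbf B=\{S\mid \forall T\in\mathbf A^\bot,\ S::T\in\mathbf B,\text{ and }\#S\ge\#\mathbf A\}$, $\mathbf A\parallel\mathbf B=\{S\parallel T\mid S\in\mathbf A,T\in\mathbf B\}^{\bot\bot}$, and, for types whose nets have one conclusion and $p$ a fresh position, $\mathbf A\otimes\mathbf B=\{S+\langle S(1),S(2)\rhd_\otimes p\rangle\mid S\in\mathbf A\parallel\mathbf B\}^{\bot\bot}$, $\mathbf A\wp\mathbf B=\{S+\langle S(1),S(2)\rhd_\wp p\rangle\mid S\in\mathbf A\rightthreetimes\mathbf B\}^{\bot\bot}$. **Logic.** Propositional variables form a countable set with an involution $X\mapsto X^\bot$. Formulas: $A,B::=X\mid A\wp B\mid A\otimes B$, with $(A\wp B)^\bot=A^\bot\otimes B^\bot$, $(A\otimes B)^\bot=A^\bot\wp B^\bot$. Sequents are finite sequences of formulas. $\mathsf{MLL}^\maltese$ proofs are trees built with the rules: ($\maltese$)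 infer any $\Gamma$ with no premise; ($\wp$) from $\Gamma,A,B$ infer $\Gamma,A\wp B$; ($\otimes$) from $\Gamma,A$ and $\Delta,B$ infer $\Gamma,\Delta,A\otimes B$; (cut) from $\Gamma,A$ and $\Delta,A^\bot$ infer $\Gamma,\Delta$; (ex) exchange of two consecutive formulas. A net $S$ represents a proof $\pi$ of $A_1,\dots,A_n$ (the $i$-th conclusion of $S$ corresponding to $A_i$), inductively: a $\maltese$-rule is represented by a single daimon link $\langle\rhd_\maltese p_1,\dots,p_n\rangle$ with conclusions ordered $p_1,\dots,p_n$; a $\wp$-rule by adding a par link with fresh output to the conclusions for $A,B$ of a net representing the premise; a $\otimes$-rule (resp. cut-rule) by the disjoint sum of nets representing the premises plus a tensor link with fresh output (resp. a cut link) on the conclusions for the two active formulas; exchange by exchanging the two conclusions in the order. $S\vdash_{\mathsf{MLL}^\maltese}\Gamma$ means that $S$ represents some $\mathsf{MLL}^\maltese$ proof of $\Gamma$. **Interpretation.** An interpretation basis $\mathcal B$ associates to each propositional variable $X$ a type $[\![X]\!]_{\mathcal B}$ all of whose nets have one conclusion, with $[\![X^\bot]\!]_{\mathcal B}\subseteq[\![X]\!]_{\mathcal B}^\bot$ for all $X$. It is extended by $[\![A\otimes B]\!]_{\mathcal B}=[\![A]\!]_{\mathcal B}\otimes[\![B]\!]_{\mathcal B}$, $[\![A\wp B]\!]_{\mathcal B}=[\![A]\!]_{\mathcal B}\wp[\![B]\!]_{\mathcal B}$, and for a sequent $[\![A_1,\dots,A_n]\!]_{\mathcal B}=[\![A_1]\!]_{\mathcal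 B}\rightthreetimes\cdots\rightthreetimes[\![A_n]\!]_{\mathcal B}$ ($\rightthreetimes$ is associative on types). $\mathcal B$ is approximable if $\maltese_1\in[\![X]\!]_{\mathcal B}$ for every propositional variable $X$. -}

module Defs where

open import Level using (0ℓ)
open import Data.List.Base
  using (List; []; _∷_; _++_; map; concatMap; length; drop; zipWith; upTo)
open import Data.List.Membership.Propositional
  using () renaming (_∈_ to _∈ˡ_; _∉_ to _∉ˡ_)
open import Data.List.Relation.Binary.Disjoint.Propositional using (Disjoint)
open import Data.List.Relation.Binary.Permutation.Propositional using (_↭_)
open import Data.List.Relation.Binary.Subset.Propositional
  using () renaming (_⊆_ to _⊆ˡ_)
open import Data.List.Relation.Unary.All using (All)
open import Data.List.Relation.Unary.Unique.Propositional using (Unique)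
open import Data.Nat.Base using (ℕ; suc; _*_; _≤_)
open import Data.Product.Base using (∃-syntax; Σ-syntax; _×_)
open import Data.Sum.Base using (_⊎_)
open import Function.Bundles using (_⇔_; _↣_)
open import Relation.Binary.Construct.Closure.ReflexiveTransitive using (Star)
open import Relation.Binary.PropositionalEquality.Core using (_≡_; _≢_)
open import Relation.Unary using (Pred; _∈_; _⊆_; _≐_; ｛_｝)

------------------------------------------------------------------------
-- Nets

Pos : Set
Pos = ℕ

data Link : Set where
  tensor par : (p₁ p₂ p : Pos) → Link
  cut        : (p₁ p₂ : Pos) → Link
  daimon     : (ps : List Pos) → Link

source target : Link → List Pos
source (tensor p₁ p₂ p) = p₁ ∷ p₂ ∷ []
source (par p₁ p₂ p)    = p₁ ∷ p₂ ∷ []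
source (cut p₁ p₂)      = p₁ ∷ p₂ ∷ []
source (daimon ps)      = []
target (tensor p₁ p₂ p) = p ∷ []
target (par p₁ p₂ p)    = p ∷ []
target (cut p₁ p₂)      = []
target (daimon ps)      = ps

record WellFormedLink (l : Link) : Set where
  field
    source-distinct : Unique (source l)
    target-distinct : Unique (target l)
    disjoint        : Disjoint (source l) (target l)

-- The links form a multiset: lists of links are only ever compared up to
-- permutation.  The set of positions is left implicit, since in a net every
-- position belongs to the target of some link.

Hypergraph : Set
Hypergraph = List Link

sources targets positions : Hypergraph → List Pos
sources     = concatMap source
targets     = concatMap target
positions H = sources H ++ targets H

record PreNet : Set where
  constructor ⟨_,_⟩
  field
    links       : Hypergraph
    conclusions : List Pos

open PreNet public

#_ : PreNet → ℕ
# S = length (conclusions S)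

infix 8 #_

-- Because links have distinct outputs (resp. inputs), uniqueness of the
-- concatenation of all targets (resp. sources) says that no position is in
-- the target (resp. source) of two different links.

record IsNet (S : PreNet) : Set where
  private H = links S
  field
    links-wf             : All WellFormedLink H
    some-target          : positions H ⊆ˡ targets H
    at-most-one-target   : Unique (targets H)
    at-most-one-source   : Unique (sources H)
    conclusions-distinct : Unique (conclusions S)
    conclusions-spec     : ∀ p → p ∈ˡ conclusions S ⇔ (p ∈ˡ positions H × p ∉ˡ sources H)

renameLink : (Pos → Pos) → Link → Link
renameLink f (tensor p₁ p₂ p) = tensor (f p₁) (f p₂) (f p)
renameLink f (par p₁ p₂ p)    = par (f p₁) (f p₂) (f p)
renameLink f (cut p₁ p₂)      = cut (f p₁) (f p₂)
renameLink f (daimon ps)      = daimon (map f ps)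

rename : (Pos → Pos) → Hypergraph → Hypergraph
rename f = map (renameLink f)

-- Only the restrictions of `to` and `from` to the positions of S and T matter.

record _≅_ (S T : PreNet) : Set where
  field
    to from     : Pos → Pos
    from∘to     : ∀ {p} → p ∈ˡ positions (links S) → from (to p) ≡ p
    to∘from     : ∀ {p} → p ∈ˡ positions (links T) → to (from p) ≡ p
    links-≅       : rename to (links S) ↭ links T
    conclusions-≅ : map to (conclusions S) ≡ conclusions T

infix 4 _≅_

∅ : PreNet
∅ = ⟨ [] , [] ⟩

✠ : ℕ → PreNet
✠ n = ⟨ daimon (upTo n) ∷ [] , upTo n ⟩

-- Injections with disjoint ranges, used to make two nets disjoint.

left right : Pos → Pos
left  p = 2 * p
right p = suc (2 * p)

infixr 6 _⊕_
_⊕_ : Hypergraph → Hypergraph → Hypergraph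
G ⊕ H = rename left G ++ rename right H

infixr 6 _∥_
_∥_ : PreNet → PreNet → PreNet
S ∥ T = ⟨ links S ⊕ links T
        , map left (conclusions S) ++ map right (conclusions T) ⟩

-- `zipWith` stops at the shorter list, and one of the two lists of remaining
-- conclusions is empty.

infix 6 _∷∷_
_∷∷_ : PreNet → PreNet → PreNet
S ∷∷ T = ⟨ zipWith cut s t ++ (links S ⊕ links T)
         , drop (# T) s ++ drop (# S) t ⟩
  where
  s = map left  (conclusions S)
  t = map right (conclusions T)

------------------------------------------------------------------------
-- Cut elimination

CutBetween : Pos → Pos → Link → Set
CutBetween p q c = c ≡ cut p q ⊎ c ≡ cut q p

-- V is the list of names with respect to which new positions must be fresh.

infix 3 _⊢_↝_
data _⊢_↝_ (V : List Pos) : Hypergraph → Hypergraph → Set where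

  par-tensor : ∀ {c p₁ p₂ p q₁ q₂ q} → CutBetween p q c →
    V ⊢ par p₁ p₂ p ∷ c ∷ tensor q₁ q₂ q ∷ []
      ↝ cut p₁ q₁ ∷ cut p₂ q₂ ∷ []

  daimon-daimon : ∀ {c a p b a′ q b′} → CutBetween p q c →
    V ⊢ daimon (a ++ p ∷ b) ∷ c ∷ daimon (a′ ++ q ∷ b′) ∷ []
      ↝ daimon ((a ++ b) ++ (a′ ++ b′)) ∷ []

  tensor-daimon : ∀ {c p₁ p₂ p a q b q¹ q²} → CutBetween p q c →
    q¹ ∉ˡ V → q² ∉ˡ V → q¹ ≢ q² →
    V ⊢ tensor p₁ p₂ p ∷ c ∷ daimon (a ++ q ∷ b) ∷ []
      ↝ cut p₁ q¹ ∷ cut p₂ q² ∷ daimon (a ++ q¹ ∷ q² ∷ b) ∷ []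

  par-daimon : ∀ {c q₁ q₂ q a p b p¹ p² a′ a″ b′ b″} → CutBetween q p c →
    p¹ ∉ˡ V → p² ∉ˡ V → p¹ ≢ p² →
    a′ ++ a″ ↭ a → b′ ++ b″ ↭ b →
    V ⊢ par q₁ q₂ q ∷ c ∷ daimon (a ++ p ∷ b) ∷ []
      ↝ cut q₁ p¹ ∷ cut q₂ p² ∷ daimon (a′ ++ p¹ ∷ b′) ∷ daimon (a″ ++ p² ∷ b″) ∷ []

record _⟶_ (S T : PreNet) : Set where
  field
    {redex reduct context} : Hypergraph
    rule          : positions (links S) ⊢ redex ↝ reduct
    before        : links S ↭ redex ++ context
    after         : links T ↭ reduct ++ context
    conclusions-≡ : conclusions T ≡ conclusions S

infix 4 _⟶_ _⟶*_

_⟶*_ : PreNet → PreNet → Set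
_⟶*_ = Star _⟶_

------------------------------------------------------------------------
-- Orthogonality and types

-- `✠ 0` has no positions, so being isomorphic to it is being equal to it.

infix 4 _⊥_
_⊥_ : PreNet → PreNet → Set
S ⊥ T = S ∷∷ T ⟶* ✠ 0

NetSet : Set₁
NetSet = Pred PreNet 0ℓ

infix 10 _^⊥
_^⊥ : NetSet → NetSet
(A ^⊥) P = IsNet P × (∀ R → R ∈ A → P ⊥ R)

-- In particular, all elements of a type are nets.

IsType : NetSet → Set
IsType A = A ^⊥ ^⊥ ≐ A

-- # S is at least the common number of conclusions of the elements of A and
-- A ^⊥, if both are nonempty.

_HasEnoughConclusionsFor_ : PreNet → NetSet → Set
S HasEnoughConclusionsFor A = ∀ P Q → P ∈ A → Q ∈ A ^⊥ → # P ≤ # S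

infixr 7 _⅄_
_⅄_ : NetSet → NetSet → NetSet
(A ⅄ B) S = IsNet S × (∀ T → T ∈ A ^⊥ → S ∷∷ T ∈ B) × S HasEnoughConclusionsFor A

infixr 7 _∥ᵗ_ _⊗ᵗ_ _⅋ᵗ_
_∥ᵗ_ : NetSet → NetSet → NetSet
A ∥ᵗ B = (λ N → ∃[ S ] ∃[ T ] S ∈ A × T ∈ B × N ≡ S ∥ T) ^⊥ ^⊥

-- N is S plus a connective link, with fresh output, on S(1) and S(2).

data LinkFirstTwo (conn : Pos → Pos → Pos → Link) : PreNet → PreNet → Set where
  linkFirstTwo : ∀ {H p₁ p₂ ps p} → p ∉ˡ positions H →
    LinkFirstTwo conn ⟨ H , p₁ ∷ p₂ ∷ ps ⟩ ⟨ conn p₁ p₂ p ∷ H , p ∷ ps ⟩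

_⊗ᵗ_ : NetSet → NetSet → NetSet
A ⊗ᵗ B = (λ N → ∃[ S ] S ∈ A ∥ᵗ B × LinkFirstTwo tensor S N) ^⊥ ^⊥

_⅋ᵗ_ : NetSet → NetSet → NetSet
A ⅋ᵗ B = (λ N → ∃[ S ] S ∈ A ⅄ B × LinkFirstTwo par S N) ^⊥ ^⊥

------------------------------------------------------------------------
-- MLL✠

record Variables : Set₁ where
  field
    Var             : Set
    countable       : Var ↣ ℕ
    dual            : Var → Var
    dual-involutive : ∀ X → dual (dual X) ≡ X

open Variables

infixr 7 _⊗_ _⅋_
data Formula (𝓥 : Variables) : Set where
  var     : Var 𝓥 → Formula 𝓥
  _⅋_ _⊗_ : (A B : Formula 𝓥) → Formula 𝓥

Sequent : Variables → Set
Sequent 𝓥 = List (Formula 𝓥)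

module _ {𝓥 : Variables} where

  infix 10 _ᗮ
  _ᗮ : Formula 𝓥 → Formula 𝓥
  (var X) ᗮ = var (dual 𝓥 X)
  (A ⅋ B) ᗮ = A ᗮ ⊗ B ᗮ
  (A ⊗ B) ᗮ = A ᗮ ⅋ B ᗮ

  data MLL✠ : Sequent 𝓥 → Set where
    ✠-rule   : ∀ Γ → MLL✠ Γ
    ⅋-rule   : ∀ Γ A B → MLL✠ (Γ ++ A ∷ B ∷ []) → MLL✠ (Γ ++ (A ⅋ B) ∷ [])
    ⊗-rule   : ∀ Γ Δ A B → MLL✠ (Γ ++ A ∷ []) → MLL✠ (Δ ++ B ∷ []) →
               MLL✠ (Γ ++ Δ ++ (A ⊗ B) ∷ [])
    cut-rule : ∀ Γ Δ A → MLL✠ (Γ ++ A ∷ []) → MLL✠ (Δ ++ A ᗮ ∷ []) → MLL✠ (Γ ++ Δ)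
    ex-rule  : ∀ Γ Δ A B → MLL✠ (Γ ++ A ∷ B ∷ Δ) → MLL✠ (Γ ++ B ∷ A ∷ Δ)

  infix 4 _Represents_
  data _Represents_ (S : PreNet) : ∀ {Γ} → MLL✠ Γ → Set where

    ✠-rep : ∀ {Γ} → S ≅ ✠ (length Γ) → S Represents ✠-rule Γ

    ⅋-rep : ∀ {Γ A B π H γ a b p} →
      ⟨ H , γ ++ a ∷ b ∷ [] ⟩ Represents π →
      p ∉ˡ positions H →
      S ≅ ⟨ par a b p ∷ H , γ ++ p ∷ [] ⟩ →
      S Represents ⅋-rule Γ A B π

    ⊗-rep : ∀ {Γ Δ A B π₁ π₂ H₁ H₂ γ δ a b p} →
      ⟨ H₁ , γ ++ a ∷ [] ⟩ Represents π₁ →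
      ⟨ H₂ , δ ++ b ∷ [] ⟩ Represents π₂ →
      p ∉ˡ positions (H₁ ⊕ H₂) →
      S ≅ ⟨ tensor (left a) (right b) p ∷ (H₁ ⊕ H₂)
          , map left γ ++ map right δ ++ p ∷ [] ⟩ →
      S Represents ⊗-rule Γ Δ A B π₁ π₂

    cut-rep : ∀ {Γ Δ A π₁ π₂ H₁ H₂ γ δ a b} →
      ⟨ H₁ , γ ++ a ∷ [] ⟩ Represents π₁ →
      ⟨ H₂ , δ ++ b ∷ [] ⟩ Represents π₂ →
      S ≅ ⟨ cut (left a) (right b) ∷ (H₁ ⊕ H₂) , map left γ ++ map right δ ⟩ →
      S Represents cut-rule Γ Δ A π₁ π₂

    ex-rep : ∀ {Γ Δ A B π H γ δ a b} →
      length γ ≡ length Γ →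
      ⟨ H , γ ++ a ∷ b ∷ δ ⟩ Represents π →
      S ≅ ⟨ H , γ ++ b ∷ a ∷ δ ⟩ →
      S Represents ex-rule Γ Δ A B π

  infix 4 _⊢MLL✠_
  _⊢MLL✠_ : PreNet → Sequent 𝓥 → Set
  S ⊢MLL✠ Γ = Σ[ π ∈ MLL✠ Γ ] S Represents π

------------------------------------------------------------------------
-- Interpretation

record Basis (𝓥 : Variables) : Set₁ where
  field
    ⟦_⟧ᵛ           : Var 𝓥 → NetSet
    isType         : ∀ X → IsType ⟦ X ⟧ᵛ
    one-conclusion : ∀ X {S} → S ∈ ⟦ X ⟧ᵛ → # S ≡ 1
    dual-⊆         : ∀ X → ⟦ dual 𝓥 X ⟧ᵛ ⊆ ⟦ X ⟧ᵛ ^⊥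

open Basis

Approximable : ∀ {𝓥} → Basis 𝓥 → Set
Approximable 𝓑 = ∀ X → ✠ 1 ∈ ⟦ 𝓑 ⟧ᵛ X

module _ {𝓥 : Variables} (𝓑 : Basis 𝓥) where

  ⟦_⟧ᶠ : Formula 𝓥 → NetSet
  ⟦ var X ⟧ᶠ = ⟦ 𝓑 ⟧ᵛ X
  ⟦ A ⅋ B ⟧ᶠ = ⟦ A ⟧ᶠ ⅋ᵗ ⟦ B ⟧ᶠ
  ⟦ A ⊗ B ⟧ᶠ = ⟦ A ⟧ᶠ ⊗ᵗ ⟦ B ⟧ᶠ

  -- The empty sequent is interpreted by the neutral element of ⅄: the nets
  -- that reduce to ✠ 0.

  ⟦_⟧ˢ : Sequent 𝓥 → NetSet
  ⟦ [] ⟧ˢ        = ｛ ∅ ｝ ^⊥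
  ⟦ A ∷ [] ⟧ˢ    = ⟦ A ⟧ᶠ
  ⟦ A ∷ B ∷ Γ ⟧ˢ = ⟦ A ⟧ᶠ ⅄ ⟦ B ∷ Γ ⟧ˢ

{-# OPTIONS --safe #-}
module Submission where

-- A sequent A₁ , … , Aₙ is realised by S as soon as S reduces to ✠ 0 when it is cut
-- against arbitrary Tᵢ ∈ ⟦ Aᵢ ⟧ ^⊥, and this property is established by induction
-- on the proof.  The rules ⅋ and ⊗ follow from the definition of the types, and
-- the cut rule from ⟦ A ᗮ ⟧ ⊆ ⟦ A ⟧ ^⊥.  For the rule ✠, a daimon with n outputs
-- cut against T₁ , … , Tₙ simulates the reductions of the ✠ 1 ∷∷ Tᵢ one after the
-- other, the remaining outputs being carried along; so all that is needed is that
-- ✠ 1 belongs to ⟦ A ⟧ for every A.  By induction on A this amounts to: a tensor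
-- or par link on top of daimons may be replaced with a single daimon.  That in
-- turn rests on a weak form of confluence, namely that reducing a cut between two
-- daimons never loses the possibility of reaching ✠ 0.

open import Defs
open import Data.Empty using (⊥-elim)
open import Data.List.Base
  using (List; []; _∷_; _++_; map; concatMap; length; drop; zipWith; upTo)
open import Data.List.Membership.Propositional
  using () renaming (_∈_ to _∈ˡ_)
open import Data.List.Membership.Propositional.Properties
  using (∈-map⁺; ∈-map⁻; ∈-∃++; ∈-++⁺ˡ; ∈-++⁺ʳ; ∈-++⁻)
import Data.List.Properties as List
open import Data.List.Relation.Binary.Permutation.Propositional
  using ( _↭_; refl; prep; swap; ↭-refl; ↭-sym; ↭-trans; ↭-reflexive; ↭⇒↭ₛ; ↭⇒↭ₛ′
        ; module PermutationReasoning)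
import Data.List.Relation.Binary.Permutation.Propositional.Properties as ↭
import Data.List.Relation.Binary.Permutation.Homogeneous as Homogeneous
import Data.List.Relation.Binary.Permutation.Setoid as SetoidPermutation
import Data.List.Relation.Binary.Permutation.Setoid.Properties as SetoidPermutationProperties
import Data.List.Relation.Binary.Pointwise as Pointwise
open import Data.List.Relation.Binary.Pointwise using (Pointwise; []; _∷_)
open import Data.List.Relation.Unary.All as All using (All; []; _∷_)
import Data.List.Relation.Unary.All.Properties as All
open import Data.List.Relation.Unary.AllPairs using ([]; _∷_)
open import Data.List.Relation.Unary.Any using (here; there)
open import Data.List.Relation.Binary.Disjoint.Propositional using (Disjoint)
open import Data.List.Relation.Unary.Unique.Propositional using (Unique)
import Data.List.Relation.Unary.Unique.Propositional.Properties as Unique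
open import Data.Nat.Base using (ℕ; zero; suc; _+_; _≤_; z≤n; s≤s)
open import Data.Nat.ListAction using (sum)
open import Data.Nat.Properties
  using (_≟_; suc-injective; <-irrefl; ≤-trans; ≤-antisym; m≤m+n; m≤n+m; +-suc
        ; +-cancelʳ-≡; +-cancelˡ-≡; m∸n≡0⇒m≤n)
open import Data.List.Membership.DecPropositional _≟_ using (_∈?_)
open import Data.Product.Base using (∃-syntax; _×_; _,_; proj₁; proj₂)
open import Data.Sum.Base using (_⊎_; inj₁; inj₂)
open import Function.Base using (_∘_; id; const)
open import Function.Bundles using (mk⇔; module Equivalence)
open import Relation.Binary.Bundles using (Setoid)
open import Relation.Binary.Construct.Closure.ReflexiveTransitive using (ε; _◅_)
open import Relation.Binary.PropositionalEquality
  using (_≡_; _≢_; setoid; refl; sym; trans; cong; cong₂; subst; subst₂)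
open import Relation.Nullary using (¬_; yes; no; contradiction)
open import Relation.Unary using (_∈_)

-- Orthogonality asks for one reduction to `✠ 0`, and a par link cut against a daimon may split the
-- outputs badly: one choice can lead to `✠ 0` while another creates a cycle of daimons. Confluence
-- therefore fails, and only the merging of two daimons is shown to be harmless. This is exactly
-- what is needed: when a connective link fed by daimons meets a daimon, it creates two cuts with
-- the daimons that feed it, whereas a single daimon in its place merges at once; contracting the
-- two cuts makes the results agree. Freshness conditions would burden every comparison of two
-- reductions. The comparisons are therefore made on `Good`, where a redex supplies its own new
-- names and links are taken up to `∼`. Goodness survives every renaming, injective or not, so nets
-- can be glued under whatever names are convenient. Genuine reductions enter only through `⊥⇒Good`
-- and `Good⇒⊥`.

module _ {A : Set} where

  private variable
    x y : A
    xs ys : List A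

  pull : ℕ → List A → List A
  pull zero    xs       = xs
  pull (suc n) []       = []
  pull (suc n) (x ∷ xs) with pull n xs
  ... | []     = x ∷ []
  ... | y ∷ ys = y ∷ x ∷ ys

  -- The elements of xs in the order in which the indices ns pick them, every
  -- index counting what has not been picked yet, followed by the others.  It
  -- computes on lists with an explicit prefix.
  reorder : List ℕ → List A → List A
  reorder₁ : List ℕ → List A → List A
  reorder []       xs = xs
  reorder (n ∷ ns) xs = reorder₁ ns (pull n xs)
  reorder₁ ns []       = []
  reorder₁ ns (x ∷ xs) = x ∷ reorder ns xs

  pull-↭ : ∀ n (xs : List A) → xs ↭ pull n xs
  pull-↭ zero    xs       = ↭-refl
  pull-↭ (suc n) []       = ↭-refl
  pull-↭ (suc n) (x ∷ xs) with pull n xs | pull-↭ n xs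
  ... | []     | xs↭ = prep x xs↭
  ... | y ∷ ys | xs↭ = ↭-trans (prep x xs↭) (swap x y ↭-refl)

  reorder-↭ : ∀ ns {xs : List A} → xs ↭ reorder ns xs
  reorder-↭ []            = ↭-refl
  reorder-↭ (n ∷ ns) {xs} with pull n xs | pull-↭ n xs
  ... | []     | xs↭ = xs↭
  ... | y ∷ ys | xs↭ = ↭-trans xs↭ (prep y (reorder-↭ ns))

  ∷-↭-∷⁻ : x ∷ xs ↭ y ∷ ys →
           (x ≡ y × xs ↭ ys) ⊎ ∃[ zs ] xs ↭ y ∷ zs × ys ↭ x ∷ zs
  ∷-↭-∷⁻ {x} e with ↭.∈-resp-↭ e (here refl)
  ... | here refl = inj₁ (refl , ↭.drop-∷ e)
  ... | there x∈ys with as , bs , refl ← ∈-∃++ x∈ys =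
    inj₂ (as ++ bs
         , ↭.drop-∷ (↭-trans e (↭-trans (prep _ (↭.shift x as bs)) (swap _ _ ↭-refl)))
         , ↭.shift x as bs)

  ∷-↭-++⁻ : ∀ ys {zs} → x ∷ xs ↭ ys ++ zs →
            (∃[ ys′ ] ys ↭ x ∷ ys′ × xs ↭ ys′ ++ zs)
          ⊎ (∃[ zs′ ] zs ↭ x ∷ zs′ × xs ↭ ys ++ zs′)
  ∷-↭-++⁻ {x} ys {zs} e with ∈-++⁻ ys (↭.∈-resp-↭ e (here refl))
  ... | inj₁ x∈ys with as , bs , refl ← ∈-∃++ x∈ys =
    inj₁ (as ++ bs , ↭.shift x as bs ,
      ↭.drop-∷ (↭-trans e (↭.++⁺ʳ zs (↭.shift x as bs))))
  ... | inj₂ x∈zs with as , bs , refl ← ∈-∃++ x∈zs =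
    inj₂ (as ++ bs , ↭.shift x as bs ,
      ↭.drop-∷ (↭-trans e (↭-trans (↭.++⁺ˡ ys (↭.shift x as bs)) (↭.shift x ys (as ++ bs)))))

  Unique-resp-↭ : xs ↭ ys → Unique xs → Unique ys
  Unique-resp-↭ xs↭ys =
    SetoidPermutationProperties.Unique-resp-↭ (setoid A) (↭⇒↭ₛ xs↭ys)

-- Links up to the order of the inputs of cuts and of the outputs of daimons

infix 4 _∼_
data _∼_ : Link → Link → Set where
  ∼-refl   : ∀ {l} → l ∼ l
  cut-swap : ∀ {p q} → cut p q ∼ cut q p
  daimon   : ∀ {ps qs} → ps ↭ qs → daimon ps ∼ daimon qs

∼-sym : ∀ {l m} → l ∼ m → m ∼ l
∼-sym ∼-refl     = ∼-refl
∼-sym cut-swap   = cut-swap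
∼-sym (daimon e) = daimon (↭-sym e)

∼-trans : ∀ {l m n} → l ∼ m → m ∼ n → l ∼ n
∼-trans ∼-refl     f          = f
∼-trans cut-swap   ∼-refl     = cut-swap
∼-trans cut-swap   cut-swap   = ∼-refl
∼-trans (daimon e) ∼-refl     = daimon e
∼-trans (daimon e) (daimon f) = daimon (↭-trans e f)

∼-setoid : Setoid _ _
∼-setoid = record
  { _≈_           = _∼_
  ; isEquivalence = record { refl = ∼-refl ; sym = ∼-sym ; trans = ∼-trans }
  }

open SetoidPermutation ∼-setoid
  using () renaming (_↭_ to infix 3 _≋_; ↭-refl to ≋-refl; ↭-sym to ≋-sym; ↭-trans to ≋-trans)
module ≋ = SetoidPermutationProperties ∼-setoid

private variable
  l m n : Link
  G G₁ G₂ H K L R R′ : Hypergraph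
  a b c d p q r s t : Pos
  as bs cs γ δ : List Pos

↭⇒≋ : H ↭ K → H ≋ K
↭⇒≋ = ↭⇒↭ₛ′ (Setoid.isEquivalence ∼-setoid)

≡⇒≋ : H ≡ K → H ≋ K
≡⇒≋ refl = ≋-refl

by : ∀ ns {H} → H ≋ reorder ns H
by ns = ↭⇒≋ (reorder-↭ ns)

infixr 5 _∷≋_
_∷≋_ : l ∼ m → H ≋ K → l ∷ H ≋ m ∷ K
_∷≋_ = Homogeneous.prep

∷-≋-∷⁻ : l ∷ H ≋ m ∷ K →
         (l ∼ m × H ≋ K) ⊎ ∃[ L ] H ≋ m ∷ L × K ≋ l ∷ L
∷-≋-∷⁻ e with ≋.↭-split _ [] _ e
... | []     , L , l∼m ∷ H≋L , L≋K = inj₁ (l∼m , ≋-trans (Homogeneous.refl H≋L) L≋K)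
... | k ∷ ps , L , l∼k ∷ H≋ , L≋K =
  inj₂ (ps ++ L , ≋-trans (Homogeneous.refl H≋) (≋.↭-shift ps L)
               , ≋-trans (≋-sym L≋K) (∼-sym l∼k ∷≋ ≋-refl))

∷-≋-∷³⁻ : ∀ {l₁ l₂ l₃} → l ∷ H ≋ l₁ ∷ l₂ ∷ l₃ ∷ G →
    (l ∼ l₁ × H ≋ l₂ ∷ l₃ ∷ G)
  ⊎ (l ∼ l₂ × H ≋ l₁ ∷ l₃ ∷ G)
  ⊎ (l ∼ l₃ × H ≋ l₁ ∷ l₂ ∷ G)
  ⊎ ∃[ L ] G ≋ l ∷ L × H ≋ l₁ ∷ l₂ ∷ l₃ ∷ L
∷-≋-∷³⁻ e with ∷-≋-∷⁻ e
... | inj₁ e₁ = inj₁ e₁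
... | inj₂ (_ , h₁ , e₁) with ∷-≋-∷⁻ (≋-sym e₁)
... | inj₁ (l∼ , f) = inj₂ (inj₁ (l∼ , ≋-trans h₁ (∼-refl ∷≋ f)))
... | inj₂ (_ , h₂ , e₂) with ∷-≋-∷⁻ (≋-sym e₂)
... | inj₁ (l∼ , f) = inj₂ (inj₂ (inj₁ (l∼ , ≋-trans h₁ (∼-refl ∷≋ ≋-trans h₂ (∼-refl ∷≋ f)))))
... | inj₂ (L , h₃ , e₃) = inj₂ (inj₂ (inj₂ (L , e₃ ,
  ≋-trans h₁ (∼-refl ∷≋ ≋-trans h₂ (∼-refl ∷≋ h₃)))))

concatMap-resp-≋ : (f : Link → List Pos) → (∀ {l m} → l ∼ m → f l ↭ f m) →
                   H ≋ K → concatMap f H ↭ concatMap f K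
concatMap-resp-≋ f resp (Homogeneous.refl e) = pointwise e
  where
  pointwise : ∀ {H K} → Pointwise _∼_ H K → concatMap f H ↭ concatMap f K
  pointwise []       = ↭-refl
  pointwise (x ∷ xs) = ↭.++⁺ (resp x) (pointwise xs)
concatMap-resp-≋ f resp (Homogeneous.prep x e)   = ↭.++⁺ (resp x) (concatMap-resp-≋ f resp e)
concatMap-resp-≋ f resp (Homogeneous.swap {x = l} {y = m} x y e) =
  ↭-trans (↭.++⁺ (resp x) (↭.++⁺ (resp y) (concatMap-resp-≋ f resp e))) (↭.shifts (f _) (f _))
concatMap-resp-≋ f resp (Homogeneous.trans e e′) =
  ↭-trans (concatMap-resp-≋ f resp e) (concatMap-resp-≋ f resp e′)

sources-≋ : H ≋ K → sources H ↭ sources K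
sources-≋ = concatMap-resp-≋ source λ where
  ∼-refl     → ↭-refl
  cut-swap   → swap _ _ ↭-refl
  (daimon _) → ↭-refl

targets-≋ : H ≋ K → targets H ↭ targets K
targets-≋ = concatMap-resp-≋ target λ where
  ∼-refl     → ↭-refl
  cut-swap   → ↭-refl
  (daimon e) → e

sources-++ : ∀ G H → sources (G ++ H) ≡ sources G ++ sources H
sources-++ = List.concatMap-++ source

targets-++ : ∀ G H → targets (G ++ H) ≡ targets G ++ targets H
targets-++ = List.concatMap-++ target

rename-∼ : ∀ f → l ∼ m → renameLink f l ∼ renameLink f m
rename-∼ f ∼-refl     = ∼-refl
rename-∼ f cut-swap   = cut-swap
rename-∼ f (daimon e) = daimon (↭.map⁺ f e)

rename-≋ : ∀ f → H ≋ K → rename f H ≋ rename f K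
rename-≋ f = ≋.map⁺ ∼-setoid (rename-∼ f)

source-rename : ∀ f l → source (renameLink f l) ≡ map f (source l)
source-rename f (tensor _ _ _) = refl
source-rename f (par _ _ _)    = refl
source-rename f (cut _ _)      = refl
source-rename f (daimon _)     = refl

target-rename : ∀ f l → target (renameLink f l) ≡ map f (target l)
target-rename f (tensor _ _ _) = refl
target-rename f (par _ _ _)    = refl
target-rename f (cut _ _)      = refl
target-rename f (daimon _)     = refl

sources-rename : ∀ f H → sources (rename f H) ≡ map f (sources H)
sources-rename f []      = refl
sources-rename f (l ∷ H) = trans (cong₂ _++_ (source-rename f l) (sources-rename f H))
                                 (sym (List.map-++ f (source l) (sources H)))

targets-rename : ∀ f H → targets (rename f H) ≡ map f (targets H)
targets-rename f []      = refl
targets-rename f (l ∷ H) = trans (cong₂ _++_ (target-rename f l) (targets-rename f H))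
                                 (sym (List.map-++ f (target l) (targets H)))

rename-++ : ∀ f G H → rename f (G ++ H) ≡ rename f G ++ rename f H
rename-++ f = List.map-++ (renameLink f)

rename-∘ : ∀ f g H → rename f (rename g H) ≡ rename (f ∘ g) H
rename-∘ f g []      = refl
rename-∘ f g (l ∷ H) = cong₂ _∷_ (renameLink-∘ l) (rename-∘ f g H)
  where
  renameLink-∘ : ∀ l → renameLink f (renameLink g l) ≡ renameLink (f ∘ g) l
  renameLink-∘ (tensor _ _ _) = refl
  renameLink-∘ (par _ _ _)    = refl
  renameLink-∘ (cut _ _)      = refl
  renameLink-∘ (daimon ps)    = cong daimon (sym (List.map-∘ ps))

map-cong-All : ∀ {f g : Pos → Pos} {ps} → All (λ p → f p ≡ g p) ps → map f ps ≡ map g ps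
map-cong-All []       = refl
map-cong-All (e ∷ es) = cong₂ _∷_ e (map-cong-All es)

rename-cong : ∀ {f g} H → All (λ p → f p ≡ g p) (sources H) →
              All (λ p → f p ≡ g p) (targets H) → rename f H ≡ rename g H
rename-cong []                   _              _        = refl
rename-cong (tensor _ _ _ ∷ H) (e₁ ∷ e₂ ∷ es) (e ∷ et) rewrite e₁ | e₂ | e =
  cong (_ ∷_) (rename-cong H es et)
rename-cong (par _ _ _ ∷ H)    (e₁ ∷ e₂ ∷ es) (e ∷ et) rewrite e₁ | e₂ | e =
  cong (_ ∷_) (rename-cong H es et)
rename-cong (cut _ _ ∷ H)      (e₁ ∷ e₂ ∷ es) et       rewrite e₁ | e₂ =
  cong (_ ∷_) (rename-cong H es et)
rename-cong (daimon ps ∷ H)    es             et       with All.++⁻ ps et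
... | e , et′ = cong₂ _∷_ (cong daimon (map-cong-All e)) (rename-cong H es et′)

rename-id : ∀ H → rename id H ≡ H
rename-id []                 = refl
rename-id (tensor _ _ _ ∷ H) = cong (_ ∷_) (rename-id H)
rename-id (par _ _ _ ∷ H)    = cong (_ ∷_) (rename-id H)
rename-id (cut _ _ ∷ H)      = cong (_ ∷_) (rename-id H)
rename-id (daimon ps ∷ H)    = cong₂ _∷_ (cong daimon (List.map-id ps)) (rename-id H)

-- Reduction to a single daimon without outputs.  In a linear hypergraph the
-- names p and q of a redex occur nowhere else, so they can play the role of the
-- fresh names of the last two rules: no freshness condition is needed, and the
-- predicate is closed under arbitrary renamings.

infix 4 _▷_
data _▷_ : Hypergraph → Hypergraph → Set where
  par-tensor    : par a b p ∷ cut p q ∷ tensor c d q ∷ []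
                ▷ cut a c ∷ cut b d ∷ []
  daimon-daimon : daimon (p ∷ as) ∷ cut p q ∷ daimon (q ∷ bs) ∷ []
                ▷ daimon (as ++ bs) ∷ []
  tensor-daimon : tensor a b p ∷ cut p q ∷ daimon (q ∷ as) ∷ []
                ▷ cut a p ∷ cut b q ∷ daimon (p ∷ q ∷ as) ∷ []
  par-daimon    : par a b p ∷ cut p q ∷ daimon (q ∷ as ++ bs) ∷ []
                ▷ cut a p ∷ cut b q ∷ daimon (p ∷ as) ∷ daimon (q ∷ bs) ∷ []

data Good : Hypergraph → Set where
  done : H ≋ daimon [] ∷ [] → Good H
  step : R ▷ R′ → H ≋ R ++ G → Good (R′ ++ G) → Good H

Good-resp-≋ : H ≋ K → Good H → Good K
Good-resp-≋ e (done f)     = done (≋-trans (≋-sym e) f)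
Good-resp-≋ e (step r f g) = step r (≋-trans (≋-sym e) f) g

▷-rename : ∀ f → R ▷ R′ → rename f R ▷ rename f R′
▷-rename f par-tensor = par-tensor
▷-rename f (daimon-daimon {as = as} {bs = bs})
  rewrite List.map-++ f as bs = daimon-daimon
▷-rename f tensor-daimon = tensor-daimon
▷-rename f (par-daimon {as = as} {bs = bs})
  rewrite List.map-++ f as bs = par-daimon

Good-rename : ∀ f → Good H → Good (rename f H)
Good-rename f (done e) = done (rename-≋ f e)
Good-rename f (step {R = R} {R′ = R′} {G = G} r e g) =
  step (▷-rename f r)
       (≋-trans (rename-≋ f e) (≡⇒≋ (rename-++ f R G)))
       (subst Good (rename-++ f R′ G) (Good-rename f g))

-- Running one reduction after another through a common daimon

daimon-∼⁻ : daimon as ∼ daimon bs → as ↭ bs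
daimon-∼⁻ ∼-refl     = ↭-refl
daimon-∼⁻ (daimon e) = e

float : ∀ R → l ∷ R ++ G ≋ R ++ l ∷ G
float R = ≋-sym (≋.↭-shift R _)

daimon-cong : as ↭ bs → Good (daimon as ∷ G) → Good (daimon bs ∷ G)
daimon-cong e = Good-resp-≋ (daimon e ∷≋ ≋-refl)

swap-right : (as bs cs : List Pos) → (as ++ bs) ++ cs ↭ (as ++ cs) ++ bs
swap-right as bs cs =
  ↭-trans (↭.++-assoc as bs cs) (↭-trans (↭.++⁺ˡ as (↭.++-comm bs cs)) (↭-sym (↭.++-assoc as cs bs)))

-- A daimon that takes part in a step always leaves a daimon behind, and the waiting outputs `bs`
-- move to that one. When a par link splits the daimon, they join the first half, an arbitrary
-- choice.
splice-step : R ▷ R′ → daimon as ∷ G ≋ R ++ G₁ →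
  (∀ {as G} → R′ ++ G₁ ≋ daimon as ∷ G → Good (daimon (as ++ bs) ∷ G ++ H)) →
  Good (daimon (as ++ bs) ∷ G ++ H)
splice-step {R = R} {R′ = R′} {as = as} {G = G} {G₁ = G₁} {bs = bs} {H = H} r e ih = go r e
  where
  disjoint : ∃[ L ] G₁ ≋ daimon as ∷ L × G ≋ R ++ L → Good (daimon (as ++ bs) ∷ G ++ H)
  disjoint (L , e₁ , e₂) = step {G = daimon (as ++ bs) ∷ L ++ H} r
    (≋-trans (∼-refl ∷≋ ≋-trans (≋.++⁺ʳ H e₂) (≋.++-assoc R L H)) (float R))
    (Good-resp-≋ (≋-trans (∼-refl ∷≋ ≋.++-assoc R′ L H) (float R′))
      (ih (≋-trans (≋.++⁺ˡ R′ e₁) (≋-sym (float R′)))))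

  go : R ▷ R′ → daimon as ∷ G ≋ R ++ G₁ → Good (daimon (as ++ bs) ∷ G ++ H)
  go par-tensor e with ∷-≋-∷³⁻ e
  ... | inj₁ (() , _)
  ... | inj₂ (inj₁ (() , _))
  ... | inj₂ (inj₂ (inj₁ (() , _)))
  ... | inj₂ (inj₂ (inj₂ x)) = disjoint x
  go (daimon-daimon {as = us} {bs = vs}) e with ∷-≋-∷³⁻ e
  ... | inj₁ (l , f) = step {G = G₁ ++ H} (daimon-daimon {as = us ++ bs} {bs = vs})
    (daimon (↭.++⁺ʳ bs (daimon-∼⁻ l)) ∷≋ ≋.++⁺ʳ H f)
    (daimon-cong (swap-right us vs bs) (ih ≋-refl))
  ... | inj₂ (inj₁ (() , _))
  ... | inj₂ (inj₂ (inj₁ (l , f))) = step {G = G₁ ++ H} (daimon-daimon {as = us} {bs = vs ++ bs})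
    (≋-trans (daimon (↭.++⁺ʳ bs (daimon-∼⁻ l)) ∷≋ ≋.++⁺ʳ H f) (by (1 ∷ 1 ∷ [])))
    (daimon-cong (↭.++-assoc us vs bs) (ih ≋-refl))
  ... | inj₂ (inj₂ (inj₂ x)) = disjoint x
  go tensor-daimon e with ∷-≋-∷³⁻ e
  ... | inj₁ (() , _)
  ... | inj₂ (inj₁ (() , _))
  ... | inj₂ (inj₂ (inj₁ (l , f))) = step {G = G₁ ++ H} tensor-daimon
    (≋-trans (daimon (↭.++⁺ʳ bs (daimon-∼⁻ l)) ∷≋ ≋.++⁺ʳ H f) (by (1 ∷ 1 ∷ [])))
    (Good-resp-≋ (by (1 ∷ 1 ∷ [])) (ih (by (2 ∷ []))))
  ... | inj₂ (inj₂ (inj₂ x)) = disjoint x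
  go (par-daimon {as = us} {bs = vs}) e with ∷-≋-∷³⁻ e
  ... | inj₁ (() , _)
  ... | inj₂ (inj₁ (() , _))
  ... | inj₂ (inj₂ (inj₁ (l , f))) = step {G = G₁ ++ H} (par-daimon {as = us ++ bs} {bs = vs})
    (≋-trans (daimon (↭-trans (↭.++⁺ʳ bs (daimon-∼⁻ l)) (prep _ (swap-right us vs bs)))
               ∷≋ ≋.++⁺ʳ H f)
             (by (1 ∷ 1 ∷ [])))
    (Good-resp-≋ (by (1 ∷ 1 ∷ [])) (ih (by (2 ∷ []))))
  ... | inj₂ (inj₂ (inj₂ x)) = disjoint x

-- The outputs bs and the hypergraph H wait until the reduction of K is over.
splice : Good K → K ≋ daimon as ∷ G → Good (daimon bs ∷ H) → Good (daimon (as ++ bs) ∷ G ++ H)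
splice {as = as} (done k) e h with ∷-≋-∷⁻ (≋-trans (≋-sym e) k)
... | inj₂ (_ , _ , x) = contradiction (≋-sym x) ≋.¬x∷xs↭[]
splice {as = _ ∷ _} (done k) e h | inj₁ (l , _) = contradiction (daimon-∼⁻ l) ↭.¬x∷xs↭[]
splice {as = []} {G = []}    (done k) e h | inj₁ _ = h
splice {as = []} {G = _ ∷ _} (done k) e h | inj₁ (_ , x) = contradiction x ≋.¬x∷xs↭[]
splice (step r k g) e h = splice-step r (≋-trans (≋-sym e) k) (λ e′ → splice g e′ h)

-- Linear hypergraphs

record Linear (H : Hypergraph) : Set where
  constructor linear
  field
    sources-unique : Unique (sources H)
    targets-unique : Unique (targets H)

open Linear

Linear-resp-≋ : H ≋ K → Linear H → Linear K
Linear-resp-≋ e (linear s t) =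
  linear (Unique-resp-↭ (sources-≋ e) s) (Unique-resp-↭ (targets-≋ e) t)

Unique-tail : ∀ {x : Pos} {xs} → Unique (x ∷ xs) → Unique xs
Unique-tail (_ ∷ u) = u

-- No rule of `▷` invents names: up to order, the sources and the targets of the reduct are among
-- those of the redex.
Linear-▷ : R ▷ R′ → Linear (R ++ G) → Linear (R′ ++ G)
Linear-▷ par-tensor (linear s t) = linear
  (Unique-tail (Unique-tail (Unique-resp-↭ (reorder-↭ (2 ∷ 2 ∷ 0 ∷ 1 ∷ [])) s)))
  (Unique-tail (Unique-tail t))
Linear-▷ {G = G} (daimon-daimon {p} {as} {q} {bs}) (linear s t) = linear
  (Unique-tail (Unique-tail s))
  (Unique-tail (Unique-resp-↭ (↭-trans (↭.shift q as _) (prep q (↭-sym (↭.++-assoc as bs _))))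
    (Unique-tail t)))
Linear-▷ tensor-daimon (linear s t) = linear (Unique-resp-↭ (reorder-↭ (0 ∷ 1 ∷ [])) s) t
Linear-▷ {G = G} (par-daimon {p = p} {q = q} {as = as} {bs = bs}) (linear s t) = linear
  (Unique-resp-↭ (reorder-↭ (0 ∷ 1 ∷ [])) s)
  (Unique-resp-↭ (prep p (↭-trans (prep q (↭.++-assoc as bs _)) (↭-sym (↭.shift q as _)))) t)

Unique⇒¬twice : ∀ {x : Pos} {xs} → ¬ Unique (x ∷ x ∷ xs)
Unique⇒¬twice ((x≢x ∷ _) ∷ _) = x≢x refl

∈⇒↭ : ∀ {x : Pos} {xs} → x ∈ˡ xs → ∃[ ys ] xs ↭ x ∷ ys
∈⇒↭ x∈xs with as , bs , refl ← ∈-∃++ x∈xs = as ++ bs , ↭.shift _ as bs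

same-target : p ∈ˡ target l → p ∈ˡ target m → Linear (l ∷ H) →
              l ∷ H ≋ m ∷ K → l ∼ m × H ≋ K
same-target {l = l} {m = m} {H = H} p∈l p∈m lin e with ∷-≋-∷⁻ e
... | inj₁ x = x
... | inj₂ (L , h , _) with xs , f ← ∈⇒↭ p∈l | ys , g ← ∈⇒↭ p∈m =
  ⊥-elim (Unique⇒¬twice (Unique-resp-↭ (↭-trans
    (↭.++⁺ f (↭-trans (targets-≋ h) (↭.++⁺ʳ (targets L) g)))
    (prep _ (↭.shift _ xs _))) (targets-unique lin)))

-- Renaming two positions at once

sub : Pos → Pos → Pos → Pos → Pos → Pos
sub p p′ q q′ x with x ≟ p
... | yes _ = p′
... | no _ with x ≟ q
...   | yes _ = q′
...   | no _  = x

sub-fst : ∀ p {p′ q q′} → sub p p′ q q′ p ≡ p′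
sub-fst p with p ≟ p
... | yes _  = refl
... | no p≢p = contradiction refl p≢p

sub-snd : ∀ {p} p′ {q} q′ → p ≢ q → sub p p′ q q′ q ≡ q′
sub-snd {p} p′ {q} q′ p≢q with q ≟ p
... | yes refl = contradiction refl p≢q
... | no _ with q ≟ q
...   | yes _  = refl
...   | no q≢q = contradiction refl q≢q

sub-other : ∀ {p} p′ {q} q′ {x} → p ≢ x → q ≢ x → sub p p′ q q′ x ≡ x
sub-other {p} p′ {q} q′ {x} p≢x q≢x with x ≟ p
... | yes refl = contradiction refl p≢x
... | no _ with x ≟ q
...   | yes refl = contradiction refl q≢x
...   | no _     = refl

map-sub : ∀ {p} p′ {q} q′ {xs} → All (p ≢_) xs → All (q ≢_) xs → map (sub p p′ q q′) xs ≡ xs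
map-sub p′ q′ []       []       = refl
map-sub p′ q′ (x ∷ xs) (y ∷ ys) = cong₂ _∷_ (sub-other p′ q′ x y) (map-sub p′ q′ xs ys)

rename-sub : ∀ {p} p′ {q} q′ H →
  All (p ≢_) (sources H) → All (q ≢_) (sources H) →
  All (p ≢_) (targets H) → All (q ≢_) (targets H) → rename (sub p p′ q q′) H ≡ H
rename-sub p′ q′ H ps qs pt qt = trans
  (rename-cong H (All.zipWith (λ (x , y) → sub-other p′ q′ x y) (ps , qs))
                 (All.zipWith (λ (x , y) → sub-other p′ q′ x y) (pt , qt)))
  (rename-id H)

∷-≋-∷²⁻ : ∀ {l₁ l₂} → l ∷ H ≋ l₁ ∷ l₂ ∷ G →
    (l ∼ l₁ × H ≋ l₂ ∷ G)
  ⊎ (l ∼ l₂ × H ≋ l₁ ∷ G)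
  ⊎ ∃[ L ] G ≋ l ∷ L × H ≋ l₁ ∷ l₂ ∷ L
∷-≋-∷²⁻ e with ∷-≋-∷⁻ e
... | inj₁ e₁ = inj₁ e₁
... | inj₂ (_ , h₁ , e₁) with ∷-≋-∷⁻ (≋-sym e₁)
... | inj₁ (l∼ , f) = inj₂ (inj₁ (l∼ , ≋-trans h₁ (∼-refl ∷≋ f)))
... | inj₂ (L , h₂ , e₂) = inj₂ (inj₂ (L , e₂ , ≋-trans h₁ (∼-refl ∷≋ h₂)))

∷-↭-∷-≢⁻ : p ≢ q → p ∷ as ↭ q ∷ bs → ∃[ cs ] as ↭ q ∷ cs × bs ↭ p ∷ cs
∷-↭-∷-≢⁻ p≢q e with ∷-↭-∷⁻ e
... | inj₁ (p≡q , _) = contradiction p≡q p≢q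
... | inj₂ x         = x

-- Contracting one cut between two daimons preserves goodness.  A reduction step
-- commutes with the contraction, except if it reduces a second cut between the
-- same two daimons: then the two results differ by a renaming.

Contractible : Hypergraph → Set
Contractible K = ∀ {p q as bs G} →
  K ≋ cut p q ∷ daimon (p ∷ as) ∷ daimon (q ∷ bs) ∷ G → Good (daimon (as ++ bs) ∷ G)

Contractible-resp-≋ : H ≋ K → Contractible H → Contractible K
Contractible-resp-≋ e c f = c (≋-trans e f)

daimon-comm : ∀ as → Good (daimon (as ++ bs) ∷ G) → Good (daimon (bs ++ as) ∷ G)
daimon-comm as = daimon-cong (↭.++-comm as _)

-- The cut to contract is `cut p q`, with context `G`; the step reduces `cut s t`, with context
-- `G₁`. Each context contains the other cut, and `G₄` is what neither operation touches.
module _ {p q s t : Pos} {as bs : List Pos} {G G₁ G₂ G₃ G₄ : Hypergraph}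
         (e₁ : G₁ ≋ cut p q ∷ G₂) (e : G ≋ cut s t ∷ G₃) where

  contract-disjoint : ∀ {x y} → x ∷ cut s t ∷ y ∷ [] ▷ R′ →
    G₂ ≋ daimon (p ∷ as) ∷ daimon (q ∷ bs) ∷ G₄ → G₃ ≋ x ∷ y ∷ G₄ →
    Contractible (R′ ++ G₁) → Good (daimon (as ++ bs) ∷ G)
  contract-disjoint {R′ = R′} r e₂ e₃ ih = step r
    (≋-trans (∼-refl ∷≋ ≋-trans e (∼-refl ∷≋ e₃)) (by (2 ∷ 1 ∷ 1 ∷ [])))
    (Good-resp-≋ (float R′)
      (ih (≋-trans (≋.++⁺ˡ R′ (≋-trans e₁ (∼-refl ∷≋ e₂)))
           (≋-trans (≋-sym (float R′)) (∼-refl ∷≋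
             ≋-trans (≋-sym (float R′)) (∼-refl ∷≋ ≋-sym (float R′)))))))

  -- As `t ≢ p`, the contracted cut sits on another output of the expanded daimon and survives the
  -- expansion, so the two operations can be exchanged.
  contract-tensor : t ≢ p → t ∷ cs ↭ p ∷ as →
    G₂ ≋ daimon (q ∷ bs) ∷ G₄ → G₃ ≋ tensor a b s ∷ G₄ →
    Contractible (cut a s ∷ cut b t ∷ daimon (s ∷ t ∷ cs) ∷ G₁) →
    Good (daimon (as ++ bs) ∷ G)
  contract-tensor t≢p f e₂ e₃ ih with us , cs↭ , as↭ ← ∷-↭-∷-≢⁻ t≢p f =
    step (tensor-daimon {as = us ++ bs})
      (≋-trans (daimon (↭.++⁺ʳ bs as↭) ∷≋ ≋-trans e (∼-refl ∷≋ e₃)) (by (2 ∷ 1 ∷ [])))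
      (Good-resp-≋ (by (1 ∷ 1 ∷ []))
        (ih {as = s ∷ t ∷ us}
          (≋-trans (∼-refl ∷≋ ∼-refl ∷≋
              daimon (↭-trans (prep s (prep t cs↭)) (reorder-↭ (2 ∷ [])))
              ∷≋ ≋-trans e₁ (∼-refl ∷≋ e₂))
            (by (3 ∷ 2 ∷ 2 ∷ [])))))

  -- The splitting sends `p` to one of the two halves. If the contraction comes first, `bs` has to
  -- be sent to that same half, which gives the two cases.
  contract-par : t ≢ p → ∀ us vs → t ∷ us ++ vs ↭ p ∷ as →
    G₂ ≋ daimon (q ∷ bs) ∷ G₄ → G₃ ≋ par a b s ∷ G₄ →
    Contractible (cut a s ∷ cut b t ∷ daimon (s ∷ us) ∷ daimon (t ∷ vs) ∷ G₁) →
    Good (daimon (as ++ bs) ∷ G)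
  contract-par t≢p us vs f e₂ e₃ ih with ∷-↭-∷-≢⁻ t≢p f
  ... | _ , us++vs↭ , as↭ with ∷-↭-++⁻ us (↭-sym us++vs↭)
  ... | inj₁ (us′ , us↭ , cs↭) =
    step (par-daimon {as = us′ ++ bs} {bs = vs})
      (≋-trans (daimon (↭-trans (↭.++⁺ʳ bs (↭-trans as↭ (prep t cs↭)))
                         (prep t (swap-right us′ vs bs)))
          ∷≋ ≋-trans e (∼-refl ∷≋ e₃)) (by (2 ∷ 1 ∷ [])))
      (Good-resp-≋ (by (1 ∷ 1 ∷ []))
        (ih {as = s ∷ us′}
          (≋-trans (∼-refl ∷≋ ∼-refl ∷≋
              daimon (↭-trans (prep s us↭) (swap _ _ ↭-refl))
              ∷≋ ∼-refl ∷≋ ≋-trans e₁ (∼-refl ∷≋ e₂))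
            (by (4 ∷ 2 ∷ 3 ∷ [])))))
  ... | inj₂ (vs′ , vs↭ , cs↭) =
    step (par-daimon {as = us} {bs = vs′ ++ bs})
      (≋-trans (daimon (↭-trans (↭.++⁺ʳ bs (↭-trans as↭ (prep t cs↭)))
                         (prep t (↭.++-assoc us vs′ bs)))
          ∷≋ ≋-trans e (∼-refl ∷≋ e₃)) (by (2 ∷ 1 ∷ [])))
      (Good-resp-≋ (by (1 ∷ 1 ∷ 1 ∷ []))
        (ih {as = t ∷ vs′}
          (≋-trans (∼-refl ∷≋ ∼-refl ∷≋ ∼-refl ∷≋
              daimon (↭-trans (prep t vs↭) (swap _ _ ↭-refl))
              ∷≋ ≋-trans e₁ (∼-refl ∷≋ e₂))
            (by (4 ∷ 3 ∷ 3 ∷ [])))))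

  -- Three daimons in a row: merging them in either order gives the same outputs up to permutation.
  contract-daimon : s ≢ p → ∀ {us vs} → s ∷ us ↭ p ∷ as →
    G₂ ≋ daimon (q ∷ bs) ∷ G₄ → G₃ ≋ daimon (t ∷ vs) ∷ G₄ →
    Contractible (daimon (us ++ vs) ∷ G₁) → Good (daimon (as ++ bs) ∷ G)
  contract-daimon s≢p {us} {vs} f e₂ e₃ ih with us′ , us↭ , as↭ ← ∷-↭-∷-≢⁻ s≢p f =
    step (daimon-daimon {as = us′ ++ bs} {bs = vs})
      (daimon (↭.++⁺ʳ bs as↭) ∷≋ ≋-trans e (∼-refl ∷≋ e₃))
      (daimon-cong (swap-right us′ vs bs)
        (ih {as = us′ ++ vs}
          (≋-trans (daimon (↭.++⁺ʳ vs us↭) ∷≋ ≋-trans e₁ (∼-refl ∷≋ e₂)) (by (1 ∷ [])))))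

  -- Whichever cut goes first, the other is left joining two outputs of one daimon. Such a cut is
  -- not dead, since a later `par-daimon` step may send its ends to different daimons; goodness is
  -- therefore transported from one result to the other, along the renaming `σ` of the surviving
  -- ends.
  contract-loop : ∀ {us vs} → s ∷ us ↭ p ∷ as → t ∷ vs ↭ q ∷ bs → G₂ ≋ G₃ →
    Linear (cut s t ∷ daimon (s ∷ us) ∷ daimon (t ∷ vs) ∷ G₁) →
    Good (daimon (us ++ vs) ∷ G₁) → Good (daimon (as ++ bs) ∷ G)
  contract-loop {us} {vs} fs ft e₂ lin g
    with linear ((_ ∷ s≢p ∷ _) ∷ (t≢p ∷ t≢q ∷ _) ∷ (p≢q ∷ ps) ∷ qs ∷ _) _
           ← Linear-resp-≋ (∼-refl ∷≋ ∼-refl ∷≋ ∼-refl ∷≋ e₁) lin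
    with us′ , us↭ , as↭ ← ∷-↭-∷-≢⁻ s≢p fs | vs′ , vs↭ , bs↭ ← ∷-↭-∷-≢⁻ t≢q ft
    with (_ ∷ _ ∷ pt) ∷ (_ ∷ qt) ∷ _ ← Unique-tail (Unique-resp-↭
           (↭-trans (prep s (↭.++⁺ us↭ (prep t (↭.++⁺ vs↭ (targets-≋ e₁)))))
             (prep s (prep p (↭-trans (↭.shifts us′ (t ∷ q ∷ [])) (swap t q ↭-refl)))))
           (targets-unique lin))
    with pus , pvt ← All.++⁻ us′ pt | qus , qvt ← All.++⁻ us′ qt
    with pvs , pt′ ← All.++⁻ vs′ pvt | qvs , qt′ ← All.++⁻ vs′ qvt =
    Good-resp-≋
      (daimon (↭-sym (↭.++⁺ as↭ bs↭)) ∷≋ ≋-sym (≋-trans e (∼-refl ∷≋ ≋-sym e₂)))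
      (subst Good
        (cong₂ _∷_ (cong daimon
            (trans (List.map-++ σ (p ∷ us′) (q ∷ vs′))
              (cong₂ _++_ (cong₂ _∷_ σp (map-sub s t pus qus))
                          (cong₂ _∷_ σq (map-sub s t pvs qvs)))))
          (cong₂ _∷_ (cong₂ cut σp σq) (rename-sub s t G₂ ps qs pt′ qt′)))
        (Good-rename σ (Good-resp-≋ (daimon (↭.++⁺ us↭ vs↭) ∷≋ e₁) g)))
    where
    σ  = sub p s q t
    σp : σ p ≡ s
    σp = sub-fst p
    σq : σ q ≡ t
    σq = sub-snd s t p≢q

cut-source : ∀ H → Linear (cut p q ∷ cut s t ∷ H) → p ≢ s × p ≢ t × q ≢ s × q ≢ t
cut-source _ (linear ((_ ∷ p≢s ∷ p≢t ∷ _) ∷ (q≢s ∷ q≢t ∷ _) ∷ _) _) = p≢s , p≢t , q≢s , q≢t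

cut-∼⁻ : cut s t ∼ cut p q → (s ≡ p × t ≡ q) ⊎ (s ≡ q × t ≡ p)
cut-∼⁻ ∼-refl   = inj₁ (refl , refl)
cut-∼⁻ cut-swap = inj₂ (refl , refl)

cut-∷-≋⁻ : ∀ {x y} → (∀ {p q} → ¬ cut p q ∼ x) → (∀ {p q} → ¬ cut p q ∼ y) →
  x ∷ cut s t ∷ y ∷ G₁ ≋ cut p q ∷ daimon as ∷ daimon bs ∷ G →
    (cut s t ∼ cut p q × x ∷ y ∷ G₁ ≋ daimon as ∷ daimon bs ∷ G)
  ⊎ ∃[ G₂ ] ∃[ G₃ ] G₁ ≋ cut p q ∷ G₂ × G ≋ cut s t ∷ G₃
      × x ∷ y ∷ G₂ ≋ daimon as ∷ daimon bs ∷ G₃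
cut-∷-≋⁻ ¬x ¬y e with ∷-≋-∷³⁻ (≋-trans (by (1 ∷ [])) e)
... | inj₁ f = inj₁ f
... | inj₂ (inj₁ (() , _))
... | inj₂ (inj₂ (inj₁ (() , _)))
... | inj₂ (inj₂ (inj₂ (G₃ , f , f′))) with ∷-≋-∷²⁻ (≋-sym f′)
... | inj₁ (x∼ , _)        = contradiction x∼ ¬x
... | inj₂ (inj₁ (y∼ , _)) = contradiction y∼ ¬y
... | inj₂ (inj₂ (G₂ , h , h′)) = inj₂ (G₂ , G₃ , h , f , ≋-sym h′)

conn-∷-≋⁻ : (∀ {as} → ¬ l ∼ daimon as) → l ∷ H ≋ daimon as ∷ G →
            ∃[ L ] H ≋ daimon as ∷ L × G ≋ l ∷ L
conn-∷-≋⁻ ¬l e with ∷-≋-∷⁻ e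
... | inj₁ (l∼ , _) = contradiction l∼ ¬l
... | inj₂ x        = x

Unique-++⁻ʳ : ∀ (xs : List Pos) {ys} → Unique (xs ++ ys) → Unique ys
Unique-++⁻ʳ []       u       = u
Unique-++⁻ʳ (x ∷ xs) (_ ∷ u) = Unique-++⁻ʳ xs u

Linear-tail : ∀ l → Linear (l ∷ H) → Linear H
Linear-tail l (linear s t) = linear (Unique-++⁻ʳ (source l) s) (Unique-++⁻ʳ (target l) t)

-- A cut reduced against a connective link is never the cut to contract: its end `s` would be an
-- output of both the connective link and a daimon.
same-cut-conn : (∀ {as} → ¬ l ∼ daimon as) → target l ≡ s ∷ [] → s ≡ p ⊎ s ≡ q → Linear (l ∷ H) →
  ¬ (l ∷ H ≋ daimon (p ∷ as) ∷ daimon (q ∷ bs) ∷ G)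
same-cut-conn ¬l eq (inj₁ refl) lin e =
  ¬l (proj₁ (same-target (subst (_ ∈ˡ_) (sym eq) (here refl)) (here refl) lin e))
same-cut-conn ¬l eq (inj₂ refl) lin e =
  ¬l (proj₁ (same-target (subst (_ ∈ˡ_) (sym eq) (here refl)) (here refl) lin (≋-trans e (by (1 ∷ [])))))

same-cut-daimon : ∀ {us vs} → Linear (daimon (p ∷ us) ∷ daimon (q ∷ vs) ∷ G₁) →
  daimon (p ∷ us) ∷ daimon (q ∷ vs) ∷ G₁ ≋ daimon (p ∷ as) ∷ daimon (q ∷ bs) ∷ G →
  Good (daimon (us ++ vs) ∷ G₁) → Good (daimon (as ++ bs) ∷ G)
same-cut-daimon lin e g with same-target (here refl) (here refl) lin e
... | x , e′ with same-target (here refl) (here refl) (Linear-tail (daimon _) lin) e′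
... | y , e″ = Good-resp-≋
  (daimon (↭.++⁺ (↭.drop-∷ (daimon-∼⁻ x)) (↭.drop-∷ (daimon-∼⁻ y))) ∷≋ e″) g

contract-step : R ▷ R′ → R ++ G₁ ≋ cut p q ∷ daimon (p ∷ as) ∷ daimon (q ∷ bs) ∷ G →
  Linear (R ++ G₁) → Good (R′ ++ G₁) → Contractible (R′ ++ G₁) → Good (daimon (as ++ bs) ∷ G)
contract-step {G₁ = G₁} {p = p} {q = q} {as = as} {bs = bs} {G = G} r e lin g ih = go r e lin g ih
  where
  Goal : Set
  Goal = Good (daimon (as ++ bs) ∷ G)

  conn-step : ∀ {x y} → (∀ {p q} → ¬ cut p q ∼ x) → (∀ {p q} → ¬ cut p q ∼ y) →
    (∀ {as} → ¬ x ∼ daimon as) → target x ≡ s ∷ [] →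
    x ∷ cut s t ∷ y ∷ [] ▷ R′ →
    x ∷ cut s t ∷ y ∷ G₁ ≋ cut p q ∷ daimon (p ∷ as) ∷ daimon (q ∷ bs) ∷ G →
    Linear (x ∷ cut s t ∷ y ∷ G₁) → Contractible (R′ ++ G₁) →
    (∀ {p q as bs G₂ G₃ G₄} → t ≢ p → G₁ ≋ cut p q ∷ G₂ → G ≋ cut s t ∷ G₃ →
      y ∼ daimon (p ∷ as) → G₂ ≋ daimon (q ∷ bs) ∷ G₄ → G₃ ≋ x ∷ G₄ → Good (daimon (as ++ bs) ∷ G)) →
    Goal
  conn-step {x = x} {y = y} ¬x ¬y ¬x′ eq r e lin ih shared with cut-∷-≋⁻ ¬x ¬y e
  ... | inj₁ (f , e′) = ⊥-elim
    (same-cut-conn ¬x′ eq (endpoint (cut-∼⁻ f))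
      (Linear-tail (cut _ _) (Linear-resp-≋ (by (1 ∷ [])) lin)) e′)
    where
    endpoint : (s ≡ p × t ≡ q) ⊎ (s ≡ q × t ≡ p) → s ≡ p ⊎ s ≡ q
    endpoint (inj₁ (s≡p , _)) = inj₁ s≡p
    endpoint (inj₂ (s≡q , _)) = inj₂ s≡q
  ... | inj₂ (G₂ , G₃ , e₁ , e₂ , e₃)
    with _ , _ , t≢p , t≢q ← cut-source (x ∷ y ∷ G₂) (Linear-resp-≋
           (≋-trans (∼-refl ∷≋ ∼-refl ∷≋ ∼-refl ∷≋ e₁) (by (1 ∷ 2 ∷ []))) lin)
    with ∷-≋-∷²⁻ (≋-trans (by (1 ∷ [])) e₃)
  ... | inj₁ (y∼ , f) with _ , f₂ , f₃ ← conn-∷-≋⁻ ¬x′ f = shared t≢p e₁ e₂ y∼ f₂ f₃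
  -- The shared daimon is the one with output `q`: the same argument applies with `p` and `q`
  -- exchanged, and `daimon-comm` restores the order of the outputs.
  ... | inj₂ (inj₁ (y∼ , f)) with _ , f₂ , f₃ ← conn-∷-≋⁻ ¬x′ f =
    daimon-comm bs (shared t≢q (≋-trans e₁ (cut-swap ∷≋ ≋-refl)) e₂ y∼ f₂ f₃)
  ... | inj₂ (inj₂ (L , f , f′)) with ∷-≋-∷²⁻ f′
  ... | inj₁ (x∼ , _)        = contradiction x∼ ¬x′
  ... | inj₂ (inj₁ (x∼ , _)) = contradiction x∼ ¬x′
  ... | inj₂ (inj₂ (G₄ , h , h′)) =
    contract-disjoint e₁ e₂ r h′ (≋-trans f (≋-trans (∼-refl ∷≋ h) (by (1 ∷ [])))) ih

  go : R ▷ R′ → R ++ G₁ ≋ cut p q ∷ daimon (p ∷ as) ∷ daimon (q ∷ bs) ∷ G →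
       Linear (R ++ G₁) → Good (R′ ++ G₁) → Contractible (R′ ++ G₁) → Goal
  go r@par-tensor e lin g ih =
    conn-step (λ ()) (λ ()) (λ ()) refl r e lin ih λ _ _ _ ()
  go r@tensor-daimon e lin g ih =
    conn-step (λ ()) (λ ()) (λ ()) refl r e lin ih λ t≢p e₁ e₂ y∼ f₂ f₃ →
      contract-tensor e₁ e₂ t≢p (daimon-∼⁻ y∼) f₂ f₃ ih
  go r@(par-daimon {as = us} {bs = vs}) e lin g ih =
    conn-step (λ ()) (λ ()) (λ ()) refl r e lin ih λ t≢p e₁ e₂ y∼ f₂ f₃ →
      contract-par e₁ e₂ t≢p us vs (daimon-∼⁻ y∼) f₂ f₃ ih
  go r@(daimon-daimon {as = us} {bs = vs}) e lin g ih with cut-∷-≋⁻ (λ ()) (λ ()) e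
  ... | inj₁ (∼-refl , e′) =
    same-cut-daimon (Linear-tail (cut _ _) (Linear-resp-≋ (by (1 ∷ [])) lin)) e′ g
  ... | inj₁ (cut-swap , e′) =
    same-cut-daimon (Linear-tail (cut _ _) (Linear-resp-≋ (by (1 ∷ 1 ∷ [])) lin))
      (≋-trans (by (1 ∷ [])) e′) (daimon-comm us g)
  ... | inj₂ (G₂ , G₃ , e₁ , e₂ , e₃)
    with s≢p , s≢q , t≢p , t≢q ← cut-source (daimon (_ ∷ us) ∷ daimon (_ ∷ vs) ∷ G₂) (Linear-resp-≋
           (≋-trans (∼-refl ∷≋ ∼-refl ∷≋ ∼-refl ∷≋ e₁) (by (1 ∷ 2 ∷ []))) lin)
    with ∷-≋-∷²⁻ e₃
  ... | inj₁ (x∼ , f) with ∷-≋-∷⁻ f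
  ...   | inj₁ (y∼ , f′) =
    contract-loop {G₄ = []} e₁ e₂ (daimon-∼⁻ x∼) (daimon-∼⁻ y∼) f′ (Linear-resp-≋ (by (1 ∷ [])) lin) g
  ...   | inj₂ (_ , f₂ , f₃) = contract-daimon e₁ e₂ s≢p (daimon-∼⁻ x∼) f₂ f₃ ih
  go r@(daimon-daimon {as = us} {bs = vs}) e lin g ih
      | inj₂ (G₂ , G₃ , e₁ , e₂ , e₃) | inj₂ (inj₁ (x∼ , f)) with ∷-≋-∷⁻ f
  ...   | inj₁ (y∼ , f′) = daimon-comm bs
    (contract-loop {G₄ = []} (≋-trans e₁ (cut-swap ∷≋ ≋-refl)) e₂ (daimon-∼⁻ x∼) (daimon-∼⁻ y∼) f′
      (Linear-resp-≋ (by (1 ∷ [])) lin) g)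
  ...   | inj₂ (_ , f₂ , f₃) = daimon-comm bs
    (contract-daimon (≋-trans e₁ (cut-swap ∷≋ ≋-refl)) e₂ s≢q (daimon-∼⁻ x∼) f₂ f₃ ih)
  go r@(daimon-daimon {as = us} {bs = vs}) e lin g ih
      | inj₂ (G₂ , G₃ , e₁ , e₂ , e₃) | inj₂ (inj₂ (L , f , f′)) with ∷-≋-∷²⁻ f′
  ...   | inj₁ (y∼ , h) =
    contract-daimon e₁ (≋-trans e₂ (cut-swap ∷≋ ≋-refl)) t≢p (daimon-∼⁻ y∼) h f
      (Contractible-resp-≋ (daimon (↭.++-comm us vs) ∷≋ ≋-refl) ih)
  ...   | inj₂ (inj₁ (y∼ , h)) = daimon-comm bs
    (contract-daimon (≋-trans e₁ (cut-swap ∷≋ ≋-refl)) (≋-trans e₂ (cut-swap ∷≋ ≋-refl))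
      t≢q (daimon-∼⁻ y∼) h f
      (Contractible-resp-≋ (daimon (↭.++-comm us vs) ∷≋ ≋-refl) ih))
  ...   | inj₂ (inj₂ (_ , h , h′)) =
    contract-disjoint e₁ e₂ r h′ (≋-trans f (∼-refl ∷≋ h)) ih

contract : Good K → Linear K → Contractible K
contract (done k) lin e
  -- A hypergraph with a cut to contract has at least three links, the final one has a single link.
  with () ← ≋.xs↭ys⇒|xs|≡|ys| (≋-trans (≋-sym e) k)
contract (step r k g) lin e =
  contract-step r (≋-trans (≋-sym k) e) (Linear-resp-≋ k lin) g
    (contract g (Linear-▷ r (Linear-resp-≋ k lin)))

∷-≋-++⁻ : ∀ R → l ∷ H ≋ R ++ G →
  (∃[ R₀ ] R ≋ l ∷ R₀ × H ≋ R₀ ++ G) ⊎ (∃[ G₀ ] G ≋ l ∷ G₀ × H ≋ R ++ G₀)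
∷-≋-++⁻ []      e = inj₂ (_ , ≋-sym e , ≋-refl)
∷-≋-++⁻ (x ∷ R) e with ∷-≋-∷⁻ e
... | inj₁ (l∼x , e′) = inj₁ (R , ≋-sym (l∼x ∷≋ ≋-refl) , e′)
... | inj₂ (L , h , e′) with ∷-≋-++⁻ R (≋-sym e′)
... | inj₁ (R₀ , f , f′) =
  inj₁ (x ∷ R₀ , ≋-trans (∼-refl ∷≋ f) (by (1 ∷ [])) , ≋-trans h (∼-refl ∷≋ f′))
... | inj₂ (G₀ , f , f′) = inj₂ (G₀ , f , ≋-trans h (∼-refl ∷≋ f′))

-- In every rule a participating daimon has an output under the reduced cut. This excludes daimons
-- whose outputs are all inputs of a connective link.
daimon-∷-▷⁻ : R ▷ R′ → daimon as ∷ H ≋ R ++ G →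
  (∃[ s ] ∃[ t ] ∃[ L ] s ∈ˡ as × H ≋ cut s t ∷ L)
  ⊎ ∃[ L ] G ≋ daimon as ∷ L × H ≋ R ++ L
daimon-∷-▷⁻ {as = as} r e = go r e
  where
  output : ∀ {x xs} → daimon as ∼ daimon (x ∷ xs) → x ∈ˡ as
  output d = ↭.∈-resp-↭ (↭-sym (daimon-∼⁻ d)) (here refl)

  go : R ▷ R′ → daimon as ∷ H ≋ R ++ G →
    (∃[ s ] ∃[ t ] ∃[ L ] s ∈ˡ as × H ≋ cut s t ∷ L)
    ⊎ ∃[ L ] G ≋ daimon as ∷ L × H ≋ R ++ L
  go par-tensor e with ∷-≋-∷³⁻ e
  ... | inj₁ (() , _)
  ... | inj₂ (inj₁ (() , _))
  ... | inj₂ (inj₂ (inj₁ (() , _)))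
  ... | inj₂ (inj₂ (inj₂ x)) = inj₂ x
  go daimon-daimon e with ∷-≋-∷³⁻ e
  ... | inj₁ (d , f) = inj₁ (_ , _ , _ , output d , f)
  ... | inj₂ (inj₁ (() , _))
  ... | inj₂ (inj₂ (inj₁ (d , f))) =
    inj₁ (_ , _ , _ , output d , ≋-trans f (≋-trans (by (1 ∷ [])) (cut-swap ∷≋ ≋-refl)))
  ... | inj₂ (inj₂ (inj₂ x)) = inj₂ x
  go tensor-daimon e with ∷-≋-∷³⁻ e
  ... | inj₁ (() , _)
  ... | inj₂ (inj₁ (() , _))
  ... | inj₂ (inj₂ (inj₁ (d , f))) =
    inj₁ (_ , _ , _ , output d , ≋-trans f (≋-trans (by (1 ∷ [])) (cut-swap ∷≋ ≋-refl)))
  ... | inj₂ (inj₂ (inj₂ x)) = inj₂ x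
  go par-daimon e with ∷-≋-∷³⁻ e
  ... | inj₁ (() , _)
  ... | inj₂ (inj₁ (() , _))
  ... | inj₂ (inj₂ (inj₁ (d , f))) =
    inj₁ (_ , _ , _ , output d , ≋-trans f (≋-trans (by (1 ∷ [])) (cut-swap ∷≋ ≋-refl)))
  ... | inj₂ (inj₂ (inj₂ x)) = inj₂ x

-- Replacing a connective link, whose inputs are outputs of daimons without other
-- outputs, with a daimon preserves goodness.  This is how ✠ 1 gets into A ⊗ B and
-- A ⅋ B, which contain such links.  The replacement commutes with every reduction
-- step, except if the step reduces the cut on the connective link itself.

record Captive (k d : Link) : Set where
  constructor captive
  field
    {outputs} : List Pos
    is-daimon : d ≡ daimon outputs
    captured  : ∀ {s} → s ∈ˡ outputs → s ∈ˡ source k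

∉-sources : s ∈ˡ source l → Linear (l ∷ H) → ¬ (H ≋ cut s t ∷ L)
∉-sources s∈l lin e with xs , f ← ∈⇒↭ s∈l =
  Unique⇒¬twice (Unique-resp-↭
    (↭-trans (↭.++⁺ f (sources-≋ e)) (prep _ (↭.shift _ xs _)))
    (sources-unique lin))

module Collapse (k : Link) (p : Pos) (D : Hypergraph)
  (not-cut : ∀ {s t} → ¬ k ∼ cut s t)
  (not-daimon : ∀ {as} → ¬ k ∼ daimon as) (captives : All (Captive k) D)
  (k-step : ∀ {R R′ R₀ G} → R ▷ R′ → k ∷ R₀ ≋ R ++ [] → Linear (R ++ D ++ G) →
            Good (R′ ++ D ++ G) → Good (daimon (p ∷ []) ∷ R₀ ++ G))
  where

  -- By linearity of the sources, no cut can reach an output that already feeds `k`. Hence no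
  -- captive daimon takes part in the step, and all of them lie in its context.
  strip : ∀ {D} → All (Captive k) D → R ▷ R′ → Linear (k ∷ D ++ G) → k ∷ D ++ G ≋ R ++ G₁ →
          ∃[ G₀ ] G₁ ≋ D ++ G₀ × k ∷ G ≋ R ++ G₀
  strip []       r lin e = _ , ≋-refl , e
  strip (captive refl cap ∷ cs) r lin e with daimon-∷-▷⁻ r (≋-trans (by (1 ∷ [])) e)
  ... | inj₁ (s , t , L , s∈ , f) with ∷-≋-∷⁻ f
  ...   | inj₁ (k∼ , _)     = contradiction k∼ not-cut
  ...   | inj₂ (L₀ , f , _) =
    contradiction (≋-trans (∼-refl ∷≋ f) (by (1 ∷ []))) (∉-sources (cap s∈) lin)
  strip {R = R} (captive refl cap ∷ cs) r lin e | inj₂ (L , f , f′)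
    with G₀ , h , h′ ← strip cs r (Linear-tail (daimon _) (Linear-resp-≋ (by (1 ∷ [])) lin)) f′ =
    G₀ , ≋-trans f (∼-refl ∷≋ h) , h′

  collapse : Good K → Linear K → K ≋ k ∷ D ++ G → Good (daimon (p ∷ []) ∷ G)
  collapse (done f) lin e with ∷-≋-∷⁻ (≋-trans (≋-sym e) f)
  ... | inj₂ (_ , _ , x) = contradiction (≋-sym x) ≋.¬x∷xs↭[]
  ... | inj₁ (k∼ , _) = contradiction k∼ not-daimon
  collapse {G = G} (step {R = R} {R′ = R′} {G = G₁} r f g) lin e
    with G₀ , e₁ , e₂ ← strip captives r (Linear-resp-≋ e lin) (≋-trans (≋-sym e) f)
    with ∷-≋-++⁻ R e₂
  ... | inj₁ (R₀ , h , h′) = Good-resp-≋ (∼-refl ∷≋ ≋-sym h′)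
    (k-step r (≋-trans (≋-sym h) (≋-sym (≋.++-identityʳ R)))
      (Linear-resp-≋ (≋-trans f (≋.++⁺ˡ R e₁)) lin) (Good-resp-≋ (≋.++⁺ˡ R′ e₁) g))
  ... | inj₂ (G₂ , h , h′) = step r (≋-trans (∼-refl ∷≋ h′) (float R))
    (Good-resp-≋ (float R′)
      (collapse g (Linear-▷ r (Linear-resp-≋ f lin))
        (≋-trans (≋.++⁺ˡ R′ (≋-trans e₁ (≋-trans (≋.++⁺ˡ D h) (≋.↭-shift D G₂))))
          (≋-trans (≋.↭-shift R′ _) (∼-refl ∷≋ ≋.shifts R′ D)))))

contract-Linear : Linear K → K ≋ cut p q ∷ daimon (p ∷ as) ∷ daimon (q ∷ bs) ∷ G →
                  Linear (daimon (as ++ bs) ∷ G)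
contract-Linear lin e = Linear-▷ daimon-daimon (Linear-resp-≋ (≋-trans e (by (1 ∷ []))) lin)

collapse-tensor : Good K → Linear K →
  K ≋ tensor a b p ∷ daimon (a ∷ []) ∷ daimon (b ∷ []) ∷ G → Good (daimon (p ∷ []) ∷ G)
collapse-tensor {a = a} {b = b} {p = p} = Collapse.collapse (tensor a b p) p
  (daimon (a ∷ []) ∷ daimon (b ∷ []) ∷ []) (λ ()) (λ ())
  (captive refl (λ where (here refl) → here refl) ∷
   captive refl (λ where (here refl) → there (here refl)) ∷ [])
  k-step
  where
  k-step : R ▷ R′ → tensor a b p ∷ L ≋ R ++ [] →
    Linear (R ++ daimon (a ∷ []) ∷ daimon (b ∷ []) ∷ G) →
    Good (R′ ++ daimon (a ∷ []) ∷ daimon (b ∷ []) ∷ G) → Good (daimon (p ∷ []) ∷ L ++ G)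
  k-step {G = G} (par-tensor {a = a′} {b = b′} {p = s}) e lin g with ∷-≋-∷³⁻ e
  ... | inj₁ (() , _)
  ... | inj₂ (inj₁ (() , _))
  ... | inj₂ (inj₂ (inj₂ (_ , x , _))) = contradiction (≋-sym x) ≋.¬x∷xs↭[]
  ... | inj₂ (inj₂ (inj₁ (∼-refl , f)))
    with linear su tu ← lin
    with (a≢b ∷ a≢a′ ∷ a≢b′ ∷ _ ∷ _ ∷ as) ∷ (b≢a′ ∷ b≢b′ ∷ _ ∷ _ ∷ bs) ∷ _
           ← Unique-resp-↭ (reorder-↭ (4 ∷ 4 ∷ [])) su
       | _ ∷ _ ∷ (_ ∷ at) ∷ bt ∷ _ ← tu =
    -- Against a par link the single daimon splits into two daimons with one output each: these are
    -- the captive ones, with `s` and `p` in place of `a` and `b`.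
    step (par-daimon {a = a′} {b = b′} {p = s} {q = p} {as = []} {bs = []})
      (≋-trans (∼-refl ∷≋ ≋.++⁺ʳ G f) (by (1 ∷ 1 ∷ [])))
      (subst Good
        (cong₂ _∷_ (cong₂ cut (sub-other s p a≢a′ b≢a′) (sub-fst a))
        (cong₂ _∷_ (cong₂ cut (sub-other s p a≢b′ b≢b′) (sub-snd s p a≢b))
        (cong₂ _∷_ (cong (λ x → daimon (x ∷ [])) (sub-fst a))
        (cong₂ _∷_ (cong (λ x → daimon (x ∷ [])) (sub-snd s p a≢b))
          (rename-sub s p G as bs at bt)))))
        (Good-rename (sub a s b p) g))
  k-step daimon-daimon e lin g with ∷-≋-∷³⁻ e
  ... | inj₁ (() , _)
  ... | inj₂ (inj₁ (() , _))
  ... | inj₂ (inj₂ (inj₁ (() , _)))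
  ... | inj₂ (inj₂ (inj₂ (_ , x , _))) = contradiction (≋-sym x) ≋.¬x∷xs↭[]
  k-step {G = G} r@tensor-daimon e lin g with ∷-≋-∷³⁻ e
  ... | inj₂ (inj₁ (() , _))
  ... | inj₂ (inj₂ (inj₁ (() , _)))
  ... | inj₂ (inj₂ (inj₂ (_ , x , _))) = contradiction (≋-sym x) ≋.¬x∷xs↭[]
  -- The single daimon is absorbed in one merge. The tensor link leaves instead two cuts, each with
  -- a captive daimon; contracting first the one on `a`, then the one on `b`, yields the same
  -- hypergraph.
  ... | inj₁ (∼-refl , f) = step daimon-daimon (∼-refl ∷≋ ≋.++⁺ʳ G f)
    (contract (contract g (Linear-▷ r lin) e₁) (contract-Linear (Linear-▷ r lin) e₁) (by (1 ∷ 1 ∷ [])))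
    where e₁ = by (0 ∷ 2 ∷ 1 ∷ [])
  k-step par-daimon e lin g with ∷-≋-∷³⁻ e
  ... | inj₁ (() , _)
  ... | inj₂ (inj₁ (() , _))
  ... | inj₂ (inj₂ (inj₁ (() , _)))
  ... | inj₂ (inj₂ (inj₂ (_ , x , _))) = contradiction (≋-sym x) ≋.¬x∷xs↭[]

collapse-par : Good K → Linear K →
  K ≋ par a b p ∷ daimon (a ∷ b ∷ []) ∷ G → Good (daimon (p ∷ []) ∷ G)
collapse-par {a = a} {b = b} {p = p} = Collapse.collapse (par a b p) p
  (daimon (a ∷ b ∷ []) ∷ []) (λ ()) (λ ()) (captive refl id ∷ []) k-step
  where
  k-step : R ▷ R′ → par a b p ∷ L ≋ R ++ [] → Linear (R ++ daimon (a ∷ b ∷ []) ∷ G) →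
    Good (R′ ++ daimon (a ∷ b ∷ []) ∷ G) → Good (daimon (p ∷ []) ∷ L ++ G)
  k-step {G = G} (par-tensor {q = q} {c = c} {d = d}) e lin g with ∷-≋-∷³⁻ e
  ... | inj₂ (inj₁ (() , _))
  ... | inj₂ (inj₂ (inj₁ (() , _)))
  ... | inj₂ (inj₂ (inj₂ (_ , x , _))) = contradiction (≋-sym x) ≋.¬x∷xs↭[]
  ... | inj₁ (∼-refl , f)
    with linear su tu ← lin
    with (a≢b ∷ _ ∷ _ ∷ a≢c ∷ a≢d ∷ as) ∷ (_ ∷ _ ∷ b≢c ∷ b≢d ∷ bs) ∷ _ ← su
       | _ ∷ _ ∷ (_ ∷ at) ∷ bt ∷ _ ← tu =
    -- Against a tensor link the single daimon gets two outputs: it becomes the captive daimon, with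
    -- `q` and `p` in place of `a` and `b`.
    step (tensor-daimon {a = c} {b = d} {p = q} {q = p} {as = []})
      (≋-trans (∼-refl ∷≋ ≋.++⁺ʳ G f)
        (≋-trans (by (2 ∷ 1 ∷ [])) (∼-refl ∷≋ cut-swap ∷≋ ≋-refl)))
      (Good-resp-≋ (cut-swap ∷≋ cut-swap ∷≋ ≋-refl) (subst Good
        (cong₂ _∷_ (cong₂ cut (sub-fst a) (sub-other q p a≢c b≢c))
        (cong₂ _∷_ (cong₂ cut (sub-snd q p a≢b) (sub-other q p a≢d b≢d))
        (cong₂ _∷_ (cong₂ (λ x y → daimon (x ∷ y ∷ [])) (sub-fst a) (sub-snd q p a≢b))
          (rename-sub q p G as bs at bt))))
        (Good-rename (sub a q b p) g)))
  k-step daimon-daimon e lin g with ∷-≋-∷³⁻ e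
  ... | inj₁ (() , _)
  ... | inj₂ (inj₁ (() , _))
  ... | inj₂ (inj₂ (inj₁ (() , _)))
  ... | inj₂ (inj₂ (inj₂ (_ , x , _))) = contradiction (≋-sym x) ≋.¬x∷xs↭[]
  k-step tensor-daimon e lin g with ∷-≋-∷³⁻ e
  ... | inj₁ (() , _)
  ... | inj₂ (inj₁ (() , _))
  ... | inj₂ (inj₂ (inj₁ (() , _)))
  ... | inj₂ (inj₂ (inj₂ (_ , x , _))) = contradiction (≋-sym x) ≋.¬x∷xs↭[]
  k-step {G = G} r@par-daimon e lin g with ∷-≋-∷³⁻ e
  ... | inj₂ (inj₁ (() , _))
  ... | inj₂ (inj₂ (inj₁ (() , _)))
  ... | inj₂ (inj₂ (inj₂ (_ , x , _))) = contradiction (≋-sym x) ≋.¬x∷xs↭[]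
  -- The par link has split the outer daimon, and the captive daimon is cut against both halves.
  -- Contracting these two cuts glues the halves together again, whatever the splitting was.
  ... | inj₁ (∼-refl , f) = step daimon-daimon (∼-refl ∷≋ ≋.++⁺ʳ G f)
    (contract (contract g (Linear-▷ r lin) e₁) (contract-Linear (Linear-▷ r lin) e₁) (by (1 ∷ [])))
    where e₁ = by (0 ∷ 3 ∷ 1 ∷ [])

-- Comparison with the cut elimination of nets

∉⇒All : ∀ {x : Pos} xs → ¬ x ∈ˡ xs → All (x ≢_) xs
∉⇒All xs = All.¬Any⇒All¬ xs

∉-positions : ∀ R → ¬ p ∈ˡ positions H → H ≋ R ++ G →
  (All (p ≢_) (sources R) × All (p ≢_) (sources G)) ×
  (All (p ≢_) (targets R) × All (p ≢_) (targets G))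
∉-positions {H = H} {G = G} R p∉ e with All.++⁻ (sources H) (∉⇒All (positions H) p∉)
... | ps , pt =
  All.++⁻ (sources R) (subst (All _) (sources-++ R G) (↭.All-resp-↭ (sources-≋ e) ps)) ,
  All.++⁻ (targets R) (subst (All _) (targets-++ R G) (↭.All-resp-↭ (targets-≋ e) pt))

CutBetween⇒∼ : ∀ {l} → CutBetween p q l → l ∼ cut p q
CutBetween⇒∼ (inj₁ refl) = ∼-refl
CutBetween⇒∼ (inj₂ refl) = cut-swap

++-interchange : (as bs cs ds : List Pos) → (as ++ bs) ++ (cs ++ ds) ↭ (as ++ cs) ++ (bs ++ ds)
++-interchange as bs cs ds =
  ↭-trans (↭.++-assoc as bs (cs ++ ds))
    (↭-trans (↭.++⁺ˡ as (↭.shifts bs cs)) (↭-sym (↭.++-assoc as cs (bs ++ ds))))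

other-outputs : ∀ l → as ↭ q ∷ bs → All (p ≢_) (target l ++ as ++ []) → All (p ≢_) bs
other-outputs {as = as} l e x = All.tail (↭.All-resp-↭ e (All.++⁻ˡ as (All.++⁻ʳ (target l) x)))

-- The fresh names of the genuine step are renamed to the two ends of its cut. Freshness guarantees
-- that this changes nothing else in the contractum or the context.
Good-↝ : positions H ⊢ R ↝ R′ → H ↭ R ++ G → K ↭ R′ ++ G → Good K → Good H
Good-↝ (par-tensor c) e f good =
    step par-tensor (≋-trans (↭⇒≋ e) (∼-refl ∷≋ CutBetween⇒∼ c ∷≋ ≋-refl))
      (Good-resp-≋ (↭⇒≋ f) good)
Good-↝ (daimon-daimon {a = as} {p = p} {b = bs} {a′ = as′} {q = q} {b′ = bs′} c) e f good =
    step (daimon-daimon {as = as ++ bs} {bs = as′ ++ bs′})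
      (≋-trans (↭⇒≋ e)
        (daimon (↭.shift p as bs) ∷≋ CutBetween⇒∼ c ∷≋ daimon (↭.shift q as′ bs′) ∷≋ ≋-refl))
      (Good-resp-≋ (↭⇒≋ f) good)
Good-↝ {G = G} (tensor-daimon {c = l} {p₁ = p₁} {p₂ = p₂} {p = p} {a = as} {q = q} {b = bs}
                              {q¹ = r} {q² = s} c r∉ s∉ r≢s) e f good
    with ((r₁ ∷ r₂ ∷ _) , rG) , ((_ ∷ rt) , rG′)
         ← ∉-positions (tensor p₁ p₂ p ∷ l ∷ daimon (as ++ q ∷ bs) ∷ []) r∉ (↭⇒≋ e)
       | ((s₁ ∷ s₂ ∷ _) , sG) , ((_ ∷ st) , sG′)
         ← ∉-positions (tensor p₁ p₂ p ∷ l ∷ daimon (as ++ q ∷ bs) ∷ []) s∉ (↭⇒≋ e)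
    with r′ ← other-outputs l (↭.shift q as bs) rt
       | s′ ← other-outputs l (↭.shift q as bs) st =
    step (tensor-daimon {a = p₁} {b = p₂} {as = as ++ bs})
      (≋-trans (↭⇒≋ e) (∼-refl ∷≋ CutBetween⇒∼ c ∷≋ daimon (↭.shift q as bs) ∷≋ ≋-refl))
      (subst Good
        (cong₂ _∷_ (cong₂ cut (sub-other p q r₁ s₁) (sub-fst r))
        (cong₂ _∷_ (cong₂ cut (sub-other p q r₂ s₂) (sub-snd p q r≢s))
        (cong₂ _∷_ (cong daimon (cong₂ _∷_ (sub-fst r) (cong₂ _∷_ (sub-snd p q r≢s)
                     (map-sub p q r′ s′))))
          (rename-sub p q G rG sG rG′ sG′))))
        (Good-rename (sub r p s q) (Good-resp-≋
          (≋-trans (↭⇒≋ f) (∼-refl ∷≋ ∼-refl ∷≋ daimon (↭.shifts as (r ∷ s ∷ [])) ∷≋ ≋-refl)) good)))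
Good-↝ {G = G} (par-daimon {c = l} {q₁ = q₁} {q₂ = q₂} {q = q} {a = as} {p = p} {b = bs} {p¹ = r}
                       {p² = s} {a′ = as′} {a″ = as″} {b′ = bs′} {b″ = bs″} c r∉ s∉ r≢s as↭ bs↭) e f good
    with ((r₁ ∷ r₂ ∷ _) , rG) , ((_ ∷ rt) , rG′)
         ← ∉-positions (par q₁ q₂ q ∷ l ∷ daimon (as ++ p ∷ bs) ∷ []) r∉ (↭⇒≋ e)
       | ((s₁ ∷ s₂ ∷ _) , sG) , ((_ ∷ st) , sG′)
         ← ∉-positions (par q₁ q₂ q ∷ l ∷ daimon (as ++ p ∷ bs) ∷ []) s∉ (↭⇒≋ e)
    with f′ ← ↭-trans (↭.shift p as bs) (prep p (↭-trans (↭-sym (↭.++⁺ as↭ bs↭))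
                (++-interchange as′ as″ bs′ bs″)))
    with r′ , r″ ← All.++⁻ (as′ ++ bs′) (other-outputs l f′ rt)
       | s′ , s″ ← All.++⁻ (as′ ++ bs′) (other-outputs l f′ st) =
    step (par-daimon {a = q₁} {b = q₂} {as = as′ ++ bs′} {bs = as″ ++ bs″})
      (≋-trans (↭⇒≋ e) (∼-refl ∷≋ CutBetween⇒∼ c ∷≋ daimon f′ ∷≋ ≋-refl))
      (subst Good
        (cong₂ _∷_ (cong₂ cut (sub-other q p r₁ s₁) (sub-fst r))
        (cong₂ _∷_ (cong₂ cut (sub-other q p r₂ s₂) (sub-snd q p r≢s))
        (cong₂ _∷_ (cong daimon (cong₂ _∷_ (sub-fst r) (map-sub q p r′ s′)))
        (cong₂ _∷_ (cong daimon (cong₂ _∷_ (sub-snd q p r≢s) (map-sub q p r″ s″)))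
          (rename-sub q p G rG sG rG′ sG′)))))
        (Good-rename (sub r q s p) (Good-resp-≋
          (≋-trans (↭⇒≋ f) (∼-refl ∷≋ ∼-refl ∷≋
            daimon (↭.shift r as′ bs′) ∷≋ daimon (↭.shift s as″ bs″) ∷≋ ≋-refl)) good)))

⟶*⇒Good : ∀ {S} → S ⟶* ✠ 0 → Good (links S)
⟶*⇒Good ε        = done ≋-refl
⟶*⇒Good (s ◅ ss) = Good-↝ rule before after (⟶*⇒Good ss)
  where open _⟶_ s

Pointwise-↭ : ∀ {H K L} → Pointwise _∼_ H K → K ↭ L → ∃[ M ] H ↭ M × Pointwise _∼_ M L
Pointwise-↭ h             refl            = _ , ↭-refl , h
Pointwise-↭ (l∼ ∷ h)      (prep _ e)      with _ , f , k ← Pointwise-↭ h e = _ , prep _ f , l∼ ∷ k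
Pointwise-↭ (l∼ ∷ m∼ ∷ h) (swap _ _ e)    with _ , f , k ← Pointwise-↭ h e = _ , swap _ _ f , m∼ ∷ l∼ ∷ k
Pointwise-↭ h             (_↭_.trans e f)
  with _ , e′ , k ← Pointwise-↭ h e
  with _ , f′ , k′ ← Pointwise-↭ k f =
  _ , ↭-trans e′ f′ , k′

-- A genuine step has to exhibit the actual links of its redex up to permutation, so `≋` is factored
-- into a permutation of links followed by a change inside each link.
≋⇒↭-Pointwise : H ≋ K → ∃[ M ] H ↭ M × Pointwise _∼_ M K
≋⇒↭-Pointwise (Homogeneous.refl h)       = _ , ↭-refl , h
≋⇒↭-Pointwise (Homogeneous.prep l∼ e)    with _ , f , k ← ≋⇒↭-Pointwise e = _ , prep _ f , l∼ ∷ k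
≋⇒↭-Pointwise (Homogeneous.swap l∼ m∼ e) with _ , f , k ← ≋⇒↭-Pointwise e = _ , swap _ _ f , m∼ ∷ l∼ ∷ k
≋⇒↭-Pointwise (Homogeneous.trans e f)
  with _ , e′ , k ← ≋⇒↭-Pointwise e | _ , f′ , k′ ← ≋⇒↭-Pointwise f
  with _ , e″ , k″ ← Pointwise-↭ k f′ = _ , ↭-trans e′ e″ , Pointwise.transitive ∼-trans k″ k′

∼-cut⁻ : l ∼ cut p q → CutBetween p q l
∼-cut⁻ ∼-refl   = inj₁ refl
∼-cut⁻ cut-swap = inj₂ refl

∼-daimon⁻ : l ∼ daimon (p ∷ as) → ∃[ bs ] ∃[ cs ] l ≡ daimon (bs ++ p ∷ cs) × bs ++ cs ↭ as
∼-daimon⁻ {p = p} {as = as} l∼ with split l∼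
  where
  split : l ∼ daimon (p ∷ as) → ∃[ bs ] l ≡ daimon bs × bs ↭ p ∷ as
  split ∼-refl     = _ , refl , ↭-refl
  split (daimon e) = _ , refl , e
... | ds , refl , e with bs , cs , refl ← ∈-∃++ (↭.∈-resp-↭ (↭-sym e) (here refl)) =
  bs , cs , refl , ↭.drop-∷ (↭-trans (↭-sym (↭.shift p bs cs)) e)

-- The empty reduction `ε` requires equality with `✠ 0`.
≋-daimon⁻ : H ≋ daimon [] ∷ [] → H ≡ daimon [] ∷ []
≋-daimon⁻ e with ≋⇒↭-Pointwise e
... | _ , f , ∼-refl ∷ [] = ↭.↭-singleton-inv f
... | _ , f , daimon g ∷ [] rewrite ↭.↭-empty-inv g = ↭.↭-singleton-inv f

fresh : (V : List Pos) → ∃[ q ] ¬ q ∈ˡ V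
fresh V = suc (sum V) , λ q∈ → <-irrefl refl (bound V q∈)
  where
  bound : ∀ V {q} → q ∈ˡ V → q ≤ sum V
  bound (v ∷ V) (here refl) = m≤m+n v (sum V)
  bound (v ∷ V) (there q∈)  = ≤-trans (bound V q∈) (m≤n+m (sum V) v)

-- The common refinement of two splittings of a multiset. It is called for because `↝` splits the
-- outputs before and after the cut one separately, whereas `▷` splits them all together.
++-↭-refine : ∀ (as : List Pos) {bs} us {vs} → as ++ bs ↭ us ++ vs →
  ∃[ us′ ] ∃[ us″ ] ∃[ vs′ ] ∃[ vs″ ]
    us′ ++ us″ ↭ us × vs′ ++ vs″ ↭ vs × us′ ++ vs′ ↭ as × us″ ++ vs″ ↭ bs
++-↭-refine []       us {vs} e = [] , us , [] , vs , ↭-refl , ↭-refl , ↭-refl , ↭-sym e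
++-↭-refine (x ∷ as) us {vs} e with ∷-↭-++⁻ us e
... | inj₁ (_ , us↭ , e′) with us′ , us″ , vs′ , vs″ , e₁ , e₂ , e₃ , e₄ ← ++-↭-refine as _ e′ =
  x ∷ us′ , us″ , vs′ , vs″ , ↭-trans (prep x e₁) (↭-sym us↭) , e₂ , prep x e₃ , e₄
... | inj₂ (_ , vs↭ , e′) with us′ , us″ , vs′ , vs″ , e₁ , e₂ , e₃ , e₄ ← ++-↭-refine as _ e′ =
  us′ , us″ , x ∷ vs′ , vs″ , e₁ , ↭-trans (prep x e₂) (↭-sym vs↭)
  , ↭-trans (↭.shift x us′ vs′) (prep x e₃) , e₄

Closed⟶* : Hypergraph → Set
Closed⟶* H = ⟨ H , [] ⟩ ⟶* ✠ 0

-- A genuine step must take fresh names where `▷` reuses `p` and `q`, so the remaining reduction is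
-- resumed up to a renaming `σ`. Linearity ensures that `p` and `q` occur nowhere else, so that `σ`
-- affects only the new cuts and outputs.
contractum⟶* : R ▷ R′ → H ↭ K → Pointwise _∼_ K (R ++ G) → Linear (R ++ G) →
  (∀ σ {L} → L ≋ rename σ (R′ ++ G) → Linear L → Closed⟶* L) → Closed⟶* H
contractum⟶* {G = G} r@par-tensor f (∼-refl ∷ c∼ ∷ ∼-refl ∷ h) lin ih =
  record { rule = par-tensor (∼-cut⁻ c∼) ; before = f ; after = ↭-refl ; conclusions-≡ = refl } ◅
  ih id (≋-trans e (≡⇒≋ (sym (rename-id _)))) (Linear-resp-≋ (≋-sym e) (Linear-▷ r lin))
  where e = ∼-refl ∷≋ ∼-refl ∷≋ Homogeneous.refl h
contractum⟶* {G = G} r@(daimon-daimon {as = as} {bs = bs}) f (d∼ ∷ c∼ ∷ d∼′ ∷ h) lin ih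
  with _ , _ , refl , as↭ ← ∼-daimon⁻ d∼ | _ , _ , refl , bs↭ ← ∼-daimon⁻ d∼′ =
  record { rule = daimon-daimon (∼-cut⁻ c∼) ; before = f ; after = ↭-refl ; conclusions-≡ = refl } ◅
  ih id (≋-trans e (≡⇒≋ (sym (rename-id _)))) (Linear-resp-≋ (≋-sym e) (Linear-▷ r lin))
  where
  e = daimon (↭.++⁺ as↭ bs↭) ∷≋ Homogeneous.refl h
contractum⟶* {H = H} {G = G} (tensor-daimon {a = a} {b = b} {p = p} {q = q} {as = as})
             f (∼-refl ∷ c∼ ∷ d∼ ∷ h) lin ih
  with ds , ds′ , refl , as↭ ← ∼-daimon⁻ d∼
  with r , r∉ ← fresh (positions H)
  with s , s∉ ← fresh (r ∷ positions H)
  with e ← ≋-trans (↭⇒≋ f) (Homogeneous.refl (∼-refl ∷ c∼ ∷ d∼ ∷ h))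
  with (p≢q ∷ p≢a ∷ p≢b ∷ pG) ∷ (q≢a ∷ q≢b ∷ qG) ∷ uG
         ← Unique-resp-↭ (reorder-↭ (2 ∷ 2 ∷ [])) (sources-unique lin)
     | (_ ∷ pt) ∷ qt ∷ ut ← targets-unique lin
     | ((r≢a ∷ r≢b ∷ _) , rG) , ((_ ∷ _ ∷ rt) , rtG)
         ← ∉-positions (tensor a b p ∷ cut p q ∷ daimon (q ∷ as) ∷ []) r∉ e
     | ((s≢a ∷ s≢b ∷ _) , sG) , ((_ ∷ _ ∷ st) , stG)
         ← ∉-positions (tensor a b p ∷ cut p q ∷ daimon (q ∷ as) ∷ []) (s∉ ∘ there) e
  with pas , ptG ← All.++⁻ as pt | qas , qtG ← All.++⁻ as qt
  with e′ ← ∼-refl ∷≋ ∼-refl ∷≋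
              daimon (↭-trans (↭.shifts ds (r ∷ s ∷ [])) (prep r (prep s as↭))) ∷≋ Homogeneous.refl h =
  record { rule = tensor-daimon (∼-cut⁻ c∼) r∉ (s∉ ∘ there) (s∉ ∘ here ∘ sym)
         ; before = f ; after = ↭-refl ; conclusions-≡ = refl } ◅
  ih (sub p r q s)
    (≋-trans e′ (≡⇒≋ (sym
      (cong₂ _∷_ (cong₂ cut (sub-other r s p≢a q≢a) (sub-fst p))
      (cong₂ _∷_ (cong₂ cut (sub-other r s p≢b q≢b) (sub-snd r s p≢q))
      (cong₂ _∷_ (cong daimon (cong₂ _∷_ (sub-fst p) (cong₂ _∷_ (sub-snd r s p≢q)
                   (map-sub r s pas qas))))
        (rename-sub r s G pG qG ptG qtG)))))))
    (Linear-resp-≋ (≋-sym e′) (linear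
      (Unique-resp-↭ (reorder-↭ (2 ∷ 0 ∷ 1 ∷ []))
        (((s∉ ∘ here ∘ sym) ∷ r≢a ∷ r≢b ∷ rG) ∷ (s≢a ∷ s≢b ∷ sG) ∷ uG))
      (((s∉ ∘ here ∘ sym) ∷ All.++⁺ (All.++⁻ˡ as rt) rtG) ∷ All.++⁺ (All.++⁻ˡ as st) stG ∷ ut)))
contractum⟶* {H = H} {G = G} (par-daimon {a = a} {b = b} {p = p} {q = q} {as = as} {bs = bs})
             f (∼-refl ∷ c∼ ∷ d∼ ∷ h) lin ih
  with ds , ds′ , refl , as↭ ← ∼-daimon⁻ d∼
  with us′ , us″ , vs′ , vs″ , e₁ , e₂ , e₃ , e₄ ← ++-↭-refine as ds (↭-sym as↭)
  with r , r∉ ← fresh (positions H)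
  with s , s∉ ← fresh (r ∷ positions H)
  with e ← ≋-trans (↭⇒≋ f) (Homogeneous.refl (∼-refl ∷ c∼ ∷ d∼ ∷ h))
  with (p≢q ∷ p≢a ∷ p≢b ∷ pG) ∷ (q≢a ∷ q≢b ∷ qG) ∷ uG
         ← Unique-resp-↭ (reorder-↭ (2 ∷ 2 ∷ [])) (sources-unique lin)
     | (_ ∷ pt) ∷ qt ∷ ut ← targets-unique lin
     | ((r≢a ∷ r≢b ∷ _) , rG) , ((_ ∷ _ ∷ rt) , rtG)
         ← ∉-positions (par a b p ∷ cut p q ∷ daimon (q ∷ as ++ bs) ∷ []) r∉ e
     | ((s≢a ∷ s≢b ∷ _) , sG) , ((_ ∷ _ ∷ st) , stG)
         ← ∉-positions (par a b p ∷ cut p q ∷ daimon (q ∷ as ++ bs) ∷ []) (s∉ ∘ there) e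
  with pabs , ptG ← All.++⁻ (as ++ bs) pt | qabs , qtG ← All.++⁻ (as ++ bs) qt
  with pas , pbs ← All.++⁻ as pabs | qas , qbs ← All.++⁻ as qabs
  with e′ ← ∼-refl ∷≋ ∼-refl ∷≋
              daimon (↭-trans (↭.shift r us′ vs′) (prep r e₃)) ∷≋
              daimon (↭-trans (↭.shift s us″ vs″) (prep s e₄)) ∷≋ Homogeneous.refl h =
  record { rule = par-daimon (∼-cut⁻ c∼) r∉ (s∉ ∘ there) (s∉ ∘ here ∘ sym) e₁ e₂
         ; before = f ; after = ↭-refl ; conclusions-≡ = refl } ◅
  ih (sub p r q s)
    (≋-trans e′ (≡⇒≋ (sym
      (cong₂ _∷_ (cong₂ cut (sub-other r s p≢a q≢a) (sub-fst p))
      (cong₂ _∷_ (cong₂ cut (sub-other r s p≢b q≢b) (sub-snd r s p≢q))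
      (cong₂ _∷_ (cong daimon (cong₂ _∷_ (sub-fst p) (map-sub r s pas qas)))
      (cong₂ _∷_ (cong daimon (cong₂ _∷_ (sub-snd r s p≢q) (map-sub r s pbs qbs)))
        (rename-sub r s G pG qG ptG qtG))))))))
    (Linear-resp-≋ (≋-sym e′) (linear
      (Unique-resp-↭ (reorder-↭ (2 ∷ 0 ∷ 1 ∷ []))
        (((s∉ ∘ here ∘ sym) ∷ r≢a ∷ r≢b ∷ rG) ∷ (s≢a ∷ s≢b ∷ sG) ∷ uG))
      (Unique-resp-↭ (prep r (↭-trans (prep s (↭.++-assoc as bs _)) (↭-sym (↭.shift s as _))))
        (((s∉ ∘ here ∘ sym) ∷ All.++⁺ (All.++⁻ˡ (as ++ bs) rt) rtG)
         ∷ All.++⁺ (All.++⁻ˡ (as ++ bs) st) stG ∷ ut))))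

-- The renaming `f` accumulates the fresh names chosen so far; the induction would not go through
-- for `f` the identity alone.
Good⇒⟶*′ : Good H → ∀ f → K ≋ rename f H → Linear K → Closed⟶* K
Good⇒⟶*′ (done e) f k lin rewrite ≋-daimon⁻ (≋-trans k (rename-≋ f e)) = ε
Good⇒⟶*′ (step {R = R} {R′ = R′} {G = G} r e g) f k lin
  with k′ ← ≋-trans k (≋-trans (rename-≋ f e) (≡⇒≋ (rename-++ f R G)))
  with _ , k↭ , h ← ≋⇒↭-Pointwise k′ =
  contractum⟶* (▷-rename f r) k↭ h (Linear-resp-≋ k′ lin) λ σ e′ →
    Good⇒⟶*′ g (σ ∘ f) (≋-trans e′ (≡⇒≋
      (trans (cong (rename σ) (sym (rename-++ f R′ G))) (rename-∘ σ f (R′ ++ G)))))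

Good⇒⟶* : Good H → Linear H → Closed⟶* H
Good⇒⟶* {H = H} g = Good⇒⟶*′ g id (≡⇒≋ (sym (rename-id H)))

-- Nets

Unique-++⁻ˡ : ∀ (xs : List Pos) {ys} → Unique (xs ++ ys) → Unique xs
Unique-++⁻ˡ []       _        = []
Unique-++⁻ˡ (x ∷ xs) (x∉ ∷ u) = All.++⁻ˡ xs x∉ ∷ Unique-++⁻ˡ xs u

Unique-++⇒Disjoint : ∀ (xs : List Pos) {ys} → Unique (xs ++ ys) → Disjoint xs ys
Unique-++⇒Disjoint (x ∷ xs) (x∉ ∷ u) (here refl , y) = All.lookup (All.++⁻ʳ xs x∉) y refl
Unique-++⇒Disjoint (x ∷ xs) (x∉ ∷ u) (there v , y)   = Unique-++⇒Disjoint xs u (v , y)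

Unique-⊆-↭ : ∀ {xs ys : List Pos} → Unique xs → Unique ys →
  (∀ {x} → x ∈ˡ xs → x ∈ˡ ys) → (∀ {y} → y ∈ˡ ys → y ∈ˡ xs) → xs ↭ ys
Unique-⊆-↭ {[]} {[]}    _ _ _ _ = ↭-refl
Unique-⊆-↭ {[]} {_ ∷ _} _ _ _ g with () ← g (here refl)
Unique-⊆-↭ {x ∷ xs} (x∉ ∷ ux) uy f g with as , bs , refl ← ∈-∃++ (f (here refl))
  with x∉′ ∷ uy′ ← Unique-resp-↭ (↭.shift x as bs) uy =
  ↭-trans (prep x (Unique-⊆-↭ ux uy′ f′ g′)) (↭-sym (↭.shift x as bs))
  where
  f′ : ∀ {y} → y ∈ˡ xs → y ∈ˡ as ++ bs
  f′ y∈ with ↭.∈-resp-↭ (↭.shift x as bs) (f (there y∈))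
  ... | here refl = contradiction refl (All.lookup x∉ y∈)
  ... | there z   = z
  g′ : ∀ {y} → y ∈ˡ as ++ bs → y ∈ˡ xs
  g′ y∈ with g (↭.∈-resp-↭ (↭-sym (↭.shift x as bs)) (there y∈))
  ... | here refl = contradiction refl (All.lookup x∉′ y∈)
  ... | there z   = z

DisjointLink : Link → Set
DisjointLink l = Disjoint (source l) (target l)

-- An equivalent form of `IsNet` that is easier to carry through constructions: given `unique`, the
-- single permutation `balanced` says that every position has one producer and is either consumed
-- once or a conclusion. Counting does not prevent a link from consuming its own output, hence
-- `link-disjoint`.
record Net (H : Hypergraph) (γ : List Pos) : Set where
  constructor net
  field
    unique        : Unique (targets H)
    balanced      : targets H ↭ sources H ++ γ
    link-disjoint : All DisjointLink H

open Net

IsNet⇒Net : ∀ {S} → IsNet S → Net (links S) (conclusions S)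
IsNet⇒Net {S} N = record
  { unique        = at-most-one-target
  ; balanced      = Unique-⊆-↭ at-most-one-target
      (Unique.++⁺ at-most-one-source conclusions-distinct
        (λ (v , w) → proj₂ (Equivalence.to (conclusions-spec _) w) v))
      to from
  ; link-disjoint = All.map WellFormedLink.disjoint links-wf
  }
  where
  open IsNet N
  to : ∀ {p} → p ∈ˡ targets (links S) → p ∈ˡ sources (links S) ++ conclusions S
  to {p} p∈ with p ∈? sources (links S)
  ... | yes p∈s = ∈-++⁺ˡ p∈s
  ... | no  p∉s = ∈-++⁺ʳ (sources (links S))
    (Equivalence.from (conclusions-spec p) (∈-++⁺ʳ (sources (links S)) p∈ , p∉s))
  from : ∀ {p} → p ∈ˡ sources (links S) ++ conclusions S → p ∈ˡ targets (links S)
  from p∈ with ∈-++⁻ (sources (links S)) p∈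
  ... | inj₁ p∈s = some-target (∈-++⁺ˡ p∈s)
  ... | inj₂ p∈c = some-target (proj₁ (Equivalence.to (conclusions-spec _) p∈c))

Net⇒IsNet : Net H γ → IsNet ⟨ H , γ ⟩
Net⇒IsNet {H = H} {γ = γ} (net u b d) = record
  { links-wf             = wf H (Unique-++⁻ˡ (sources H) us) u d
  ; some-target          = some
  ; at-most-one-target   = u
  ; at-most-one-source   = Unique-++⁻ˡ (sources H) us
  ; conclusions-distinct = Unique-++⁻ʳ (sources H) us
  ; conclusions-spec     = λ p → mk⇔
      (λ p∈ → ∈-++⁺ʳ (sources H) (↭.∈-resp-↭ (↭-sym b) (∈-++⁺ʳ (sources H) p∈))
            , λ p∈s → Unique-++⇒Disjoint (sources H) us (p∈s , p∈))
      (λ (p∈ , p∉) → other p∉ (∈-++⁻ (sources H) (↭.∈-resp-↭ b (some p∈))))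
  }
  where
  us = Unique-resp-↭ b u
  some : ∀ {p} → p ∈ˡ positions H → p ∈ˡ targets H
  some p∈ with ∈-++⁻ (sources H) p∈
  ... | inj₁ p∈s = ↭.∈-resp-↭ (↭-sym b) (∈-++⁺ˡ p∈s)
  ... | inj₂ p∈t = p∈t
  other : ∀ {p} → ¬ p ∈ˡ sources H → p ∈ˡ sources H ⊎ p ∈ˡ γ → p ∈ˡ γ
  other p∉ (inj₁ p∈) = contradiction p∈ p∉
  other p∉ (inj₂ p∈) = p∈
  wf : ∀ H → Unique (sources H) → Unique (targets H) → All DisjointLink H → All WellFormedLink H
  wf []      _ _ []      = []
  wf (l ∷ H) s t (d ∷ ds) = record
    { source-distinct = Unique-++⁻ˡ (source l) s
    ; target-distinct = Unique-++⁻ˡ (target l) t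
    ; disjoint        = d
    } ∷ wf H (Unique-++⁻ʳ (source l) s) (Unique-++⁻ʳ (target l) t) ds

Net⇒Linear : Net H γ → Linear H
Net⇒Linear {H = H} (net u b _) = linear (Unique-++⁻ˡ (sources H) (Unique-resp-↭ b u)) u

source⇒target : Net H γ → p ∈ˡ sources H → p ∈ˡ targets H
source⇒target N p∈ = ↭.∈-resp-↭ (↭-sym (balanced N)) (∈-++⁺ˡ p∈)

conclusion⇒target : Net H γ → p ∈ˡ γ → p ∈ˡ targets H
conclusion⇒target {H = H} N p∈ = ↭.∈-resp-↭ (↭-sym (balanced N)) (∈-++⁺ʳ (sources H) p∈)

∈-sources : l ∈ˡ H → p ∈ˡ source l → p ∈ˡ sources H
∈-sources (here refl) p∈ = ∈-++⁺ˡ p∈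
∈-sources {H = l ∷ _} (there l∈) p∈ = ∈-++⁺ʳ (source l) (∈-sources l∈ p∈)

∈-targets : l ∈ˡ H → p ∈ˡ target l → p ∈ˡ targets H
∈-targets (here refl) p∈ = ∈-++⁺ˡ p∈
∈-targets {H = l ∷ _} (there l∈) p∈ = ∈-++⁺ʳ (target l) (∈-targets l∈ p∈)

Unique-map⇒injective : ∀ {f : Pos → Pos} {xs x y} → Unique (map f xs) →
                       x ∈ˡ xs → y ∈ˡ xs → f x ≡ f y → x ≡ y
Unique-map⇒injective (_ ∷ _)  (here refl) (here refl) _ = refl
Unique-map⇒injective {f} (x∉ ∷ _) (here refl) (there y) e =
  contradiction e (All.lookup x∉ (∈-map⁺ f y))
Unique-map⇒injective {f} (x∉ ∷ _) (there x) (here refl) e =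
  contradiction (sym e) (All.lookup x∉ (∈-map⁺ f x))
Unique-map⇒injective (_ ∷ u)  (there x)   (there y)   e = Unique-map⇒injective u x y e

-- Every position of a net is a target, so `f` being injective on the targets makes it injective on
-- all positions.
Net-rename : ∀ f → Unique (map f (targets H)) → Net H γ → Net (rename f H) (map f γ)
Net-rename {H = H} {γ = γ} f u N = record
  { unique        = subst Unique (sym (targets-rename f H)) u
  ; balanced      = subst₂ _↭_ (sym (targets-rename f H))
      (trans (List.map-++ f (sources H) γ) (cong (_++ map f γ) (sym (sources-rename f H))))
      (↭.map⁺ f (balanced N))
  ; link-disjoint = All.map⁺ (All.tabulate λ {l} l∈ → subst₂ Disjoint
      (sym (source-rename f l)) (sym (target-rename f l)) (disjoint l∈))
  }
  where
  disjoint : ∀ {l} → l ∈ˡ H → Disjoint (map f (source l)) (map f (target l))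
  disjoint {l} l∈ (v , w) with x , x∈ , refl ← ∈-map⁻ f v | y , y∈ , e ← ∈-map⁻ f w
    with refl ← Unique-map⇒injective u (source⇒target N (∈-sources l∈ x∈)) (∈-targets l∈ y∈) e =
    All.lookup (link-disjoint N) l∈ (x∈ , y∈)

Net-resp-↭ : H ↭ K → γ ↭ δ → Net H γ → Net K δ
Net-resp-↭ e f (net u b d) = net
  (Unique-resp-↭ (targets-≋ (↭⇒≋ e)) u)
  (↭-trans (↭-sym (targets-≋ (↭⇒≋ e))) (↭-trans b (↭.++⁺ (sources-≋ (↭⇒≋ e)) f)))
  (↭.All-resp-↭ e d)

Net-++ : Net H γ → Net K δ → Unique (targets H ++ targets K) → Net (H ++ K) (γ ++ δ)
Net-++ {H = H} {γ = γ} {K = K} {δ = δ} (net _ b d) (net _ b′ d′) u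
  = net (subst Unique (sym (targets-++ H K)) u)
        (subst₂ _↭_ (sym (targets-++ H K)) (cong (_++ (γ ++ δ)) (sym (sources-++ H K)))
          (↭-trans (↭.++⁺ b b′) (++-interchange (sources H) γ (sources K) δ)))
        (All.++⁺ d d′)

Net-cut : Net H (a ∷ b ∷ γ) → Net (cut a b ∷ H) γ
Net-cut {H = H} {a = a} {b = b} (net u bal d) = net u
  (↭-trans bal (↭.shifts (sources H) (a ∷ b ∷ []))) ((λ ()) ∷ d)

Net-cuts : ∀ γ δ → Net H (γ ++ δ) →
           Net (zipWith cut γ δ ++ H) (drop (length δ) γ ++ drop (length γ) δ)
Net-cuts []      []      N = N
Net-cuts []      (b ∷ δ) N = N
Net-cuts (a ∷ γ) []      N = N
Net-cuts (a ∷ γ) (b ∷ δ) N =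
  Net-resp-↭ (↭.shift _ (zipWith cut γ δ) _) ↭-refl
    (Net-cuts γ δ (Net-cut (Net-resp-↭ ↭-refl (prep a (↭.shift b γ δ)) N)))

Net-tensor : Net H (a ∷ b ∷ γ) → ¬ p ∈ˡ targets H → Net (tensor a b p ∷ H) (p ∷ γ)
Net-tensor {H = H} {a = a} {b = b} {γ = γ} {p = p} N@(net u bal d) p∉ = net
  (∉⇒All _ p∉ ∷ u)
  (↭-trans (prep p (↭-trans bal (↭.shifts (sources H) (a ∷ b ∷ []))))
    (↭-sym (↭.shift p (a ∷ b ∷ sources H) γ)))
  ((λ where
      (here refl , here refl) → p∉ (conclusion⇒target N (here refl))
      (there (here refl) , here refl) → p∉ (conclusion⇒target N (there (here refl)))) ∷ d)

Net-par : Net H (a ∷ b ∷ γ) → ¬ p ∈ˡ targets H → Net (par a b p ∷ H) (p ∷ γ)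
-- Sources and targets of a par link are those of the tensor link on the same positions, so the
-- three fields have the same content.
Net-par N p∉ with Net-tensor N p∉
... | net u b (d ∷ ds) = net u b (d ∷ ds)

-- The mediating map for positions seen as the coproduct of the even ones (`left`) and the odd ones
-- (`right`). Every change of names in a glued net is obtained from it.
copair : (Pos → Pos) → (Pos → Pos) → Pos → Pos
copair f g 0             = f 0
copair f g 1             = g 0
copair f g (suc (suc n)) = copair (f ∘ suc) (g ∘ suc) n

copair-left : ∀ f g p → copair f g (left p) ≡ f p
copair-left f g zero = refl
copair-left f g (suc p) rewrite +-suc p (p + 0) = copair-left (f ∘ suc) (g ∘ suc) p

copair-right : ∀ f g p → copair f g (right p) ≡ g p
copair-right f g zero = refl
copair-right f g (suc p) rewrite +-suc p (p + 0) = copair-right (f ∘ suc) (g ∘ suc) p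

left-injective : ∀ {p q} → left p ≡ left q → p ≡ q
left-injective {p} {q} e =
  trans (sym (copair-left id id p)) (trans (cong (copair id id) e) (copair-left id id q))

right-injective : ∀ {p q} → right p ≡ right q → p ≡ q
right-injective {p} {q} e =
  trans (sym (copair-right id id p)) (trans (cong (copair id id) e) (copair-right id id q))

left≢right : ∀ {p q} → left p ≢ right q
left≢right {p} {q} e
  with () ← trans (sym (copair-left (const 0) (const 1) p))
                  (trans (cong (copair (const 0) (const 1)) e) (copair-right (const 0) (const 1) q))

Unique-left-right : Unique as → Unique bs → Unique (map left as ++ map right bs)
Unique-left-right {as = as} {bs = bs} u v = Unique.++⁺
  (Unique.map⁺ left-injective u) (Unique.map⁺ right-injective v)
  λ (x , y) → disjoint (∈-map⁻ left x) (∈-map⁻ right y)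
  where
  disjoint : ∀ {x} → ∃[ p ] p ∈ˡ as × x ≡ left p → ∃[ q ] q ∈ˡ bs × x ≡ right q → _
  disjoint (p , _ , refl) (q , _ , e) = left≢right {p} {q} e

Net-∥ : Net H γ → Net K δ → Net (H ⊕ K) (map left γ ++ map right δ)
Net-∥ {H = H} {K = K} M N = Net-++
  (Net-rename left (Unique.map⁺ left-injective (unique M)) M)
  (Net-rename right (Unique.map⁺ right-injective (unique N)) N)
  (subst₂ (λ x y → Unique (x ++ y)) (sym (targets-rename left H)) (sym (targets-rename right K))
    (Unique-left-right (unique M) (unique N)))

Net-∷∷ : ∀ S T → Net (links S) (conclusions S) → Net (links T) (conclusions T) →
         Net (links (S ∷∷ T)) (conclusions (S ∷∷ T))
Net-∷∷ ⟨ H , γ ⟩ ⟨ K , δ ⟩ M N = subst₂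
  (λ m n → Net (zipWith cut (map left γ) (map right δ) ++ (H ⊕ K))
               (drop m (map left γ) ++ drop n (map right δ)))
  (List.length-map right δ) (List.length-map left γ)
  (Net-cuts (map left γ) (map right δ) (Net-∥ M N))

-- By definition `interaction left right S T` is `links (S ∷∷ T)`; other `f` and `g` describe the
-- same interaction inside a larger gluing.
interaction : (f g : Pos → Pos) → PreNet → PreNet → Hypergraph
interaction f g S T = zipWith cut (map f (conclusions S)) (map g (conclusions T)) ++
                      rename f (links S) ++ rename g (links T)

rename-cuts : ∀ f γ δ → rename f (zipWith cut γ δ) ≡ zipWith cut (map f γ) (map f δ)
rename-cuts f []      δ       = refl
rename-cuts f (_ ∷ γ) []      = refl
rename-cuts f (_ ∷ γ) (_ ∷ δ) = cong (_ ∷_) (rename-cuts f γ δ)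

map-∘-≗ : ∀ {f g h : Pos → Pos} → (∀ x → f (g x) ≡ h x) → ∀ xs → map f (map g xs) ≡ map h xs
map-∘-≗ e xs = trans (sym (List.map-∘ xs)) (List.map-cong e xs)

rename-≗ : ∀ {f g} → (∀ x → f x ≡ g x) → ∀ H → rename f H ≡ rename g H
rename-≗ e H = rename-cong H (All.universal e _) (All.universal e _)

rename-∘-≗ : ∀ {f g h} → (∀ x → f (g x) ≡ h x) → ∀ H → rename f (rename g H) ≡ rename h H
rename-∘-≗ {f} {g} e H = trans (rename-∘ f g H) (rename-≗ e H)

rename-interaction : ∀ {h f g f′ g′} → (∀ x → h (f x) ≡ f′ x) → (∀ x → h (g x) ≡ g′ x) → ∀ S T →
  rename h (interaction f g S T) ≡ interaction f′ g′ S T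
rename-interaction {h} {f} {g} ef eg ⟨ H , γ ⟩ ⟨ K , δ ⟩ =
  trans (rename-++ h (zipWith cut (map f γ) (map g δ)) _)
    (cong₂ _++_ (trans (rename-cuts h (map f γ) (map g δ))
                       (cong₂ (zipWith cut) (map-∘-≗ ef γ) (map-∘-≗ eg δ)))
      (trans (rename-++ h (rename f H) (rename g K)) (cong₂ _++_ (rename-∘-≗ ef H) (rename-∘-≗ eg K))))

zipWith-cut-comm : ∀ γ δ → zipWith cut γ δ ≋ zipWith cut δ γ
zipWith-cut-comm []      []      = ≋-refl
zipWith-cut-comm []      (_ ∷ δ) = ≋-refl
zipWith-cut-comm (_ ∷ γ) []      = ≋-refl
zipWith-cut-comm (_ ∷ γ) (_ ∷ δ) = cut-swap ∷≋ zipWith-cut-comm γ δ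

interaction-comm : ∀ f g S T → interaction f g S T ≋ interaction g f T S
interaction-comm f g S T = ≋.++⁺ (zipWith-cut-comm (map f (conclusions S)) (map g (conclusions T)))
                                 (≋.++-comm (rename f (links S)) (rename g (links T)))

-- Orthogonality in terms of goodness

⟶*-conclusions : ∀ {S T} → S ⟶* T → conclusions T ≡ conclusions S
⟶*-conclusions ε        = refl
⟶*-conclusions (s ◅ ss) = trans (⟶*-conclusions ss) (_⟶_.conclusions-≡ s)

drop-≡-[]⁻ : ∀ n (xs : List Pos) → drop n xs ≡ [] → length xs ≤ n
drop-≡-[]⁻ n xs e = m∸n≡0⇒m≤n (trans (sym (List.length-drop n xs)) (cong length e))

drop-all : ∀ (xs : List Pos) → drop (length xs) xs ≡ []
drop-all []       = refl
drop-all (_ ∷ xs) = drop-all xs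

-- Reduction keeps the conclusions and `✠ 0` has none, so neither side can have a conclusion left
-- over.
⊥⇒#≡ : ∀ S T → S ⊥ T → # S ≡ # T
⊥⇒#≡ S T red with e ← ⟶*-conclusions red = ≤-antisym
  (subst (_≤ # T) (List.length-map left (conclusions S))
    (drop-≡-[]⁻ (# T) (map left (conclusions S)) (List.++-conicalˡ _ _ (sym e))))
  (subst (_≤ # S) (List.length-map right (conclusions T))
    (drop-≡-[]⁻ (# S) (map right (conclusions T)) (List.++-conicalʳ _ _ (sym e))))

#≡⇒closed : ∀ S T → # S ≡ # T → conclusions (S ∷∷ T) ≡ []
#≡⇒closed S T e = cong₂ _++_
  (trans (cong (λ n → drop n (map left (conclusions S)))
           (trans (sym e) (sym (List.length-map left (conclusions S)))))
         (drop-all (map left (conclusions S))))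
  (trans (cong (λ n → drop n (map right (conclusions T)))
           (trans e (sym (List.length-map right (conclusions T)))))
         (drop-all (map right (conclusions T))))

⊥⇒Good : ∀ f g S T → S ⊥ T → Good (interaction f g S T)
⊥⇒Good f g S T red = subst Good (rename-interaction (copair-left f g) (copair-right f g) S T)
  (Good-rename (copair f g) (⟶*⇒Good red))

Good⇒⊥ : ∀ S T → IsNet S → IsNet T → # S ≡ # T → Good (links (S ∷∷ T)) → S ⊥ T
Good⇒⊥ S T M N e g = subst (λ γ → ⟨ links (S ∷∷ T) , γ ⟩ ⟶* ✠ 0) (sym (#≡⇒closed S T e))
  (Good⇒⟶* g (Net⇒Linear (Net-∷∷ S T (IsNet⇒Net M) (IsNet⇒Net N))))

-- Goodness ignores the order of the inputs of cuts, and the two nets may trade `left` for `right`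
-- by renaming.
⊥-sym : ∀ S T → IsNet S → IsNet T → S ⊥ T → T ⊥ S
⊥-sym S T M N red = Good⇒⊥ T S N M (sym (⊥⇒#≡ S T red))
  (Good-resp-≋ (interaction-comm right left S T) (⊥⇒Good right left S T red))

-- Types

private variable
  𝐀 𝐀′ 𝐁 𝐁′ : NetSet

⊥-unit : (∀ {S} → S ∈ 𝐀 → IsNet S) → ∀ {S} → S ∈ 𝐀 → S ∈ 𝐀 ^⊥ ^⊥
⊥-unit nets {S} S∈ = nets S∈ , λ R (R-net , R⊥) → ⊥-sym R S R-net (nets S∈) (R⊥ S S∈)

⊥⊥-closed : ∀ {S} → S ∈ 𝐀 ^⊥ ^⊥ ^⊥ ^⊥ → S ∈ 𝐀 ^⊥ ^⊥
⊥⊥-closed (N , S⊥) = N , λ R R∈ → S⊥ R (⊥-unit proj₁ R∈)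

-- The invariant of the induction on formulas, for a formula and its dual together. As in a basis,
-- only an inclusion in the orthogonal is asked for. The presence of `✠ 1` on both sides also fixes
-- the number of conclusions, through `⊥⇒#≡`.
record Dual (𝐀 𝐀′ : NetSet) : Set where
  field
    closed  : ∀ {S} → S ∈ 𝐀 ^⊥ ^⊥ → S ∈ 𝐀
    closed′ : ∀ {S} → S ∈ 𝐀′ ^⊥ ^⊥ → S ∈ 𝐀′
    nets    : ∀ {S} → S ∈ 𝐀 → IsNet S
    nets′   : ∀ {S} → S ∈ 𝐀′ → IsNet S
    ✠∈      : ✠ 1 ∈ 𝐀
    ✠∈′     : ✠ 1 ∈ 𝐀′
    ⊆⊥      : ∀ {S} → S ∈ 𝐀′ → S ∈ 𝐀 ^⊥

  #≡1 : ∀ {S} → S ∈ 𝐀 → # S ≡ 1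
  #≡1 {S} S∈ = sym (⊥⇒#≡ (✠ 1) S (proj₂ (⊆⊥ ✠∈′) S S∈))

  ⊥-#≡1 : ∀ {S} → S ∈ 𝐀 ^⊥ → # S ≡ 1
  ⊥-#≡1 {S} (_ , S⊥) = ⊥⇒#≡ S (✠ 1) (S⊥ _ ✠∈)

Dual-sym : Dual 𝐀 𝐀′ → Dual 𝐀′ 𝐀
Dual-sym D = record
  { closed = closed′ ; closed′ = closed ; nets = nets′ ; nets′ = nets ; ✠∈ = ✠∈′ ; ✠∈′ = ✠∈
  ; ⊆⊥ = λ {S} S∈ → nets S∈ , λ R R∈ → ⊥-sym R S (nets′ R∈) (nets S∈) (proj₂ (⊆⊥ R∈) S S∈)
  }
  where open Dual D

✠-net : ∀ n → IsNet (✠ n)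
✠-net n = Net⇒IsNet (net (subst Unique (sym (List.++-identityʳ (upTo n))) (Unique.upTo⁺ n))
                         (↭-reflexive (List.++-identityʳ (upTo n))) ((λ ()) ∷ []))

LinkFirstTwo-tensor-net : ∀ {S N} → IsNet S → LinkFirstTwo tensor S N → IsNet N
LinkFirstTwo-tensor-net M (linkFirstTwo {H = H} p∉) =
  Net⇒IsNet (Net-tensor (IsNet⇒Net M) (p∉ ∘ ∈-++⁺ʳ (sources H)))

LinkFirstTwo-par-net : ∀ {S N} → IsNet S → LinkFirstTwo par S N → IsNet N
LinkFirstTwo-par-net M (linkFirstTwo {H = H} p∉) =
  Net⇒IsNet (Net-par (IsNet⇒Net M) (p∉ ∘ ∈-++⁺ʳ (sources H)))

-- In both interactions `S₁` is cut against the first conclusion of `S` and `S₂` against the second;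
-- only the names differ. A third conclusion of `S` would survive and contradict the hypothesis.
∷∷-assoc : ∀ S S₁ S₂ → IsNet S → IsNet S₁ → IsNet S₂ → 2 ≤ # S → # S₁ ≡ 1 → # S₂ ≡ 1 →
  S ∷∷ S₁ ⊥ S₂ → S ⊥ S₁ ∥ S₂
∷∷-assoc ⟨ H , p₁ ∷ [] ⟩ _ _ _ _ _ (s≤s ()) _ _ _
∷∷-assoc S@(⟨ H , p₁ ∷ p₂ ∷ _ ∷ _ ⟩) S₁@(⟨ H₁ , s₁ ∷ [] ⟩) S₂@(⟨ H₂ , s₂ ∷ [] ⟩) _ _ _ _ refl refl red
  with () ← ⊥⇒#≡ (S ∷∷ S₁) S₂ red
∷∷-assoc S@(⟨ H , p₁ ∷ p₂ ∷ [] ⟩) S₁@(⟨ H₁ , s₁ ∷ [] ⟩) S₂@(⟨ H₂ , s₂ ∷ [] ⟩) M M₁ M₂ _ refl refl red =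
  Good⇒⊥ S (S₁ ∥ S₂) M (Net⇒IsNet (Net-∥ (IsNet⇒Net M₁) (IsNet⇒Net M₂))) refl
  (Good-resp-≋ e (⊥⇒Good f (right ∘ right) (S ∷∷ S₁) S₂ red))
  where
  -- Inside `S ∷∷ (S₁ ∥ S₂)` the names of `S`, `S₁` and `S₂` are prefixed by `left`, `right ∘ left`
  -- and `right ∘ right`.
  f = copair left (right ∘ left)
  e = ≋-trans
    (≡⇒≋ (cong₂ _∷_ (cong₂ cut (copair-left left (right ∘ left) p₂) refl)
      (cong₂ _∷_ (cong₂ cut (copair-left left (right ∘ left) p₁)
                            (copair-right left (right ∘ left) s₁))
        (cong (_++ rename (right ∘ right) H₂) (trans (rename-++ f (rename left H) (rename right H₁))
          (cong₂ _++_ (rename-∘-≗ (copair-left left (right ∘ left)) H)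
                      (rename-∘-≗ (copair-right left (right ∘ left)) H₁)))))))
    (≋-trans (by (1 ∷ [])) (∼-refl ∷≋ ∼-refl ∷≋ ≋-trans
      (≋.++-assoc (rename left H) (rename (right ∘ left) H₁) (rename (right ∘ right) H₂))
      (≡⇒≋ (cong (rename left H ++_) (sym (trans (rename-++ right (rename left H₁) (rename right H₂))
        (cong₂ _++_ (rename-∘ right left H₁) (rename-∘ right right H₂))))))))

-- Below, `2` is the output of the connective link of `N₀`, so `left 2` is its name in `N₀ ∷∷ T`;
-- after the collapse it is renamed to `0`, the output of `✠ 1`.
✠⊥ : ∀ {t K} → IsNet ⟨ K , t ∷ [] ⟩ →
  Good (daimon (left 2 ∷ []) ∷ cut (left 2) (right t) ∷ rename right K) → ✠ 1 ⊥ ⟨ K , t ∷ [] ⟩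
✠⊥ {t} {K} N g = Good⇒⊥ (✠ 1) ⟨ K , t ∷ [] ⟩ (✠-net 1) N refl
  (Good-resp-≋ (by (1 ∷ [])) (subst Good
    (cong₂ (λ x H → daimon (0 ∷ []) ∷ cut 0 x ∷ H) (copair-right (const 0) right t)
      (rename-∘-≗ (copair-right (const 0) right) K))
    (Good-rename (copair (const 0) right) g)))

module _ (DA : Dual 𝐀 𝐀′) (DB : Dual 𝐁 𝐁′) where

  private
    module 𝐀 = Dual DA
    module 𝐁 = Dual DB

    ⊗-generator ⅋-generator ∥-generator : NetSet
    ⊗-generator N = ∃[ S ] S ∈ 𝐀 ∥ᵗ 𝐁 × LinkFirstTwo tensor S N
    ⅋-generator N = ∃[ S ] S ∈ 𝐀′ ⅄ 𝐁′ × LinkFirstTwo par S N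
    ∥-generator N = ∃[ S ] ∃[ T ] S ∈ 𝐀 × T ∈ 𝐁 × N ≡ S ∥ T

    ⊗-net : ∀ {N} → N ∈ ⊗-generator → IsNet N
    ⊗-net (_ , S∈ , N) = LinkFirstTwo-tensor-net (proj₁ S∈) N

    ⅋-net : ∀ {N} → N ∈ ⅋-generator → IsNet N
    ⅋-net (_ , S∈ , N) = LinkFirstTwo-par-net (proj₁ S∈) N

    ∥-net : ∀ {N} → N ∈ ∥-generator → IsNet N
    ∥-net (_ , _ , S∈ , T∈ , refl) =
      Net⇒IsNet (Net-∥ (IsNet⇒Net (𝐀.nets S∈)) (IsNet⇒Net (𝐁.nets T∈)))

    -- One direction of the adjunction between `∥` and `⅄`. The bound on `# S` holds wherever a par
    -- link can be put on two conclusions.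
    ⅄⊆∥⊥ : ∀ {S} → 2 ≤ # S → S ∈ 𝐀′ ⅄ 𝐁′ → S ∈ ∥-generator ^⊥
    ⅄⊆∥⊥ {S} 2≤ (M , S∷∷∈ , _) = M , λ where
      _ (S₁ , S₂ , S₁∈ , S₂∈ , refl) →
        ∷∷-assoc S S₁ S₂ M (𝐀.nets S₁∈) (𝐁.nets S₂∈) 2≤ (𝐀.#≡1 S₁∈) (𝐁.#≡1 S₂∈)
          (proj₂ (𝐁.⊆⊥ (S∷∷∈ S₁ (Dual.⊆⊥ (Dual-sym DA) S₁∈))) S₂ S₂∈)

    -- The new par and tensor links meet in a `par-tensor` redex, whose contractum is the
    -- interaction of the two nets before the links were added.
    ⅋⊆⊗⊥ : ∀ {N} → N ∈ ⅋-generator → N ∈ ⊗-generator ^⊥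
    ⅋⊆⊗⊥ N∈@(S , S∈ , linkFirstTwo {H = H} {p₁ = p₁} {p₂ = p₂} {ps = ps} {p = p} _) =
     ⅋-net N∈ , λ where
      R R∈@(S′ , S′∈ , linkFirstTwo {H = K} {p₁ = q₁} {p₂ = q₂} {ps = qs} {p = q} _) →
        let red = ⊥-sym S′ S (proj₁ S′∈) (proj₁ S∈) (proj₂ S′∈ S (⅄⊆∥⊥ (s≤s (s≤s z≤n)) S∈))
            Z   = zipWith cut (map left ps) (map right qs)
            HL  = rename left H
            KR  = rename right K
        in Good⇒⊥ _ R (⅋-net N∈) (⊗-net R∈) (suc-injective (⊥⇒#≡ S S′ red))
             (step {G = Z ++ HL ++ KR} par-tensor
               (≋-trans (∼-refl ∷≋ ≋-trans (≋.↭-shift Z (HL ++ _ ∷ KR))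
                  (∼-refl ∷≋ ≋-trans (≋.++⁺ˡ Z (≋.↭-shift HL KR)) (≋.↭-shift Z (HL ++ KR))))
                 (by (1 ∷ [])))
               (⊥⇒Good left right S S′ red))

    ✠∈⊗ : ✠ 1 ∈ 𝐀 ⊗ᵗ 𝐁
    ✠∈⊗ = ✠-net 1 , λ T (T-net , T⊥) →
      orthogonal T T-net (⊥-sym T N₀ T-net (⊗-net N₀∈) (T⊥ N₀ N₀∈)) (⊥⇒#≡ T N₀ (T⊥ N₀ N₀∈))
      where
      -- The net `✠ 1 ∥ ✠ 1`, whose positions are `left 0`, that is `0`, and `right 0`, that is `1`,
      -- with a tensor link of fresh output `2`.
      N₀ = ⟨ tensor 0 1 2 ∷ daimon (0 ∷ []) ∷ daimon (1 ∷ []) ∷ [] , 2 ∷ [] ⟩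
      N₀∈ : N₀ ∈ ⊗-generator
      N₀∈ = ✠ 1 ∥ ✠ 1 , ⊥-unit ∥-net (_ , _ , 𝐀.✠∈ , 𝐁.✠∈ , refl)
          , linkFirstTwo λ { (there (there ())) }
      orthogonal : ∀ T → IsNet T → N₀ ⊥ T → # T ≡ 1 → ✠ 1 ⊥ T
      orthogonal T@(⟨ _ , _ ∷ [] ⟩) T-net red refl = ✠⊥ T-net
        (collapse-tensor (⊥⇒Good left right N₀ T red)
          (Net⇒Linear (Net-∷∷ N₀ T (IsNet⇒Net (⊗-net N₀∈)) (IsNet⇒Net T-net)))
          (by (1 ∷ 1 ∷ 1 ∷ [])))

    -- Closedness of `𝐁′` turns membership of `✠ 2 ∷∷ T` into orthogonality to every `T′`; then the
    -- reductions of `✠ 1 ∷∷ T` and `✠ 1 ∷∷ T′` are spliced.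
    ✠∈⅄ : ✠ 2 ∈ 𝐀′ ⅄ 𝐁′
    ✠∈⅄ = ✠-net 2
        , (λ T T∈ → 𝐁.closed′ (Net⇒IsNet (Net-∷∷ (✠ 2) T (IsNet⇒Net (✠-net 2)) (IsNet⇒Net (proj₁ T∈)))
            , λ T′ T′∈ → orthogonal T T′ T∈ T′∈ (𝐀′.⊥-#≡1 T∈) (𝐁′.⊥-#≡1 T′∈)))
        , λ P Q P∈ _ → subst (_≤ 2) (sym (𝐀′.#≡1 P∈)) (s≤s z≤n)
      where
      module 𝐀′ = Dual (Dual-sym DA)
      module 𝐁′ = Dual (Dual-sym DB)
      orthogonal : ∀ T T′ → T ∈ 𝐀′ ^⊥ → T′ ∈ 𝐁′ ^⊥ → # T ≡ 1 → # T′ ≡ 1 → ✠ 2 ∷∷ T ⊥ T′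
      orthogonal T@(⟨ H , t ∷ [] ⟩) T′@(⟨ H′ , t′ ∷ [] ⟩) (N , T⊥) (N′ , T′⊥) refl refl =
        Good⇒⊥ (✠ 2 ∷∷ T) T′
          (Net⇒IsNet (Net-∷∷ (✠ 2) T (IsNet⇒Net (✠-net 2)) (IsNet⇒Net N))) N′ refl
          (Good-resp-≋
            (≋-trans (∼-refl ∷≋ ∼-refl ∷≋ ≋-trans
                (≋.↭-shift (rename (left ∘ right) H) (rename right H′))
                (∼-refl ∷≋ ≋.++⁺ʳ (rename right H′) (≡⇒≋ (sym (rename-∘ left right H)))))
              (by (2 ∷ 1 ∷ [])))
            -- The outputs `0` and `1` of `✠ 2` are called `left (left 0)` and `left (left 1)` here,
            -- that is `0` and `4`; each instance of `✠ 1` is given one of these names.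
            (splice (⊥⇒Good (const 0) (left ∘ right) (✠ 1) T
                (⊥-sym T (✠ 1) N (✠-net 1) (T⊥ _ 𝐀.✠∈′)))
              (by (1 ∷ []))
              (Good-resp-≋ (by (1 ∷ []))
                (⊥⇒Good (const 4) right (✠ 1) T′ (⊥-sym T′ (✠ 1) N′ (✠-net 1) (T′⊥ _ 𝐁.✠∈′))))))

    ✠∈⅋ : ✠ 1 ∈ 𝐀′ ⅋ᵗ 𝐁′
    ✠∈⅋ = ✠-net 1 , λ T (T-net , T⊥) →
      orthogonal T T-net (⊥-sym T N₀ T-net (⅋-net N₀∈) (T⊥ N₀ N₀∈)) (⊥⇒#≡ T N₀ (T⊥ N₀ N₀∈))
      where
      N₀ = ⟨ par 0 1 2 ∷ daimon (0 ∷ 1 ∷ []) ∷ [] , 2 ∷ [] ⟩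
      N₀∈ : N₀ ∈ ⅋-generator
      N₀∈ = ✠ 2 , ✠∈⅄ , linkFirstTwo λ { (there (there ())) }
      orthogonal : ∀ T → IsNet T → N₀ ⊥ T → # T ≡ 1 → ✠ 1 ⊥ T
      orthogonal T@(⟨ _ , _ ∷ [] ⟩) T-net red refl = ✠⊥ T-net
        (collapse-par (⊥⇒Good left right N₀ T red)
          (Net⇒Linear (Net-∷∷ N₀ T (IsNet⇒Net (⅋-net N₀∈)) (IsNet⇒Net T-net)))
          (by (1 ∷ 1 ∷ [])))

  -- Orthogonality of the generators extends to the types because taking orthogonals reverses
  -- inclusions.
  Dual-⊗-⅋ : Dual (𝐀 ⊗ᵗ 𝐁) (𝐀′ ⅋ᵗ 𝐁′)
  Dual-⊗-⅋ = record
    { closed  = ⊥⊥-closed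
    ; closed′ = ⊥⊥-closed
    ; nets    = proj₁
    ; nets′   = proj₁
    ; ✠∈      = ✠∈⊗
    ; ✠∈′     = ✠∈⅋
    ; ⊆⊥      = λ (M , P⊥) → M , λ R (R-net , R⊥) →
        P⊥ R (R-net , λ y y∈ → R⊥ y (⅋⊆⊗⊥ y∈))
    }

-- Renaming of nets within orthogonals

⊥⇒Good-id : ∀ S T → S ⊥ T → Good (zipWith cut (conclusions S) (conclusions T) ++ links S ++ links T)
⊥⇒Good-id S T red = subst Good
  (cong₂ _++_ (cong₂ (zipWith cut) (List.map-id (conclusions S)) (List.map-id (conclusions T)))
              (cong₂ _++_ (rename-id (links S)) (rename-id (links T))))
  (⊥⇒Good id id S T red)

⊥-rename : ∀ f P R → IsNet P → IsNet R → Unique (map f (targets (links P))) → P ⊥ R →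
           ⟨ rename f (links P) , map f (conclusions P) ⟩ ⊥ R
⊥-rename f P@(⟨ H , γ ⟩) R@(⟨ K , δ ⟩) M N u red = Good⇒⊥ ⟨ rename f H , map f γ ⟩ R
  (Net⇒IsNet (Net-rename f u (IsNet⇒Net M))) N (trans (List.length-map f γ) (⊥⇒#≡ P R red))
  (subst Good (cong₂ (λ x y → zipWith cut x (map right δ) ++ y ++ rename right K)
                (List.map-∘ γ) (sym (rename-∘ left f H)))
    (⊥⇒Good (left ∘ f) right P R red))

-- This allows the tests of an environment to be moved apart from a net or renamed along with it.
^⊥-rename : ∀ f {A P} → (∀ {S} → S ∈ A → IsNet S) → Unique (map f (targets (links P))) → P ∈ A ^⊥ →
            ⟨ rename f (links P) , map f (conclusions P) ⟩ ∈ A ^⊥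
^⊥-rename f nets u (M , P⊥) = Net⇒IsNet (Net-rename f u (IsNet⇒Net M))
  , λ R R∈ → ⊥-rename f _ R M (nets R∈) u (P⊥ R R∈)

-- The map `copair id id` undoes both `left` and `right`. It is injective on the positions of the
-- parallel composition because the two nets were disjoint beforehand.
∥-intro : ∀ {A B : NetSet} → (∀ {S} → S ∈ A → IsNet S) → (∀ {S} → S ∈ B → IsNet S) →
  ⟨ H , γ ⟩ ∈ A → ⟨ K , δ ⟩ ∈ B → Unique (targets H ++ targets K) → ⟨ H ++ K , γ ++ δ ⟩ ∈ A ∥ᵗ B
∥-intro {H = H} {γ = γ} {K = K} {δ = δ} netsA netsB S∈ T∈ u = N , λ R (M , R⊥) → subst (_⊥ R)
    (cong₂ ⟨_,_⟩ links≡ conclusions≡)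
    (⊥-rename (copair id id) S∥T R N∥ M
      (subst Unique (trans (sym (trans (cong targets links≡) (targets-++ H K)))
                            (targets-rename _ (H ⊕ K))) u)
      (⊥-sym R S∥T M N∥ (R⊥ S∥T (_ , _ , S∈ , T∈ , refl))))
  where
  M₁ = IsNet⇒Net (netsA S∈)
  M₂ = IsNet⇒Net (netsB T∈)
  S∥T = ⟨ H , γ ⟩ ∥ ⟨ K , δ ⟩
  N∥ = Net⇒IsNet (Net-∥ M₁ M₂)
  N  = Net⇒IsNet (Net-++ M₁ M₂ u)
  links≡ : rename (copair id id) (H ⊕ K) ≡ H ++ K
  links≡ = trans (rename-++ _ (rename left H) (rename right K)) (cong₂ _++_
    (trans (rename-∘-≗ (copair-left id id) H) (rename-id H))
    (trans (rename-∘-≗ (copair-right id id) K) (rename-id K)))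
  conclusions≡ : map (copair id id) (map left γ ++ map right δ) ≡ γ ++ δ
  conclusions≡ = trans (List.map-++ _ (map left γ) (map right δ)) (cong₂ _++_
    (trans (map-∘-≗ (copair-left id id) γ) (List.map-id γ))
    (trans (map-∘-≗ (copair-right id id) δ) (List.map-id δ)))

-- The nets representing the premises of a rule are nets because the one
-- representing its conclusion is.  The converse fails: an isomorphism ignores the
-- value of `to` on conclusions that are not positions.

Net-cut⁻ : Net (cut a b ∷ H) γ → Net H (a ∷ b ∷ γ)
Net-cut⁻ {a = a} {b = b} {H = H} (net u bal (_ ∷ d)) =
  net u (↭-trans bal (↭-sym (↭.shifts (sources H) (a ∷ b ∷ [])))) d

Net-tensor⁻ : Net (tensor a b p ∷ H) (γ ++ p ∷ []) → Net H (a ∷ b ∷ γ)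
Net-tensor⁻ {a = a} {b = b} {p = p} {H = H} {γ = γ} (net (_ ∷ u) bal (_ ∷ d)) = net u
  (↭.drop-∷ (↭-trans bal (↭-trans
    (↭-trans (↭.++⁺ˡ (a ∷ b ∷ sources H) (↭.++-comm γ (p ∷ []))) (↭.shift p (a ∷ b ∷ sources H) γ))
    (prep p (↭-sym (↭.shifts (sources H) (a ∷ b ∷ [])))))))
  d

Net-par⁻ : Net (par a b p ∷ H) (γ ++ p ∷ []) → Net H (a ∷ b ∷ γ)
Net-par⁻ (net u bal (d ∷ ds)) = Net-tensor⁻ (net u bal (d ∷ ds))

-- Parity tells the two halves apart, and for lists without repetition equal membership is enough
-- for a permutation.
left-right-↭⁻ : ∀ {as as′ bs bs′} → Unique (map left as ++ map right bs) →
  map left as ++ map right bs ↭ map left as′ ++ map right bs′ → as ↭ as′ × bs ↭ bs′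
left-right-↭⁻ {as} {as′} {bs} {bs′} u e =
    Unique-⊆-↭ (Unique.map⁻ (Unique-++⁻ˡ (map left as) u))
                (Unique.map⁻ (Unique-++⁻ˡ (map left as′) u′))
      (inˡ as′ bs′ ∘ ↭.∈-resp-↭ e ∘ ∈-++⁺ˡ ∘ ∈-map⁺ left)
      (inˡ as bs ∘ ↭.∈-resp-↭ (↭-sym e) ∘ ∈-++⁺ˡ ∘ ∈-map⁺ left)
  , Unique-⊆-↭ (Unique.map⁻ (Unique-++⁻ʳ (map left as) u))
                (Unique.map⁻ (Unique-++⁻ʳ (map left as′) u′))
      (inʳ as′ bs′ ∘ ↭.∈-resp-↭ e ∘ ∈-++⁺ʳ (map left as) ∘ ∈-map⁺ right)
      (inʳ as bs ∘ ↭.∈-resp-↭ (↭-sym e) ∘ ∈-++⁺ʳ (map left as′) ∘ ∈-map⁺ right)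
  where
  u′ = Unique-resp-↭ e u
  inˡ : ∀ xs ys {x} → left x ∈ˡ map left xs ++ map right ys → x ∈ˡ xs
  inˡ xs ys {x} x∈ with ∈-++⁻ (map left xs) x∈
  ... | inj₁ l with y , y∈ , e ← ∈-map⁻ left l rewrite left-injective {x} {y} e = y∈
  ... | inj₂ r with y , _ , e ← ∈-map⁻ right r = ⊥-elim (left≢right {x} {y} e)
  inʳ : ∀ xs ys {x} → right x ∈ˡ map left xs ++ map right ys → x ∈ˡ ys
  inʳ xs ys {x} x∈ with ∈-++⁻ (map left xs) x∈
  ... | inj₁ l with y , _ , e ← ∈-map⁻ left l = ⊥-elim (left≢right {y} {x} (sym e))
  ... | inj₂ r with y , y∈ , e ← ∈-map⁻ right r rewrite right-injective {x} {y} e = y∈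

DisjointLink-rename⁻ : ∀ f H → All DisjointLink (rename f H) → All DisjointLink H
DisjointLink-rename⁻ f H d = All.map
  (λ {l} d {_} (v , w) → d ( subst (_ ∈ˡ_) (sym (source-rename f l)) (∈-map⁺ f v)
                       , subst (_ ∈ˡ_) (sym (target-rename f l)) (∈-map⁺ f w)))
  (All.map⁻ d)

Net-⊕⁻ : Net (H ⊕ K) (map left γ ++ map right δ) → Net H γ × Net K δ
Net-⊕⁻ {H = H} {K = K} {γ = γ} {δ = δ} (net u bal d) =
    net (Unique.map⁻ (Unique-++⁻ˡ (map left (targets H)) u′)) (proj₁ bal′)
        (DisjointLink-rename⁻ left H (All.++⁻ˡ (rename left H) d))
  , net (Unique.map⁻ (Unique-++⁻ʳ (map left (targets H)) u′)) (proj₂ bal′)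
        (DisjointLink-rename⁻ right K (All.++⁻ʳ (rename left H) d))
  where
  targets≡ : targets (H ⊕ K) ≡ map left (targets H) ++ map right (targets K)
  targets≡ = trans (targets-++ (rename left H) (rename right K))
                   (cong₂ _++_ (targets-rename left H) (targets-rename right K))
  sources≡ : sources (H ⊕ K) ≡ map left (sources H) ++ map right (sources K)
  sources≡ = trans (sources-++ (rename left H) (rename right K))
                   (cong₂ _++_ (sources-rename left H) (sources-rename right K))
  u′ = subst Unique targets≡ u
  bal′ = left-right-↭⁻ u′ (↭-trans
    (subst₂ (λ x y → x ↭ y ++ map left γ ++ map right δ) targets≡ sources≡ bal)
    (↭-trans (++-interchange (map left (sources H)) (map right (sources K)) (map left γ) (map right δ))
      (↭-reflexive (sym (cong₂ _++_ (List.map-++ left (sources H) γ)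
                                    (List.map-++ right (sources K) δ))))))

-- Adequacy of the interpretation

module Adequacy {𝓥 : Variables} (𝓑 : Basis 𝓥) (approximable : Approximable 𝓑) where

  private variable
    Γ Δ : Sequent 𝓥
    A B : Formula 𝓥
    S T : PreNet
    E : Hypergraph

  duality : ∀ A → Dual (⟦ 𝓑 ⟧ᶠ A) (⟦ 𝓑 ⟧ᶠ (A ᗮ))
  duality (var X) = record
    { closed  = proj₁ (Basis.isType 𝓑 X)
    ; closed′ = proj₁ (Basis.isType 𝓑 _)
    ; nets    = proj₁ ∘ proj₂ (Basis.isType 𝓑 X)
    ; nets′   = proj₁ ∘ proj₂ (Basis.isType 𝓑 _)
    ; ✠∈      = approximable X
    ; ✠∈′     = approximable _
    ; ⊆⊥      = Basis.dual-⊆ 𝓑 X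
    }
  duality (A ⊗ B) = Dual-⊗-⅋ (duality A) (duality B)
  -- The dual of `A ⅋ B` is a tensor, so the lemma is applied to the dual formulas and then
  -- reversed.
  duality (A ⅋ B) = Dual-sym (Dual-⊗-⅋ (Dual-sym (duality A)) (Dual-sym (duality B)))

  module D (A : Formula 𝓥) = Dual (duality A)

  ⟦_⟧ : Formula 𝓥 → NetSet
  ⟦_⟧ = ⟦ 𝓑 ⟧ᶠ

  -- A test for each conclusion, together with the cut that attaches it. Disjointness is not part of
  -- the definition: it is demanded once, of the net and all its tests together, as uniqueness of
  -- the targets.
  data Env : Sequent 𝓥 → List Pos → Hypergraph → Set where
    []  : Env [] [] []
    _∷_ : ⟨ H , t ∷ [] ⟩ ∈ ⟦ A ⟧ ^⊥ → Env Γ γ E → Env (A ∷ Γ) (c ∷ γ) (cut c t ∷ H ++ E)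

  Env-balanced : Env Γ γ E → sources E ↭ γ ++ targets E
  Env-balanced [] = ↭-refl
  Env-balanced {γ = c ∷ γ} (_∷_ {H = H} {t = t} {E = E} T∈ e) = prep c (begin
    t ∷ sources (H ++ E)              ≡⟨ cong (t ∷_) (sources-++ H E) ⟩
    (t ∷ sources H) ++ sources E      ↭⟨ ↭.++⁺ (↭.++-comm (t ∷ []) (sources H)) (Env-balanced e) ⟩
    (sources H ++ t ∷ []) ++ γ ++ targets E ↭⟨ ↭.++⁺ʳ _ (balanced (IsNet⇒Net (proj₁ T∈))) ⟨
    targets H ++ γ ++ targets E       ↭⟨ ↭.shifts (targets H) γ ⟩
    γ ++ targets H ++ targets E       ≡⟨ cong (γ ++_) (targets-++ H E) ⟨
    γ ++ targets (H ++ E)             ∎)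
    where open PermutationReasoning

  Env-disjoint : Env Γ γ E → All DisjointLink E
  Env-disjoint []       = []
  Env-disjoint (T∈ ∷ e) = (λ ()) ∷ All.++⁺ (link-disjoint (IsNet⇒Net (proj₁ T∈))) (Env-disjoint e)

  Net-Env : Net H (γ ++ δ) → Env Γ γ E → Unique (targets (H ++ E)) → Net (H ++ E) δ
  Net-Env {H = H} {γ = γ} {δ = δ} {E = E} N e u = net u
    (begin
      targets (H ++ E)                       ≡⟨ targets-++ H E ⟩
      targets H ++ targets E                 ↭⟨ ↭.++⁺ʳ _ (balanced N) ⟩
      (sources H ++ γ ++ δ) ++ targets E     ≡⟨ cong (_++ targets E) (List.++-assoc (sources H) γ δ) ⟨
      ((sources H ++ γ) ++ δ) ++ targets E   ↭⟨ swap-right (sources H ++ γ) δ (targets E) ⟩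
      ((sources H ++ γ) ++ targets E) ++ δ   ≡⟨ cong (_++ δ) (List.++-assoc (sources H) γ (targets E)) ⟩
      (sources H ++ γ ++ targets E) ++ δ     ↭⟨ ↭.++⁺ʳ δ (↭.++⁺ˡ (sources H) (Env-balanced e)) ⟨
      (sources H ++ sources E) ++ δ          ≡⟨ cong (_++ δ) (sources-++ H E) ⟨
      sources (H ++ E) ++ δ                  ∎)
    (All.++⁺ (link-disjoint N) (Env-disjoint e))
    where open PermutationReasoning

  Env-rename : ∀ f → Unique (map f (targets E)) → Env Γ γ E → Env Γ (map f γ) (rename f E)
  Env-rename f u [] = []
  Env-rename f u (_∷_ {H = H} {A = A} {E = E} T∈ e)
    with u′ ← subst Unique (trans (cong (map f) (targets-++ H E))
                                  (List.map-++ f (targets H) (targets E))) u =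
    subst (Env _ _) (cong (_ ∷_) (sym (rename-++ f H E)))
      (^⊥-rename f (D.nets A) (Unique-++⁻ˡ (map f (targets H)) u′) T∈
        ∷ Env-rename f (Unique-++⁻ʳ (map f (targets H)) u′) e)

  Env-++⁺ : ∀ {E₁ E₂} → Env Γ γ E₁ → Env Δ δ E₂ → Env (Γ ++ Δ) (γ ++ δ) (E₁ ++ E₂)
  Env-++⁺ []                          e₂ = e₂
  Env-++⁺ (_∷_ {H = H} {E = E} T∈ e₁) e₂ =
    subst (Env _ _) (cong (_ ∷_) (sym (List.++-assoc H E _))) (T∈ ∷ Env-++⁺ e₁ e₂)

  Env-++⁻ : ∀ Γ γ → length γ ≡ length Γ → Env (Γ ++ Δ) (γ ++ δ) E →
            ∃[ E₁ ] ∃[ E₂ ] Env Γ γ E₁ × Env Δ δ E₂ × E ≡ E₁ ++ E₂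
  Env-++⁻ []      []      _ e = [] , _ , [] , e , refl
  Env-++⁻ (A ∷ Γ) (c ∷ γ) l (_∷_ {H = H} T∈ e)
    with E₁ , E₂ , e₁ , e₂ , refl ← Env-++⁻ Γ γ (suc-injective l) e =
    _ , E₂ , T∈ ∷ e₁ , e₂ , cong (_ ∷_) (sym (List.++-assoc H E₁ E₂))

  -- Unfolding the nested ⅄ into one interaction makes the formulas play symmetric
  -- roles, so that exchange is immediate.  The renaming f leaves the names of the
  -- tests free.
  Realises : Sequent 𝓥 → PreNet → Set
  Realises Γ S = ∀ f {E} → Env Γ (map f (conclusions S)) E →
    Unique (targets (rename f (links S) ++ E)) → Good (rename f (links S) ++ E)

  Unique-part : ∀ G → H ≋ G ++ K → Unique (targets H) → Unique (targets G)
  Unique-part {K = K} G e u = Unique-++⁻ˡ (targets G)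
    (subst Unique (targets-++ G K) (Unique-resp-↭ (targets-≋ e) u))

  Realises-≋ : links S ≋ links T → conclusions S ≡ conclusions T → Realises Γ S → Realises Γ T
  Realises-≋ e refl r f {E} env u = Good-resp-≋ e′
    (r f env (Unique-resp-↭ (targets-≋ (≋-sym e′)) u))
    where e′ = ≋.++⁺ʳ E (rename-≋ f e)

  -- A form of currying: the tests on `Γ` become part of the net. A later renaming `g` also acts on
  -- them, which is why environments must be stable under renaming.
  partial : ∀ Γ γ f → length γ ≡ length Γ → Realises (Γ ++ Δ) ⟨ H , γ ++ δ ⟩ → Env Γ (map f γ) E →
            Realises Δ ⟨ rename f H ++ E , map f δ ⟩
  partial {H = H} {δ = δ} {E = E} Γ γ f _ r e g {E′} e′ u = subst Good H≡
    (r (g ∘ f) (subst (λ γ → Env _ γ _) γ≡ (Env-++⁺ (Env-rename g u′ e) e′))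
      (subst (Unique ∘ targets) (sym H≡) u))
    where
    γ≡ : map g (map f γ) ++ map g (map f δ) ≡ map (g ∘ f) (γ ++ δ)
    γ≡ = trans (cong₂ _++_ (sym (List.map-∘ γ)) (sym (List.map-∘ δ))) (sym (List.map-++ (g ∘ f) γ δ))
    H≡ : rename (g ∘ f) H ++ rename g E ++ E′ ≡ rename g (rename f H ++ E) ++ E′
    H≡ = trans (cong (_++ (rename g E ++ E′)) (sym (rename-∘ g f H)))
      (trans (sym (List.++-assoc (rename g (rename f H)) (rename g E) E′))
        (cong (_++ E′) (sym (rename-++ g (rename f H) E))))
    u′ : Unique (map g (targets E))
    u′ = subst Unique (targets-rename g E) (Unique-part (rename g E)
      (≋-trans (≡⇒≋ (trans (cong (_++ E′) (rename-++ g (rename f H) E))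
                            (List.++-assoc (rename g (rename f H)) (rename g E) E′)))
               (≋.shifts (rename g (rename f H)) (rename g E)))
      u)

  ⅄-intro : ∀ Γ {X : NetSet} → (∀ S → IsNet S → # S ≡ length Γ → Realises Γ S → S ∈ X) →
    ∀ S → IsNet S → # S ≡ suc (length Γ) → Realises (A ∷ Γ) S → S ∈ ⟦ A ⟧ ⅄ X
  ⅄-intro {A = A} Γ {X} realises∈ S@(⟨ H , c ∷ γ ⟩) N l r = N
    , (λ T T∈ → residual T T∈ (D.⊥-#≡1 A T∈))
    , λ P Q P∈ _ → subst (_≤ # S) (sym (D.#≡1 A P∈)) (s≤s z≤n)
    where
    residual : ∀ T → T ∈ ⟦ A ⟧ ^⊥ → # T ≡ 1 → S ∷∷ T ∈ X
    residual T@(⟨ K , t ∷ [] ⟩) T∈ refl = realises∈ (S ∷∷ T)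
      (Net⇒IsNet (Net-∷∷ S T (IsNet⇒Net N) (IsNet⇒Net (proj₁ T∈))))
      (trans (cong length (sym γ≡)) (trans (List.length-map left γ) (suc-injective l)))
      (Realises-≋ e γ≡ (partial (A ∷ []) (c ∷ []) left refl r
        (^⊥-rename right (D.nets A) (Unique.map⁺ right-injective (unique (IsNet⇒Net (proj₁ T∈)))) T∈ ∷ [])))
      where
      γ≡ : map left γ ≡ map left γ ++ drop (length γ) []
      γ≡ = sym (trans (cong (map left γ ++_) (List.drop-[] (length γ))) (List.++-identityʳ (map left γ)))
      e : rename left H ++ cut (left c) (right t) ∷ rename right K ++ [] ≋ links (S ∷∷ T)
      e = ≋-trans (≋-sym (float (rename left H)))
            (∼-refl ∷≋ ≋-trans (≋.++⁺ˡ (rename left H) (≋.++-identityʳ (rename right K)))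
              (≡⇒≋ (cong (_++ (H ⊕ K)) (sym (List.zipWith-zeroʳ cut (map left γ))))))

  -- Each `⅄` consumes one test, kept apart from the net by `right`. On the last formula, surviving
  -- all tests means being in the biorthogonal, and the type is closed.
  realises⇒∈ : ∀ Γ S → IsNet S → # S ≡ length Γ → Realises Γ S → S ∈ ⟦ 𝓑 ⟧ˢ Γ
  realises⇒∈ [] S@(⟨ H , [] ⟩) N _ r = N , λ where
    _ refl → Good⇒⊥ S ∅ N (Net⇒IsNet (net [] ↭-refl [])) refl
      (r left [] (unique (Net-∷∷ S ∅ (IsNet⇒Net N) (net [] ↭-refl []))))
  realises⇒∈ (A ∷ []) S@(⟨ H , c ∷ [] ⟩) N _ r = 
    D.closed A (N , λ T T∈ → orthogonal T T∈ (D.⊥-#≡1 A T∈))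
    where
    orthogonal : ∀ T → T ∈ ⟦ A ⟧ ^⊥ → # T ≡ 1 → S ⊥ T
    orthogonal T@(⟨ K , t ∷ [] ⟩) T∈ refl = Good⇒⊥ S T N (proj₁ T∈) refl
      (Good-resp-≋ (≋-sym e) (r left
        (^⊥-rename right (D.nets A) (Unique.map⁺ right-injective (unique (IsNet⇒Net (proj₁ T∈)))) T∈ ∷ [])
        (Unique-resp-↭ (targets-≋ e) (unique (Net-∷∷ S T (IsNet⇒Net N) (IsNet⇒Net (proj₁ T∈)))))))
      where
      e : links (S ∷∷ T) ≋ rename left H ++ cut (left c) (right t) ∷ rename right K ++ []
      e = ≋-trans (∼-refl ∷≋ ≋.++⁺ˡ (rename left H) (≋-sym (≋.++-identityʳ (rename right K))))
            (float (rename left H))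
  realises⇒∈ (A ∷ Γ@(_ ∷ _)) S N l r = ⅄-intro Γ (realises⇒∈ Γ) S N l r

  ≅-net : S ≅ T → Net (links S) (conclusions S) → Net (links T) (conclusions T)
  ≅-net {S} {T} i N = subst (Net (links T)) conclusions-≅
    (Net-resp-↭ links-≅ ↭-refl (Net-rename to to-unique N))
    where
    open _≅_ i
    to-unique : Unique (map to (targets (links S)))
    to-unique = Unique.map⁻ {f = from} (subst Unique
      (sym (trans (sym (List.map-∘ (targets (links S)))) (trans (map-cong-All (All.tabulate (from∘to ∘ ∈-++⁺ʳ (sources (links S)))))
        (List.map-id _)))) (unique N))

  -- The free renaming in `Realises` absorbs the isomorphism, being instantiated with `f ∘ from`.
  -- That `S` is a net makes its conclusions positions, the only names on which `from` is known to
  -- invert `to`.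
  ≅-realises : S ≅ T → Net (links S) (conclusions S) →
               # T ≡ length Γ × Realises Γ T → # S ≡ length Γ × Realises Γ S
  ≅-realises {S} {T} i N (l , r) =
    trans (trans (sym (List.length-map to (conclusions S))) (cong length conclusions-≅)) l
    , λ f {E} env u →
      let H≋ : rename (f ∘ from) (links T) ≋ rename f (links S)
          H≋ = ≋-trans (rename-≋ (f ∘ from) (↭⇒≋ (↭-sym links-≅))) (≡⇒≋ (trans
                 (rename-∘ (f ∘ from) to (links S))
                 (rename-cong (links S) (All.tabulate (cong f ∘ from∘to ∘ ∈-++⁺ˡ))
                   (All.tabulate (cong f ∘ from∘to ∘ ∈-++⁺ʳ (sources (links S)))))))
          γ≡ : map f (conclusions S) ≡ map (f ∘ from) (conclusions T)
          γ≡ = trans (map-cong-All (All.tabulate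
                   (sym ∘ cong f ∘ from∘to ∘ ∈-++⁺ʳ (sources (links S)) ∘ conclusion⇒target N)))
                 (trans (List.map-∘ (conclusions S)) (cong (map (f ∘ from)) conclusions-≅))
      in Good-resp-≋ (≋.++⁺ʳ E H≋) (r (f ∘ from) (subst (λ γ → Env _ γ E) γ≡ env)
           (Unique-resp-↭ (targets-≋ (≋.++⁺ʳ E (≋-sym H≋))) u))
    where open _≅_ i

  daimon-good : Env Γ γ E → Good (daimon γ ∷ E)
  daimon-good [] = done ≋-refl
  daimon-good {γ = c ∷ γ} (_∷_ {H = H} {t = t} {A = A} T∈@(N , T⊥) e) = splice
    -- The only position of `✠ 1` is its output, which `const c` turns into the first output of the
    -- large daimon.
    (⊥⇒Good (const c) id (✠ 1) T₀ (⊥-sym T₀ (✠ 1) N (✠-net 1) (T⊥ (✠ 1) (D.✠∈ A))))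
    (≋-trans (by (1 ∷ [])) (∼-refl ∷≋ ∼-refl ∷≋ ≡⇒≋ (rename-id H)))
    (daimon-good e)
    where T₀ = ⟨ H , t ∷ [] ⟩

  ++-length-cancel : ∀ {X Y : Set} (xs : List X) (ys : List Y) {us vs} → length us ≡ length vs →
    length (xs ++ us) ≡ length (ys ++ vs) → length xs ≡ length ys
  ++-length-cancel xs ys {us} {vs} e e′ = +-cancelʳ-≡ (length us) (length xs) (length ys)
    (trans (sym (List.length-++ xs)) (trans e′ (trans (List.length-++ ys)
      (cong (length ys +_) (sym e)))))

  ++-length-cong : ∀ {X Y : Set} (xs : List X) (ys : List Y) {us vs} → length xs ≡ length ys →
    length us ≡ length vs → length (xs ++ us) ≡ length (ys ++ vs)
  ++-length-cong xs ys e e′ = trans (List.length-++ xs) (trans (cong₂ _+_ e e′) (sym (List.length-++ ys)))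

  premise-net : ∀ γ f → Net H (γ ++ δ) → Env Γ (map f γ) E → Unique (targets (rename f H ++ E)) →
                Net (rename f H ++ E) (map f δ)
  premise-net {H = H} {δ = δ} γ f N env u = Net-Env
    (subst (Net (rename f H)) (List.map-++ f γ δ)
      (Net-rename f (subst Unique (targets-rename f H) (Unique-part (rename f H) ≋-refl u)) N))
    env u

  -- With the context plugged by its tests, a premise becomes an ordinary element of the type of its
  -- active formula, to which the definitions of `⊗ᵗ` and of orthogonality apply.
  premise : ∀ Γ γ f → length (γ ++ a ∷ []) ≡ length (Γ ++ A ∷ []) → Net H (γ ++ a ∷ []) →
    Realises (Γ ++ A ∷ []) ⟨ H , γ ++ a ∷ [] ⟩ → Env Γ (map f γ) E →
    Unique (targets (rename f H ++ E)) → ⟨ rename f H ++ E , f a ∷ [] ⟩ ∈ ⟦ A ⟧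
  premise Γ γ f l N r env u = realises⇒∈ (_ ∷ []) _ (Net⇒IsNet (premise-net γ f N env u)) refl
    (partial Γ γ f (++-length-cancel γ Γ refl l) r env)

  fresh-output : Net H γ → Unique (p ∷ targets H) → ¬ p ∈ˡ positions H
  fresh-output {H = H} N (p∉ ∷ _) p∈ with ∈-++⁻ (sources H) p∈
  ... | inj₁ p∈s = All.lookup p∉ (source⇒target N p∈s) refl
  ... | inj₂ p∈t = All.lookup p∉ p∈t refl

  tensor-intro : ∀ {N} → S ∈ ⟦ A ⟧ ∥ᵗ ⟦ B ⟧ → LinkFirstTwo tensor S N → N ∈ ⟦ A ⊗ B ⟧
  tensor-intro S∈ N = ⊥-unit (λ (_ , S∈ , N) → LinkFirstTwo-tensor-net (proj₁ S∈) N) (_ , S∈ , N)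

  par-intro : ∀ {N} → S ∈ ⟦ A ⟧ ⅄ ⟦ B ⟧ → LinkFirstTwo par S N → N ∈ ⟦ A ⅋ B ⟧
  par-intro S∈ N = ⊥-unit (λ (_ , S∈ , N) → LinkFirstTwo-par-net (proj₁ S∈) N) (_ , S∈ , N)

  plug : ∀ A → ⟨ H , p ∷ [] ⟩ ∈ ⟦ A ⟧ → ⟨ K , t ∷ [] ⟩ ∈ ⟦ A ⟧ ^⊥ → Good (cut p t ∷ H ++ K)
  plug {H = H} {p = p} {K = K} {t = t} A S∈ (N , T⊥) =
    ⊥⇒Good-id S₀ T₀ (⊥-sym T₀ S₀ N (D.nets A S∈) (T⊥ S₀ S∈))
    where
    S₀ = ⟨ H , p ∷ [] ⟩
    T₀ = ⟨ K , t ∷ [] ⟩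

  -- Once `Γ` is plugged, the premise is an element of `⟦ A ⟧ ⅄ ⟦ B ⟧`; the par link makes it a
  -- generator of `⟦ A ⅋ B ⟧`, which is then opposed to the last test.
  ⅋-realises : ∀ Γ γ → length (γ ++ a ∷ b ∷ []) ≡ length (Γ ++ A ∷ B ∷ []) → Net H (γ ++ a ∷ b ∷ []) →
    Realises (Γ ++ A ∷ B ∷ []) ⟨ H , γ ++ a ∷ b ∷ [] ⟩ →
    Realises (Γ ++ (A ⅋ B) ∷ []) ⟨ par a b p ∷ H , γ ++ p ∷ [] ⟩
  ⅋-realises {a = a} {b = b} {A = A} {B = B} {H = H} {p = p} Γ γ l N r f env u
    with l′ ← ++-length-cancel γ Γ refl l
    with E₁ , _ , env₁ , _∷_ {H = K} {t = t} T∈ [] , refl ←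
      Env-++⁻ Γ (map f γ) (trans (List.length-map f γ) l′)
        (subst (λ γ → Env _ γ _) (List.map-++ f γ (p ∷ [])) env) =
    Good-resp-≋ e (plug (A ⅋ B) (par-intro {A = A} {B = B} S₀∈ (linkFirstTwo (fresh-output N₀ u₀))) T∈)
    where
    H₀ = rename f H ++ E₁
    e : cut (f p) t ∷ par (f a) (f b) (f p) ∷ H₀ ++ K ≋
        par (f a) (f b) (f p) ∷ rename f H ++ E₁ ++ cut (f p) t ∷ K ++ []
    e = ≋-trans (by (1 ∷ [])) (∼-refl ∷≋ ≋-trans (float H₀) (≋-trans
          (≋.++-assoc (rename f H) E₁ (cut (f p) t ∷ K))
          (≋.++⁺ˡ (rename f H) (≋.++⁺ˡ E₁ (∼-refl ∷≋ ≋-sym (≋.++-identityʳ K))))))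
    u₀ : Unique (f p ∷ targets H₀)
    u₀ = Unique-part (par (f a) (f b) (f p) ∷ H₀)
      (≋-trans (≋-sym e) (≋-trans (by (1 ∷ [])) (∼-refl ∷≋ float H₀))) u
    N₀ : Net H₀ (f a ∷ f b ∷ [])
    N₀ = premise-net γ f N env₁ (Unique-tail u₀)
    S₀∈ : ⟨ H₀ , f a ∷ f b ∷ [] ⟩ ∈ ⟦ A ⟧ ⅄ ⟦ B ⟧
    S₀∈ = realises⇒∈ (A ∷ B ∷ []) _ (Net⇒IsNet N₀) refl (partial Γ γ f l′ r env₁)

  ≋-interchange : ∀ G H K L → (G ++ H) ++ (K ++ L) ≋ (G ++ K) ++ (H ++ L)
  ≋-interchange G H K L = ≋-trans (≋.++-assoc G H (K ++ L))
    (≋-trans (≋.++⁺ˡ G (≋.shifts H K)) (≋-sym (≋.++-assoc G K (H ++ L))))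

  rename-⊕ : ∀ f H K → rename f (H ⊕ K) ≡ rename (f ∘ left) H ++ rename (f ∘ right) K
  rename-⊕ f H K = trans (rename-++ f (rename left H) (rename right K))
                         (cong₂ _++_ (rename-∘ f left H) (rename-∘ f right K))

  ⊗-realises : ∀ Γ γ Δ δ →
    length (γ ++ a ∷ []) ≡ length (Γ ++ A ∷ []) → length (δ ++ b ∷ []) ≡ length (Δ ++ B ∷ []) →
    Net H (γ ++ a ∷ []) → Net K (δ ++ b ∷ []) →
    Realises (Γ ++ A ∷ []) ⟨ H , γ ++ a ∷ [] ⟩ → Realises (Δ ++ B ∷ []) ⟨ K , δ ++ b ∷ [] ⟩ →
    Realises (Γ ++ Δ ++ (A ⊗ B) ∷ [])
      ⟨ tensor (left a) (right b) p ∷ (H ⊕ K) , map left γ ++ map right δ ++ p ∷ [] ⟩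
  ⊗-realises {a = a} {A = A} {b = b} {B = B} {H = H} {K = K} {p = p} Γ γ Δ δ l m M N r s f env u
    with E₁ , _ , env₁ , env′ , refl ← Env-++⁻ Γ (map (f ∘ left) γ)
           (trans (List.length-map _ γ) (++-length-cancel γ Γ refl l))
           (subst (λ γ → Env _ γ _) (trans (List.map-++ f (map left γ) _)
             (cong₂ _++_ (sym (List.map-∘ γ)) refl)) env)
    with E₂ , _ , env₂ , _∷_ {H = L} {t = t} T∈ [] , refl ← Env-++⁻ Δ (map (f ∘ right) δ)
           (trans (List.length-map _ δ) (++-length-cancel δ Δ refl m))
           (subst (λ δ → Env _ δ _) (trans (List.map-++ f (map right δ) _)
             (cong₂ _++_ (sym (List.map-∘ δ)) refl)) env′) =
    Good-resp-≋ e (plug (A ⊗ B) (tensor-intro {A = A} {B = B}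
      (∥-intro (D.nets A) (D.nets B)
        (premise Γ γ (f ∘ left) l M r env₁ (Unique-++⁻ˡ (targets H₁) u₁))
        (premise Δ δ (f ∘ right) m N s env₂ (Unique-++⁻ʳ (targets H₁) u₁))
        u₁)
      (linkFirstTwo (fresh-output
        (Net-++ (premise-net γ (f ∘ left) M env₁ (Unique-++⁻ˡ (targets H₁) u₁))
                (premise-net δ (f ∘ right) N env₂ (Unique-++⁻ʳ (targets H₁) u₁)) u₁) u₀))) T∈)
    where
    H₁ = rename (f ∘ left) H ++ E₁
    H₂ = rename (f ∘ right) K ++ E₂
    tensor′ = tensor (f (left a)) (f (right b)) (f p)
    e : cut (f p) t ∷ tensor′ ∷ (H₁ ++ H₂) ++ L ≋
        tensor′ ∷ rename f (H ⊕ K) ++ E₁ ++ E₂ ++ cut (f p) t ∷ L ++ []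
    e = ≋-trans (by (1 ∷ [])) (∼-refl ∷≋ ≋-trans (float (H₁ ++ H₂)) (≋-trans
          (≋.++⁺ʳ (cut (f p) t ∷ L) (≋-trans
            (≋-interchange (rename (f ∘ left) H) E₁ (rename (f ∘ right) K) E₂)
            (≡⇒≋ (cong (_++ (E₁ ++ E₂)) (sym (rename-⊕ f H K))))))
          (≋-trans (≋.++-assoc (rename f (H ⊕ K)) (E₁ ++ E₂) (cut (f p) t ∷ L))
            (≋.++⁺ˡ (rename f (H ⊕ K)) (≋-trans (≋.++-assoc E₁ E₂ (cut (f p) t ∷ L))
              (≋.++⁺ˡ E₁ (≋.++⁺ˡ E₂ (∼-refl ∷≋ ≋-sym (≋.++-identityʳ L)))))))))
    u₀ : Unique (f p ∷ targets (H₁ ++ H₂))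
    u₀ = Unique-part (tensor′ ∷ H₁ ++ H₂)
      (≋-trans (≋-sym e) (≋-trans (by (1 ∷ [])) (∼-refl ∷≋ float (H₁ ++ H₂)))) u
    u₁ : Unique (targets H₁ ++ targets H₂)
    u₁ = subst Unique (targets-++ H₁ H₂) (Unique-tail u₀)

  -- Each plugged premise acts as a test for the other, by the inclusion of the dual type in the
  -- orthogonal.
  cut-realises : ∀ Γ γ Δ δ A →
    length (γ ++ a ∷ []) ≡ length (Γ ++ A ∷ []) → length (δ ++ b ∷ []) ≡ length (Δ ++ A ᗮ ∷ []) →
    Net H (γ ++ a ∷ []) → Net K (δ ++ b ∷ []) →
    Realises (Γ ++ A ∷ []) ⟨ H , γ ++ a ∷ [] ⟩ → Realises (Δ ++ A ᗮ ∷ []) ⟨ K , δ ++ b ∷ [] ⟩ →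
    Realises (Γ ++ Δ) ⟨ cut (left a) (right b) ∷ (H ⊕ K) , map left γ ++ map right δ ⟩
  cut-realises {a = a} {b = b} {H = H} {K = K} Γ γ Δ δ A l m M N r s f env u
    with E₁ , E₂ , env₁ , env₂ , refl ← Env-++⁻ Γ (map (f ∘ left) γ)
           (trans (List.length-map _ γ) (++-length-cancel γ Γ refl l))
           (subst (λ γ → Env _ γ _) (trans (List.map-++ f (map left γ) _)
             (cong₂ _++_ (sym (List.map-∘ γ)) (sym (List.map-∘ δ)))) env) =
    Good-resp-≋ e (plug A
      (premise Γ γ (f ∘ left) l M r env₁ (Unique-++⁻ˡ (targets H₁) u₁))
      (D.⊆⊥ A (premise Δ δ (f ∘ right) m N s env₂ (Unique-++⁻ʳ (targets H₁) u₁))))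
    where
    H₁ = rename (f ∘ left) H ++ E₁
    H₂ = rename (f ∘ right) K ++ E₂
    e : cut (f (left a)) (f (right b)) ∷ H₁ ++ H₂ ≋
        cut (f (left a)) (f (right b)) ∷ rename f (H ⊕ K) ++ E₁ ++ E₂
    e = ∼-refl ∷≋ ≋-trans (≋-interchange (rename (f ∘ left) H) E₁ (rename (f ∘ right) K) E₂)
          (≡⇒≋ (cong (_++ (E₁ ++ E₂)) (sym (rename-⊕ f H K))))
    u₁ : Unique (targets H₁ ++ targets H₂)
    u₁ = subst Unique (targets-++ H₁ H₂) (Unique-resp-↭ (targets-≋ (≋-sym e)) u)

  ex-realises : ∀ Γ γ → length γ ≡ length Γ → Realises (Γ ++ A ∷ B ∷ Δ) ⟨ H , γ ++ a ∷ b ∷ δ ⟩ →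
                Realises (Γ ++ B ∷ A ∷ Δ) ⟨ H , γ ++ b ∷ a ∷ δ ⟩
  ex-realises {H = H} {a = a} {b = b} {δ = δ} Γ γ l r f env u
    with E₁ , _ , env₁ , _∷_ {H = K} {t = t} T∈ (_∷_ {H = L} {t = s} {E = E₂} R∈ env₂) , refl ←
      Env-++⁻ Γ (map f γ) (trans (List.length-map f γ) l)
        (subst (λ γ → Env _ γ _) (List.map-++ f γ (b ∷ a ∷ δ)) env) =
    Good-resp-≋ e (r f
      (subst (λ γ → Env _ γ _) (sym (List.map-++ f γ (a ∷ b ∷ δ))) (Env-++⁺ env₁ (R∈ ∷ T∈ ∷ env₂)))
      (Unique-resp-↭ (targets-≋ (≋-sym e)) u))
    where
    e : rename f H ++ E₁ ++ cut (f a) s ∷ L ++ cut (f b) t ∷ K ++ E₂ ≋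
        rename f H ++ E₁ ++ cut (f b) t ∷ K ++ cut (f a) s ∷ L ++ E₂
    e = ≋.++⁺ˡ (rename f H) (≋.++⁺ˡ E₁ (≋.shifts (cut (f a) s ∷ L) (cut (f b) t ∷ K)))

  premises-↭ : ∀ γ δ → left a ∷ right b ∷ map left γ ++ map right δ ↭
                       map left (γ ++ a ∷ []) ++ map right (δ ++ b ∷ [])
  premises-↭ {a = a} {b = b} γ δ = begin
    (left a ∷ []) ++ (right b ∷ []) ++ map left γ ++ map right δ
      ↭⟨ ++-interchange (left a ∷ []) (right b ∷ []) (map left γ) (map right δ) ⟩
    (left a ∷ map left γ) ++ (right b ∷ map right δ)
      ↭⟨ ↭.++⁺ (↭.++-comm (left a ∷ []) (map left γ)) (↭.++-comm (right b ∷ []) (map right δ)) ⟩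
    (map left γ ++ left a ∷ []) ++ (map right δ ++ right b ∷ [])
      ≡⟨ cong₂ _++_ (List.map-++ left γ (a ∷ [])) (List.map-++ right δ (b ∷ [])) ⟨
    map left (γ ++ a ∷ []) ++ map right (δ ++ b ∷ []) ∎
    where open PermutationReasoning

  length-tail : ∀ {X Y : Set} (xs : List X) (ys : List Y) {us vs} → length xs ≡ length ys →
    length (xs ++ us) ≡ length (ys ++ vs) → length us ≡ length vs
  length-tail xs ys {us} {vs} e e′ = +-cancelˡ-≡ (length xs) (length us) (length vs)
    (trans (sym (List.length-++ xs)) (trans e′ (trans (List.length-++ ys)
      (cong (_+ length vs) (sym e)))))

  -- The number of conclusions is established together with realisability because for the rules ⅋, ⊗
  -- and cut `Represents` does not say that `γ` is as long as `Γ`, and the environment is split at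
  -- that point.
  adequate : ∀ {π : MLL✠ Γ} → S Represents π → Net (links S) (conclusions S) →
             # S ≡ length Γ × Realises Γ S
  adequate {Γ = Γ} (✠-rep i) N = ≅-realises i N (List.length-upTo (length Γ) , λ f env u → daimon-good env)
  adequate (⅋-rep {Γ = Γ} {γ = γ} {a = a} {b = b} ρ _ i) N
    with M ← Net-resp-↭ ↭-refl (↭.++-comm (a ∷ b ∷ []) γ) (Net-par⁻ (≅-net i N))
    with l , r ← adequate ρ M =
    ≅-realises i N (++-length-cong γ Γ (++-length-cancel γ Γ refl l) refl , ⅋-realises Γ γ l M r)
  adequate (⊗-rep {Γ = Γ} {Δ = Δ} {H₁ = H₁} {H₂ = H₂} {γ = γ} {δ = δ}
                  {p = p} ρ₁ ρ₂ _ i) N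
    with M₁ , M₂ ← Net-⊕⁻ {H = H₁} {K = H₂} (Net-resp-↭ ↭-refl (premises-↭ γ δ)
           (Net-tensor⁻
             (subst (Net _) (sym (List.++-assoc (map left γ) (map right δ) (p ∷ []))) (≅-net i N))))
    with l , r ← adequate ρ₁ M₁ | m , s ← adequate ρ₂ M₂ =
    ≅-realises i N
      ( ++-length-cong (map left γ) Γ (trans (List.length-map left γ) (++-length-cancel γ Γ refl l))
          (++-length-cong (map right δ) Δ (trans (List.length-map right δ) (++-length-cancel δ Δ refl m)) refl)
      , ⊗-realises Γ γ Δ δ l m M₁ M₂ r s)
  adequate (cut-rep {Γ = Γ} {Δ = Δ} {A = A} {H₁ = H₁} {H₂ = H₂} {γ = γ} {δ = δ} ρ₁ ρ₂ i) N
    with M₁ , M₂ ← Net-⊕⁻ {H = H₁} {K = H₂} (Net-resp-↭ ↭-refl (premises-↭ γ δ) (Net-cut⁻ (≅-net i N)))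
    with l , r ← adequate ρ₁ M₁ | m , s ← adequate ρ₂ M₂ =
    ≅-realises i N
      ( ++-length-cong (map left γ) Γ (trans (List.length-map left γ) (++-length-cancel γ Γ refl l))
          (trans (List.length-map right δ) (++-length-cancel δ Δ refl m))
      , cut-realises Γ γ Δ δ A l m M₁ M₂ r s)
  adequate (ex-rep {Γ = Γ} {γ = γ} l ρ i) N
    with m , r ← adequate ρ (Net-resp-↭ ↭-refl (↭.++⁺ˡ γ (swap _ _ ↭-refl)) (≅-net i N)) =
    ≅-realises i N (++-length-cong γ Γ l (length-tail γ Γ l m) , ex-realises Γ γ l r)

theorem64 : (𝓥 : Variables) (𝓑 : Basis 𝓥) → Approximable 𝓑 →
    (S : PreNet) → IsNet S → (Γ : Sequent 𝓥) →
    S ⊢MLL✠ Γ → S ∈ ⟦_⟧ˢ 𝓑 Γ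
theorem64 𝓥 𝓑 approximable S N Γ (_ , ρ)
  with l , r ← Adequacy.adequate 𝓑 approximable ρ (IsNet⇒Net N) =
  Adequacy.realises⇒∈ 𝓑 approximable Γ S N l r
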